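{- For every $n\ge 4$, the graph $\mathcal{S}_n^0$ is connected.
   Context: A triangulated $2$-sphere is a finite simplicial complex whose geometric realization is homeomorphic to the $2$-sphere. Edge flip $ab\mapsto cd$: if $abc,abd$ are triangles and $cd$ is not an edge, replace $abc,abd$ by $acd,bcd$. A stacked $3$-ball is a simplicial complex obtained from a single tetrahedron by repeatedly gluing a new tetrahedron along exactly one boundary triangle, introducing one new vertex each time. A stacked $2$-sphere is a triangulated $2$-sphere isomorphic to the boundary of a stacked $3$-ball. For a stacked $2$-sphere $S$, $\overline{S}$ denotes the simplicial complex whose faces are all cliques of the edge graph of $S$; it is known that $\overline{S}$ is a stacked $3$-ball with boundary $S$, unique up to isomorphism. The dual graph $\Lambda(C)$ of a complex made of tetrahedra has the tetrahedra as nodes, adjacent iff they share a triangle. $\mathcal{S}_n^0$ is the graph whose nodes are the isomorphism classes of $n$-vertex stacked $2$-spheres $S$ such that $\Lambda(\overline{S})$ has no node of degree four, two nodes being adjacent iff a representative of one can be transformed into a representative of the other by a single edge flip. -}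

module Defs where

open import Data.Fin.Base using (Fin)
open import Data.Fin.Permutation
  using (Permutation′; _⟨$⟩ˡ_; _∘ₚ_; inverseʳ)
  renaming (id to idₚ; flip to _⁻¹ₚ)
open import Data.Fin.Subset
  using (Subset; inside; outside; ⁅_⁆; _∈_; _⊆_; _∪_; _∩_; ∣_∣)
open import Data.Fin.Subset.Properties using (∩-comm)
open import Data.List.Base using (List; length)
import Data.List.Membership.Setoid as Membership
import Data.List.Relation.Unary.Unique.Setoid as Unique
open import Data.Nat.Base using (ℕ; suc)
open import Data.Product using (Σ; Σ-syntax; ∃!; ∃-syntax; _×_; _,_; proj₁; proj₂)
open import Data.Sum.Base using (_⊎_; swap)
open import Data.Vec.Base using (_∷_; lookup; tabulate)
open import Data.Vec.Properties using (tabulate-cong; tabulate∘lookup; lookup∘tabulate)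
open import Function.Base using (_∘_)
open import Function.Bundles using (_⇔_)
open import Level using (Level; 0ℓ; _⊔_) renaming (suc to lsuc)
open import Relation.Binary.Bundles using (Setoid)
open import Relation.Binary.Construct.Closure.ReflexiveTransitive using (Star)
import Relation.Binary.Construct.On as On
open import Relation.Binary.Core using (Rel)
open import Relation.Binary.Definitions using (Symmetric; _Respectsˡ_)
open import Relation.Binary.PropositionalEquality
  using (_≡_; _≢_; refl; sym; trans; cong; subst)
  renaming (setoid to ≡-setoid)
open import Relation.Nullary.Negation using (¬_)
open import Relation.Unary using (Pred; U; _≐_)

private variable
  n : ℕ

-- The node type is a setoid so that isomorphism classes can be nodes.
-- Loops are not excluded: they affect neither connectedness nor, since
-- dual graphs have none, the degrees used below.

record Graph c ℓ₁ ℓ₂ : Set (lsuc (c ⊔ ℓ₁ ⊔ ℓ₂)) where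
  field
    nodes : Setoid c ℓ₁
  open Setoid nodes public using (_≈_) renaming (Carrier to Node)
  field
    Adjacent     : Rel Node ℓ₂
    Adjacent-sym : Symmetric Adjacent
    -- By symmetry, adjacency respects _≈_ on the right as well.
    Adjacent-resp : Adjacent Respectsˡ _≈_

module _ {c ℓ₁ ℓ₂ : Level} (G : Graph c ℓ₁ ℓ₂) where
  open Graph G
  open Membership nodes using () renaming (_∈_ to _∈ₗ_)
  open Unique nodes using () renaming (Unique to NoRepeats)

  Degree : Node → ℕ → Set (c ⊔ ℓ₁ ⊔ ℓ₂)
  Degree v k = Σ[ ns ∈ List Node ]
    length ns ≡ k × NoRepeats ns × (∀ w → Adjacent v w ⇔ w ∈ₗ ns)

  -- Steps along _≈_ are steps that stay at the same node.
  Path : Rel Node (c ⊔ ℓ₁ ⊔ ℓ₂)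
  Path = Star (λ v w → v ≈ w ⊎ Adjacent v w)

  -- A connected graph is nonempty by convention.
  Connected : Set (c ⊔ ℓ₁ ⊔ ℓ₂)
  Connected = Node × (∀ v w → Path v w)

-- Vertices are the elements of Fin n, all of which are used once IsComplex
-- holds; the empty set counts as a face.
Faces : ℕ → Set₁
Faces n = Pred (Subset n) 0ℓ

record IsComplex {n} (K : Faces n) : Set where
  field
    down-closed : ∀ {s t} → s ⊆ t → K t → K s
    vertex      : ∀ v → K ⁅ v ⁆

Edge : Faces n → Rel (Fin n) 0ℓ
Edge K u v = u ≢ v × K (⁅ u ⁆ ∪ ⁅ v ⁆)

Triangle Tetrahedron : Faces n → Faces n
Triangle    K t = K t × ∣ t ∣ ≡ 3
Tetrahedron K t = K t × ∣ t ∣ ≡ 4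

⟨_⟩ : Faces n → Faces n
⟨ F ⟩ s = ∃[ t ] F t × s ⊆ t

BoundaryTriangle : Faces n → Faces n
BoundaryTriangle K t =
  Triangle K t × ∃! _≡_ (λ u → Tetrahedron K u × t ⊆ u)

∂ : Faces n → Faces n
∂ K = ⟨ BoundaryTriangle K ⟩

-- Usually written with an overline.
Clique : Faces n → Faces n
Clique K s = ∀ {u v} → u ∈ s → v ∈ s → u ≢ v → Edge K u v

-- The image of a set under a permutation: j lies in it iff π⁻¹ j lies in s.
image : Permutation′ n → Subset n → Subset n
image π s = tabulate (λ j → lookup s (π ⟨$⟩ˡ j))

infix 4 _≅_
_≅_ : Rel (Faces n) 0ℓ
K ≅ L = ∃[ π ] K ≐ (L ∘ image π)

image-id : (s : Subset n) → image idₚ s ≡ s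
image-id = tabulate∘lookup

image-∘ : ∀ (π ρ : Permutation′ n) s → image ρ (image π s) ≡ image (π ∘ₚ ρ) s
image-∘ π ρ s = tabulate-cong λ j → lookup∘tabulate _ (ρ ⟨$⟩ˡ j)

image-inverse : ∀ (π : Permutation′ n) s → image π (image (π ⁻¹ₚ) s) ≡ s
image-inverse π s = trans
  (tabulate-cong λ j → trans (lookup∘tabulate _ (π ⟨$⟩ˡ j))
                             (cong (lookup s) (inverseʳ π)))
  (tabulate∘lookup s)

≅-refl : {K : Faces n} → K ≅ K
≅-refl {K = K} = idₚ ,
  (λ {s} → subst K (sym (image-id s))) , (λ {s} → subst K (image-id s))

≅-sym : {K L : Faces n} → K ≅ L → L ≅ K
≅-sym {L = L} (π , to , from) = π ⁻¹ₚ ,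
  (λ {s} → from ∘ subst L (sym (image-inverse π s))) ,
  (λ {s} → subst L (image-inverse π s) ∘ to)

≅-trans : {K L M : Faces n} → K ≅ L → L ≅ M → K ≅ M
≅-trans {M = M} (π , to , from) (ρ , to′ , from′) = π ∘ₚ ρ ,
  (λ {s} → subst M (image-∘ π ρ s) ∘ to′ ∘ to) ,
  (λ {s} → from ∘ from′ ∘ subst M (sym (image-∘ π ρ s)))

-- The nodes are the tetrahedra of K.  Two of them share a triangle iff
-- they have exactly three vertices in common; they are then distinct.
Λ : Faces n → Graph 0ℓ 0ℓ 0ℓ
Λ K = record
  { nodes         = On.setoid (≡-setoid (Subset _)) (proj₁ {B = Tetrahedron K})
  ; Adjacent      = λ (t , _) (u , _) → ∣ t ∩ u ∣ ≡ 3
  ; Adjacent-sym  = λ {(t , _)} {(u , _)} → trans (cong ∣_∣ (∩-comm u t))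
  ; Adjacent-resp = λ { refl e → e }
  }

-- Cone over the triangle t from a new vertex, numbered zero, glued to B;
-- the old vertices are shifted by one.
glue : Faces n → Subset n → Faces (suc n)
glue B t (outside ∷ s) = B s
glue B t (inside  ∷ s) = s ⊆ t

-- Stacked 3-balls, up to isomorphism.
data StackedBall : (n : ℕ) → Faces n → Set₁ where
  tetrahedron : StackedBall 4 U
  stack       : ∀ {n B t} → StackedBall n B → BoundaryTriangle B t →
                StackedBall (suc n) (glue B t)

-- That the geometric realization is a 2-sphere is not listed as a
-- condition: it holds for the boundary of every stacked 3-ball.
-- All vertices of a stacked ball lie on its boundary, so that the ball
-- has n vertices too.
record StackedSphere (n : ℕ) (S : Faces n) : Set₁ where
  field
    isComplex  : IsComplex S
    {ball}     : Faces n
    isBall     : StackedBall n ball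
    ≅-boundary : S ≅ ∂ ball

tri : Fin n → Fin n → Fin n → Subset n
tri a b c = ⁅ a ⁆ ∪ ⁅ b ⁆ ∪ ⁅ c ⁆

-- The flip ab ↦ cd.  S and T are pure of dimension two, so T is given by
-- its triangles; c ≢ d because ¬ Edge alone would allow c ≡ d.
record FlipAt {n} (S T : Faces n) (a b c d : Fin n) : Set where
  field
    abc    : Triangle S (tri a b c)
    abd    : Triangle S (tri a b d)
    c≢d    : c ≢ d
    no-cd  : ¬ Edge S c d
    result : T ≐ ⟨ (λ t → (Triangle S t × t ≢ tri a b c × t ≢ tri a b d)
                          ⊎ t ≡ tri a c d
                          ⊎ t ≡ tri b c d) ⟩

Flip : Rel (Faces n) 0ℓ
Flip S T = ∃[ a ] ∃[ b ] ∃[ c ] ∃[ d ] FlipAt S T a b c d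

record Is𝒮⁰ (n : ℕ) (S : Faces n) : Set₁ where
  field
    stackedSphere : StackedSphere n S
    noDegreeFour  : ∀ t → ¬ Degree (Λ (Clique S)) t 4

𝒮⁰-classes : ℕ → Setoid (lsuc 0ℓ) 0ℓ
𝒮⁰-classes n = record
  { Carrier       = Σ (Faces n) (Is𝒮⁰ n)
  ; _≈_           = λ (S , _) (T , _) → S ≅ T
  ; isEquivalence = record
    { refl  = λ {(S , _)} → ≅-refl {K = S}
    ; sym   = λ {(S , _)} {(T , _)} → ≅-sym {K = S} {T}
    ; trans = λ {(S , _)} {(T , _)} {(R , _)} → ≅-trans {K = S} {T} {R}
    }
  }

𝒮⁰ : ℕ → Graph (lsuc 0ℓ) 0ℓ (lsuc 0ℓ)
𝒮⁰ n = record
  { nodes         = 𝒮⁰-classes n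
  ; Adjacent      = λ x y → ∃[ x′ ] ∃[ y′ ] x ≈ x′ × y ≈ y′ ×
                      (Flip (proj₁ x′) (proj₁ y′) ⊎ Flip (proj₁ y′) (proj₁ x′))
  ; Adjacent-sym  = λ (x′ , y′ , p , q , f) → y′ , x′ , q , p , swap f
  ; Adjacent-resp = λ {_} {x} {z} e (x′ , y′ , p , q , f) →
                      x′ , y′ , C.trans {z} {x} {x′} (C.sym {x} {z} e) p , q , f
  }
  where
  module C = Setoid (𝒮⁰-classes n)
  open C using (_≈_)

{-# OPTIONS --safe #-}
module Submission where

-- A stacked ball is unfolded from one of its boundary triangles into an
-- ordered ternary tree, whose nodes are the tetrahedra and whose labels are
-- their apexes.  Rooting the tree at a leaf of the dual graph, no node of the
-- dual graph has degree four iff every node of the tree has an empty child,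
-- and rotating the tree at two neighbouring nodes that lack the same child
-- is an edge flip which leaves all labels in place.  Rotations bring every such
-- tree to the left comb, and any two labelled left combs of the same size
-- differ by a permutation of the vertices.

open import Defs

import Data.Bool.Properties as Bool
open import Data.Empty using (⊥-elim)
open import Data.Fin.Base using (Fin; zero; suc; punchOut)
open import Data.Fin.Patterns using (0F; 1F; 2F; 3F)
open import Data.Fin.Permutation
  using (Permutation′; permutation; _⟨$⟩ˡ_; _⟨$⟩ʳ_; inverseʳ; inverseˡ)
  renaming (id to idₚ)
open import Data.Fin.Properties
  using (_≟_; suc-injective; punchOut-injective; injective⇒≤; any?; pigeonhole)
  renaming (<⇒≢ to F<⇒≢)
open import Data.Fin.Subset
  using (Subset; inside; outside; ⁅_⁆; ⋃; ∁; _∈_; _∉_; _⊆_; _∪_; _∩_; _-_; ∣_∣; ⊥; ⊤)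
open import Data.Fin.Subset.Properties
open import Data.List.Base
  using (List; []; _∷_; _++_; _ʳ++_; map; length; lookup; allFin; tabulate)
import Data.List.Membership.Propositional as L
import Data.List.Membership.Propositional.Properties as LP
import Data.List.Membership.Setoid as SM
import Data.List.Membership.Setoid.Properties as SetoidMem
import Data.List.Properties as ListP
open import Data.List.Relation.Binary.Permutation.Propositional
  using (_↭_; prep; swap; ↭-refl; ↭-sym; ↭-trans; ↭⇒↭ₛ)
open import Data.List.Relation.Binary.Permutation.Propositional.Properties
  using (∈-resp-↭; ↭-length; ++⁺ˡ; ++⁺ʳ; shift)
import Data.List.Relation.Binary.Permutation.Setoid.Properties as SetoidPerm
open import Data.List.Relation.Unary.All as All using (All; []; _∷_)
import Data.List.Relation.Unary.All.Properties as AllP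
open import Data.List.Relation.Unary.AllPairs using (AllPairs; []; _∷_)
import Data.List.Relation.Unary.AllPairs.Properties as AllPairsP
open import Data.List.Relation.Unary.Any using (here; there)
open import Data.List.Relation.Unary.Unique.Propositional using (Unique)
import Data.List.Relation.Unary.Unique.Propositional.Properties as UniqueP
open import Data.Nat.Base using (ℕ; zero; suc; _+_; _≤_; _<_; z≤n; s≤s; s≤s⁻¹)
open import Data.Nat.Properties
  using (≤-antisym; ≤-trans; ≤-reflexive; <-irrefl; 1+n≰n; n≤1+n; n<1+n; +-comm)
  renaming (suc-injective to ℕ-suc-injective)
open import Data.Nat.Solver using (module +-*-Solver)
open import Data.Product using (∃-syntax; Σ-syntax; ∃!; _×_; _,_; proj₁; proj₂)
open import Data.Sum.Base using (_⊎_; inj₁; inj₂; [_,_]′; map₂) renaming (swap to ⊎-swap)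
open import Data.Unit.Base using (tt) renaming (⊤ to Unit)
import Data.Vec.Base as Vec
open import Data.Vec.Base using ([]; _∷_; here; there)
import Data.Vec.Properties as VecP
open import Function.Base using (_∘_; id)
open import Function.Bundles using (mk⇔; Equivalence)
open import Relation.Binary.Construct.Closure.Equivalence
  using (EqClosure; gmap; return; symmetric; transitive)
open import Relation.Binary.Construct.Closure.ReflexiveTransitive using (ε; _◅_; _◅◅_)
open import Relation.Binary.Construct.Closure.Symmetric using (fwd; bwd)
open import Relation.Binary.PropositionalEquality
  using (_≡_; _≢_; refl; sym; trans; cong; subst; ≢-sym; setoid)
open import Relation.Nullary using (¬_; Dec; yes; no; contradiction)
open import Relation.Nullary.Decidable using (decidable-stable)
open import Relation.Unary using (_≐_) renaming (U to Full)

-- Why rotations are flips: passing to a child replaces one corner by the apex and leaves the other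
-- two in their positions. If two neighbouring nodes lack the same child, their missing faces
-- therefore lie opposite one common corner `x`, and the two tetrahedra form a cone from `x` over a
-- quadrilateral. The flip exchanges its diagonals; the four triangles over its sides carry the
-- parent and three subtrees, which get regrouped as in associativity. Why the root is a leaf:
-- elsewhere the dual degree is one plus the number of children, but the root has no parent, so
-- three children there would only give degree three and escape the hypothesis. The obstacle is that
-- empty children may sit in different positions at neighbouring nodes, where no rotation applies.
-- Subtrees are therefore made into combs before they are joined: the nodes of a comb have two empty
-- children, which yields a common empty position in all cases but one. The hypothesis speaks of
-- `Clique S`, not of a given ball. The two agree because every edge of a stacked ball lies on its
-- boundary and every clique of its edge graph lies in a tetrahedron.

private variable
  n m : ℕ

-- Finite sets of vertices

⟦_⟧ : List (Fin n) → Subset n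
⟦ l ⟧ = ⋃ (map ⁅_⁆ l)

∈⟦⟧⁺ : ∀ {l} {x : Fin n} → x L.∈ l → x ∈ ⟦ l ⟧
∈⟦⟧⁺ (here refl) = x∈p∪q⁺ (inj₁ (x∈⁅x⁆ _))
∈⟦⟧⁺ (there x∈l) = x∈p∪q⁺ (inj₂ (∈⟦⟧⁺ x∈l))

∈⟦⟧⁻ : ∀ l {x : Fin n} → x ∈ ⟦ l ⟧ → x L.∈ l
∈⟦⟧⁻ []      x∈ = contradiction x∈ ∉⊥
∈⟦⟧⁻ (y ∷ l) x∈ with x∈p∪q⁻ ⁅ y ⁆ ⟦ l ⟧ x∈
... | inj₁ x∈y = here (x∈⁅y⁆⇒x≡y y x∈y)
... | inj₂ x∈l = there (∈⟦⟧⁻ l x∈l)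

∈-insert⁻ : ∀ {y x : Fin n} {t} → x ∈ ⁅ y ⁆ ∪ t → x ≡ y ⊎ x ∈ t
∈-insert⁻ {y = y} {t = t} x∈ with x∈p∪q⁻ ⁅ y ⁆ t x∈
... | inj₁ x∈y = inj₁ (x∈⁅y⁆⇒x≡y y x∈y)
... | inj₂ x∈t = inj₂ x∈t

∈-insert : ∀ (y : Fin n) {t} → y ∈ ⁅ y ⁆ ∪ t
∈-insert y = x∈p∪q⁺ (inj₁ (x∈⁅x⁆ y))

⊆-insert : ∀ (y : Fin n) t → t ⊆ ⁅ y ⁆ ∪ t
⊆-insert y t = q⊆p∪q ⁅ y ⁆ t

insert-⊆ : ∀ {y : Fin n} {t s} → y ∈ s → t ⊆ s → ⁅ y ⁆ ∪ t ⊆ s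
insert-⊆ y∈s t⊆s x∈ with ∈-insert⁻ x∈
... | inj₁ refl = y∈s
... | inj₂ x∈t  = t⊆s x∈t

insert-mono : ∀ {y : Fin n} {t s} → t ⊆ s → ⁅ y ⁆ ∪ t ⊆ ⁅ y ⁆ ∪ s
insert-mono {y = y} {s = s} t⊆s = insert-⊆ (∈-insert y) (⊆-insert y s ∘ t⊆s)

insert-drop : ∀ {v : Fin n} {t s} → v ∉ t → t ⊆ ⁅ v ⁆ ∪ s → t ⊆ s
insert-drop v∉t t⊆ x∈t with ∈-insert⁻ (t⊆ x∈t)
... | inj₁ refl = contradiction x∈t v∉t
... | inj₂ x∈s  = x∈s

⟦⟧-mono : ∀ {l l′ : List (Fin n)} → All (L._∈ l′) l → ⟦ l ⟧ ⊆ ⟦ l′ ⟧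
⟦⟧-mono {l = l} l⊆l′ x∈ = ∈⟦⟧⁺ (All.lookup l⊆l′ (∈⟦⟧⁻ l x∈))

⟦⟧-⊆ : ∀ {l : List (Fin n)} {s} → All (_∈ s) l → ⟦ l ⟧ ⊆ s
⟦⟧-⊆ {l = l} l⊆s x∈ = All.lookup l⊆s (∈⟦⟧⁻ l x∈)

∣insert∣ : ∀ (x : Fin n) s → x ∉ s → ∣ ⁅ x ⁆ ∪ s ∣ ≡ suc ∣ s ∣
∣insert∣ zero    (outside ∷ s) x∉s = cong (λ t → suc ∣ t ∣) (∪-identityˡ s)
∣insert∣ zero    (inside  ∷ s) x∉s = contradiction here x∉s
∣insert∣ (suc x) (outside ∷ s) x∉s = ∣insert∣ x s (x∉s ∘ there)
∣insert∣ (suc x) (inside  ∷ s) x∉s = cong suc (∣insert∣ x s (x∉s ∘ there))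

∉⟦⟧ : ∀ {l} {x : Fin n} → All (x ≢_) l → x ∉ ⟦ l ⟧
∉⟦⟧ {l = l} x≢ x∈ = All.lookup x≢ (∈⟦⟧⁻ l x∈) refl

∣⟦⟧∣ : ∀ {l : List (Fin n)} → Unique l → ∣ ⟦ l ⟧ ∣ ≡ length l
∣⟦⟧∣ {n} []   = ∣⊥∣≡0 n
∣⟦⟧∣ {l = x ∷ l} (x≢ ∷ u) = trans (∣insert∣ x ⟦ l ⟧ (∉⟦⟧ x≢)) (cong suc (∣⟦⟧∣ u))

∣⟦⟧∣≤ : ∀ (l : List (Fin n)) → ∣ ⟦ l ⟧ ∣ ≤ length l
∣⟦⟧∣≤ {n} []  = ≤-reflexive (∣⊥∣≡0 n)
∣⟦⟧∣≤ (x ∷ l) with x ∈? ⟦ l ⟧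
... | yes x∈l = ≤-trans (p⊆q⇒∣p∣≤∣q∣ (insert-⊆ x∈l id)) (≤-trans (∣⟦⟧∣≤ l) (n≤1+n _))
... | no  x∉l = ≤-trans (≤-reflexive (∣insert∣ x ⟦ l ⟧ x∉l)) (s≤s (∣⟦⟧∣≤ l))

⊈⇒∃∉ : ∀ {p q : Subset n} → ¬ p ⊆ q → ∃[ x ] x ∈ p × x ∉ q
⊈⇒∃∉ {p = p} {q} p⊈q with nonempty? (p ∩ ∁ q)
... | yes (x , x∈) = x , proj₁ (x∈p∩q⁻ p _ x∈) , x∈∁p⇒x∉p (proj₂ (x∈p∩q⁻ p _ x∈))
... | no  empty    = contradiction
  (λ {x} x∈p → decidable-stable (x ∈? q) λ x∉q → empty (x , x∈p∩q⁺ (x∈p , x∉p⇒x∈∁p x∉q))) p⊈q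

∣∣<⇒∃∉ : ∀ {p q : Subset n} → ∣ q ∣ < ∣ p ∣ → ∃[ x ] x ∈ p × x ∉ q
∣∣<⇒∃∉ q<p = ⊈⇒∃∉ λ p⊆q → <-irrefl refl (≤-trans q<p (p⊆q⇒∣p∣≤∣q∣ p⊆q))

⊆∧∣≥∣⇒≡ : ∀ {p q : Subset n} → p ⊆ q → ∣ q ∣ ≤ ∣ p ∣ → p ≡ q
⊆∧∣≥∣⇒≡ {p = p} {q} p⊆q q≤p with q ⊆? p
... | yes q⊆p = ⊆-antisym p⊆q q⊆p
... | no  q⊈p = contradiction (≤-trans (p⊂q⇒∣p∣<∣q∣ (p⊆q , ⊈⇒∃∉ q⊈p)) q≤p) 1+n≰n

⊆∧∣≡∣⇒≡ : ∀ {p q : Subset n} {k} → p ⊆ q → ∣ p ∣ ≡ k → ∣ q ∣ ≡ k → p ≡ q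
⊆∧∣≡∣⇒≡ p⊆q p≡k q≡k = ⊆∧∣≥∣⇒≡ p⊆q (≤-reflexive (trans q≡k (sym p≡k)))

third : ∀ {t : Subset n} x y → 3 ≤ ∣ t ∣ → ∃[ z ] z ∈ t × z ≢ x × z ≢ y
third x y 3≤t with ∣∣<⇒∃∉ {q = ⟦ x ∷ y ∷ [] ⟧} (≤-trans (s≤s (∣⟦⟧∣≤ (x ∷ y ∷ []))) 3≤t)
... | z , z∈t , z∉ = z , z∈t , (λ { refl → z∉ (∈⟦⟧⁺ {l = _ ∷ _ ∷ []} (here refl)) }) , (λ { refl → z∉ (∈⟦⟧⁺ {l = _ ∷ _ ∷ []} (there (here refl))) })

x∉p-x : ∀ (p : Subset n) x → x ∉ p - x
x∉p-x (inside  ∷ p) zero    ()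
x∉p-x (outside ∷ p) zero    ()
x∉p-x (_       ∷ p) (suc x) (there x∈) = x∉p-x p x x∈

∣remove∣ : ∀ {t : Subset n} {z} → z ∈ t → ∣ t ∣ ≡ suc ∣ t - z ∣
∣remove∣ {t = t} {z} z∈t =
  trans (cong ∣_∣ (⊆-antisym to (insert-⊆ z∈t (p─q⊆p t ⁅ z ⁆)))) (∣insert∣ z (t - z) (x∉p-x t z))
  where
  to : t ⊆ ⁅ z ⁆ ∪ (t - z)
  to {x} x∈t with x ≟ z
  ... | yes refl = ∈-insert z
  ... | no  x≢z  = ⊆-insert z _ (x∈p∧x≢y⇒x∈p-y x∈t x≢z)

-- Images and preimages of vertex sets

push : (Fin m → Fin n) → Subset m → Subset n
push f []            = ⊥
push f (outside ∷ s) = push (f ∘ suc) s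
push f (inside  ∷ s) = ⁅ f zero ⁆ ∪ push (f ∘ suc) s

∈-push⁺ : ∀ (f : Fin m → Fin n) {s i} → i ∈ s → f i ∈ push f s
∈-push⁺ f here                     = ∈-insert (f zero)
∈-push⁺ f (there {y = outside} i∈) = ∈-push⁺ (f ∘ suc) i∈
∈-push⁺ f (there {y = inside}  i∈) = ⊆-insert (f zero) _ (∈-push⁺ (f ∘ suc) i∈)

∈-push⁻ : ∀ (f : Fin m → Fin n) s {x} → x ∈ push f s → ∃[ i ] i ∈ s × x ≡ f i
∈-push⁻ f []            x∈ = contradiction x∈ ∉⊥
∈-push⁻ f (outside ∷ s) x∈ with ∈-push⁻ (f ∘ suc) s x∈
... | i , i∈s , x≡ = suc i , there i∈s , x≡
∈-push⁻ f (inside  ∷ s) x∈ with ∈-insert⁻ x∈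
... | inj₁ x≡ = zero , here , x≡
... | inj₂ x∈s with ∈-push⁻ (f ∘ suc) s x∈s
... | i , i∈s , x≡ = suc i , there i∈s , x≡

push-mono : ∀ (f : Fin m → Fin n) {s t} → s ⊆ t → push f s ⊆ push f t
push-mono f {s} s⊆t x∈ with ∈-push⁻ f s x∈
... | i , i∈s , refl = ∈-push⁺ f (s⊆t i∈s)

Inj : (Fin m → Fin n) → Set
Inj f = ∀ {i j} → f i ≡ f j → i ≡ j

∈-push-inj : ∀ {f : Fin m → Fin n} → Inj f → ∀ {s i} → f i ∈ push f s → i ∈ s
∈-push-inj {f = f} inj {s} x∈ with ∈-push⁻ f s x∈
... | i , i∈s , eq = subst (_∈ s) (sym (inj eq)) i∈s

push-mono⁻ : ∀ {f : Fin m → Fin n} → Inj f → ∀ {s t} → push f s ⊆ push f t → s ⊆ t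
push-mono⁻ {f = f} inj s⊆t i∈s = ∈-push-inj inj (s⊆t (∈-push⁺ f i∈s))

push-injective : ∀ {f : Fin m → Fin n} → Inj f → ∀ {s t} → push f s ≡ push f t → s ≡ t
push-injective inj eq = ⊆-antisym (push-mono⁻ inj (⊆-reflexive eq)) (push-mono⁻ inj (⊆-reflexive (sym eq)))

∘suc-inj : ∀ {f : Fin (suc m) → Fin n} → Inj f → Inj (f ∘ suc)
∘suc-inj inj eq = suc-injective (inj eq)

zero∉push-suc : ∀ {f : Fin (suc m) → Fin n} → Inj f → ∀ s → f zero ∉ push (f ∘ suc) s
zero∉push-suc {f = f} inj s f0∈ with ∈-push⁻ (f ∘ suc) s f0∈
... | i , _ , eq with () ← inj eq

∣push∣ : ∀ {f : Fin m → Fin n} → Inj f → ∀ s → ∣ push f s ∣ ≡ ∣ s ∣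
∣push∣ {n = n} inj []    = ∣⊥∣≡0 n
∣push∣ inj (outside ∷ s) = ∣push∣ (∘suc-inj inj) s
∣push∣ {f = f} inj (inside ∷ s) =
  trans (∣insert∣ (f zero) _ (zero∉push-suc inj s)) (cong suc (∣push∣ (∘suc-inj inj) s))

push-⟦⟧ : ∀ (f : Fin m → Fin n) l → push f ⟦ l ⟧ ≡ ⟦ map f l ⟧
push-⟦⟧ f l = ⊆-antisym to (⟦⟧-⊆ (from l id))
  where
  to : push f ⟦ l ⟧ ⊆ ⟦ map f l ⟧
  to x∈ with ∈-push⁻ f ⟦ l ⟧ x∈
  ... | i , i∈ , refl = ∈⟦⟧⁺ (LP.∈-map⁺ f (∈⟦⟧⁻ l i∈))
  from : ∀ l′ → (∀ {x} → x L.∈ l′ → x L.∈ l) → All (_∈ push f ⟦ l ⟧) (map f l′)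
  from l′ sub = AllP.map⁺ (All.tabulate λ x∈ → ∈-push⁺ f (∈⟦⟧⁺ (sub x∈)))

-- `image π` unfolds to `pull (π ⟨$⟩ˡ_)`, so `push-pull` also applies to the isomorphisms of the
-- definitions.
pull : (Fin m → Fin n) → Subset n → Subset m
pull f t = Vec.tabulate (λ i → Vec.lookup t (f i))

∈-pull⁺ : ∀ (f : Fin m → Fin n) {t i} → f i ∈ t → i ∈ pull f t
∈-pull⁺ f {t} {i} x∈ = VecP.lookup⇒[]= i _ (trans (VecP.lookup∘tabulate _ i) (VecP.[]=⇒lookup x∈))

∈-pull⁻ : ∀ (f : Fin m → Fin n) {t i} → i ∈ pull f t → f i ∈ t
∈-pull⁻ f {t} {i} x∈ = VecP.lookup⇒[]= _ t (trans (sym (VecP.lookup∘tabulate _ i)) (VecP.[]=⇒lookup x∈))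

push-pull : ∀ (f : Fin m → Fin n) {t w} → t ⊆ push f w → push f (pull f t) ≡ t
push-pull f {t} {w} t⊆ = ⊆-antisym to from
  where
  to : push f (pull f t) ⊆ t
  to x∈ with ∈-push⁻ f (pull f t) x∈
  ... | i , i∈ , refl = ∈-pull⁻ f i∈
  from : t ⊆ push f (pull f t)
  from x∈ with ∈-push⁻ f w (t⊆ x∈)
  ... | i , _ , refl = ∈-push⁺ f (∈-pull⁺ f x∈)

-- Stacked balls as sets of tetrahedra

_≟ₛ_ : (s t : Subset n) → Dec (s ≡ t)
_≟ₛ_ = VecP.≡-dec Bool._≟_

-- The counterpart of `BoundaryTriangle` for a bare set of tetrahedra. Working with such sets inside
-- a fixed vertex set avoids the renumbering that `glue` forces at every gluing.
Bd : Faces n → Faces n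
Bd F t = ∣ t ∣ ≡ 3 × ∃! _≡_ (λ u → F u × t ⊆ u)

-- F is the set of tetrahedra of a stacked ball with m vertices.
data Stacked {n : ℕ} : ℕ → Faces n → Set₁ where
  base : ∀ {F a b c d} → Unique (a ∷ b ∷ c ∷ d ∷ []) →
         F ≐ (_≡ ⟦ a ∷ b ∷ c ∷ d ∷ [] ⟧) → Stacked 4 F
  step : ∀ {m F F′ t v} → Stacked m F → Bd F t → (∀ {u} → F u → v ∉ u) →
         F′ ≐ (λ u → F u ⊎ u ≡ ⁅ v ⁆ ∪ t) → Stacked (suc m) F′

module _ {F : Faces n} {t : Subset n} {v : Fin n} (bd : Bd F t) (fresh : ∀ {u} → F u → v ∉ u) where

  bd-fresh : v ∉ t
  bd-fresh v∈t = let _ , _ , (Fu , t⊆u) , _ = bd in fresh Fu (t⊆u v∈t)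

  ∣cone∣ : ∣ ⁅ v ⁆ ∪ t ∣ ≡ 4
  ∣cone∣ = trans (∣insert∣ v t bd-fresh) (cong suc (proj₁ bd))

  ⊆cone⇒≡ : ∀ {s u} → ∣ s ∣ ≡ 3 → F u → s ⊆ u → s ⊆ ⁅ v ⁆ ∪ t → s ≡ t
  ⊆cone⇒≡ ∣s∣ Fu s⊆u s⊆ = ⊆∧∣≡∣⇒≡ (insert-drop (fresh Fu ∘ s⊆u) s⊆) ∣s∣ (proj₁ bd)

pure : ∀ {F : Faces n} {u} → Stacked m F → F u → ∣ u ∣ ≡ 4
pure (base uniq eq)      Fu = trans (cong ∣_∣ (proj₁ eq Fu)) (∣⟦⟧∣ uniq)
pure (step st bd fr eq) Fu with proj₁ eq Fu
... | inj₁ Fu′  = pure st Fu′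
... | inj₂ refl = ∣cone∣ bd fr

-- A triangle lying both in the new cone and in an old tetrahedron misses the apex, so it is the
-- glued triangle, which had exactly one owner before. All other triangles keep their owners or are
-- owned by the cone alone.
≤2-owners : ∀ {F : Faces n} {t u₁ u₂ u₃} → Stacked m F → ∣ t ∣ ≡ 3 →
            F u₁ × t ⊆ u₁ → F u₂ × t ⊆ u₂ → F u₃ × t ⊆ u₃ →
            u₁ ≡ u₂ ⊎ u₁ ≡ u₃ ⊎ u₂ ≡ u₃
≤2-owners (base _ eq) _ (F₁ , _) (F₂ , _) _ = inj₁ (trans (proj₁ eq F₁) (sym (proj₁ eq F₂)))
≤2-owners {F = F′} {t} (step {F = F} {t = t₀} {v} st bd@(_ , _ , _ , only) fr eq) ∣t∣ (F₁ , t₁) (F₂ , t₂) (F₃ , t₃) =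
  cases (proj₁ eq F₁) (proj₁ eq F₂) (proj₁ eq F₃) t₁ t₂ t₃
  where
  old-unique : ∀ {x y} → t ⊆ ⁅ v ⁆ ∪ t₀ → F x → t ⊆ x → F y → t ⊆ y → x ≡ y
  old-unique t⊆ Fx tx Fy ty with refl ← ⊆cone⇒≡ bd fr ∣t∣ Fx tx t⊆ =
    trans (sym (only (Fx , tx))) (only (Fy , ty))
  cases : ∀ {x y z} → F x ⊎ x ≡ ⁅ v ⁆ ∪ t₀ → F y ⊎ y ≡ ⁅ v ⁆ ∪ t₀ → F z ⊎ z ≡ ⁅ v ⁆ ∪ t₀ →
          t ⊆ x → t ⊆ y → t ⊆ z → x ≡ y ⊎ x ≡ z ⊎ y ≡ z
  cases (inj₁ x) (inj₁ y) (inj₁ z) tx ty tz = ≤2-owners st ∣t∣ (x , tx) (y , ty) (z , tz)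
  cases (inj₁ x) (inj₁ y) (inj₂ refl) tx ty tz = inj₁ (old-unique tz x tx y ty)
  cases (inj₁ x) (inj₂ refl) (inj₁ z) tx ty tz = inj₂ (inj₁ (old-unique ty x tx z tz))
  cases (inj₂ refl) (inj₁ y) (inj₁ z) tx ty tz = inj₂ (inj₂ (old-unique tx y ty z tz))
  cases (inj₂ refl) (inj₂ refl) _ _ _ _ = inj₁ refl
  cases (inj₂ refl) (inj₁ _) (inj₂ refl) _ _ _ = inj₂ (inj₁ refl)
  cases (inj₁ _) (inj₂ refl) (inj₂ refl) _ _ _ = inj₂ (inj₂ refl)

-- If the newest vertex belongs to the clique, all its neighbours lie in its only tetrahedron. If
-- not, every adjacency seen in the cone already holds in `t`, hence in the old owner `u₀` of `t`,
-- and induction applies.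
clique-face : ∀ {F : Faces n} {s} → Stacked m F →
              (∀ {x y} → x ∈ s → y ∈ s → ∃[ u ] F u × x ∈ u × y ∈ u) →
              ∃[ u ] F u × s ⊆ u
clique-face {F = F} {s} (base {a = a} {b} {c} {d} _ eq) adj = _ , proj₂ eq refl , sub
  where
  sub : s ⊆ ⟦ a ∷ b ∷ c ∷ d ∷ [] ⟧
  sub x∈s with u , Fu , x∈u , _ ← adj x∈s x∈s with refl ← proj₁ eq Fu = x∈u
clique-face {s = s} (step {F = F} {t = t} {v} st bd@(_ , u₀ , (Fu₀ , t⊆u₀) , _) fr eq) adj with v ∈? s
... | yes v∈s = _ , proj₂ eq (inj₂ refl) , sub
  where
  sub : s ⊆ ⁅ v ⁆ ∪ t
  sub x∈s with adj v∈s x∈s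
  ... | u , Fu , v∈u , x∈u with proj₁ eq Fu
  ... | inj₁ Fu′  = contradiction v∈u (fr Fu′)
  ... | inj₂ refl = x∈u
... | no  v∉s = let u , Fu , s⊆u = clique-face st adj′ in u , proj₂ eq (inj₁ Fu) , s⊆u
  where
  old : ∀ {x} → x ∈ s → x ∈ ⁅ v ⁆ ∪ t → x ∈ t
  old x∈s x∈ with ∈-insert⁻ x∈
  ... | inj₁ refl = contradiction x∈s v∉s
  ... | inj₂ x∈t  = x∈t
  adj′ : ∀ {x y} → x ∈ s → y ∈ s → ∃[ u ] F u × x ∈ u × y ∈ u
  adj′ x∈s y∈s with adj x∈s y∈s
  ... | u , Fu , x∈u , y∈u with proj₁ eq Fu
  ... | inj₁ Fu′  = u , Fu′ , x∈u , y∈u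
  ... | inj₂ refl = u₀ , Fu₀ , t⊆u₀ (old x∈s x∈u) , t⊆u₀ (old y∈s y∈u)

-- The witness is a side face of the cone: a base vertex `z` other than `x` and `y` is dropped. The
-- face contains the fresh apex, so the cone is its only owner.
cone-edge : ∀ {F F′ : Faces n} {t v} → Bd F t → (∀ {u} → F u → v ∉ u) →
            F′ ≐ (λ u → F u ⊎ u ≡ ⁅ v ⁆ ∪ t) → ∀ {x y} → x ∈ ⁅ v ⁆ ∪ t → y ∈ ⁅ v ⁆ ∪ t →
            ∃[ s ] Bd F′ s × x ∈ s × y ∈ s
cone-edge {F′ = F′} {t} {v} bd fr eq {x} {y} x∈ y∈
  with z , z∈ , z≢x , z≢y ← third {t = t} x y (≤-reflexive (sym (proj₁ bd))) =
  ⁅ v ⁆ ∪ (t - z) ,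
  (trans (∣insert∣ v _ (bd-fresh bd fr ∘ p─q⊆p t ⁅ z ⁆)) (trans (sym (∣remove∣ z∈)) (proj₁ bd)) ,
   ⁅ v ⁆ ∪ t , (proj₂ eq (inj₂ refl) , insert-mono (p─q⊆p t ⁅ z ⁆)) , only) ,
  lift x∈ z≢x , lift y∈ z≢y
  where
  only : ∀ {w} → F′ w × ⁅ v ⁆ ∪ (t - z) ⊆ w → ⁅ v ⁆ ∪ t ≡ w
  only (F′w , ⊆w) with proj₁ eq F′w
  ... | inj₁ Fw   = contradiction (⊆w (∈-insert v)) (fr Fw)
  ... | inj₂ refl = refl
  lift : ∀ {x} → x ∈ ⁅ v ⁆ ∪ t → z ≢ x → x ∈ ⁅ v ⁆ ∪ (t - z)
  lift x∈ z≢x with ∈-insert⁻ x∈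
  ... | inj₁ refl = ∈-insert v
  ... | inj₂ x∈t  = ⊆-insert v _ (x∈p∧x≢y⇒x∈p-y x∈t (≢-sym z≢x))

-- Gluing removes only `t₀` from the boundary, and the edges of `t₀` reappear on side faces of the
-- cone. Since `x` and `y` may coincide, this also puts every vertex on the boundary.
edge-on-boundary : ∀ {F : Faces n} {u x y} → Stacked m F → F u → x ∈ u → y ∈ u →
                   ∃[ t ] Bd F t × x ∈ t × y ∈ t
edge-on-boundary {F = F} {u} {x} {y} (base uniq eq) Fu x∈u y∈u
  with ∣u∣ ← trans (cong ∣_∣ (proj₁ eq Fu)) (∣⟦⟧∣ uniq)
  with z , z∈ , z≢x , z≢y ← third {t = u} x y (≤-trans (n≤1+n 3) (≤-reflexive (sym ∣u∣))) =
  u - z ,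
  (ℕ-suc-injective (trans (sym (∣remove∣ z∈)) ∣u∣) ,
   u , (Fu , p─q⊆p u ⁅ z ⁆) , λ (Fw , _) → trans (proj₁ eq Fu) (sym (proj₁ eq Fw))) ,
  x∈p∧x≢y⇒x∈p-y x∈u (≢-sym z≢x) , x∈p∧x≢y⇒x∈p-y y∈u (≢-sym z≢y)
edge-on-boundary {u = u} {x} {y} (step {F = F} {F′} {t₀} {v} st bd fr eq) F′u x∈u y∈u with proj₁ eq F′u
... | inj₂ refl = cone-edge bd fr eq x∈u y∈u
... | inj₁ Fu with edge-on-boundary st Fu x∈u y∈u
... | t , bt@(∣t∣ , w , (Fw , t⊆w) , only) , x∈t , y∈t with t ≟ₛ t₀
... | no  t≢ = t , (∣t∣ , w , (proj₂ eq (inj₁ Fw) , t⊆w) , only′) , x∈t , y∈t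
  where
  only′ : ∀ {w′} → F′ w′ × t ⊆ w′ → w ≡ w′
  only′ (F′w , t⊆w′) with proj₁ eq F′w
  ... | inj₁ Fw′  = only (Fw′ , t⊆w′)
  ... | inj₂ refl = contradiction (⊆cone⇒≡ bd fr ∣t∣ Fw t⊆w t⊆w′) t≢
... | yes refl = cone-edge bd fr eq (⊆-insert v t x∈t) (⊆-insert v t y∈t)

-- The complex spanned by a set of tetrahedra, and the cliques of its boundary

module _ {F : Faces n} (4F : ∀ {u} → F u → ∣ u ∣ ≡ 4) where

  tetrahedron⁺ : ∀ {u} → F u → Tetrahedron ⟨ F ⟩ u
  tetrahedron⁺ Fu = (_ , Fu , id) , 4F Fu

  tetrahedron⁻ : ∀ {u} → Tetrahedron ⟨ F ⟩ u → F u
  tetrahedron⁻ ((w , Fw , u⊆w) , ∣u∣) = subst F (sym (⊆∧∣≡∣⇒≡ u⊆w ∣u∣ (4F Fw))) Fw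

  boundaryTriangle⁺ : ∀ {t} → Bd F t → BoundaryTriangle ⟨ F ⟩ t
  boundaryTriangle⁺ (∣t∣ , u , (Fu , t⊆u) , only) =
    ((u , Fu , t⊆u) , ∣t∣) , u , (tetrahedron⁺ Fu , t⊆u) , λ (Kw , t⊆w) → only (tetrahedron⁻ Kw , t⊆w)

  boundaryTriangle⁻ : ∀ {t} → BoundaryTriangle ⟨ F ⟩ t → Bd F t
  boundaryTriangle⁻ ((_ , ∣t∣) , u , (Ku , t⊆u) , only) =
    ∣t∣ , u , (tetrahedron⁻ Ku , t⊆u) , λ (Fw , t⊆w) → only (tetrahedron⁺ Fw , t⊆w)

module _ {F S : Faces n} (st : Stacked m F) (cover : ∀ x → ∃[ u ] F u × x ∈ u)
         (S≐ : S ≐ ∂ ⟨ F ⟩) where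

  private
    edge⇒tet : ∀ {x y} → Edge S x y → ∃[ u ] F u × x ∈ u × y ∈ u
    edge⇒tet {x} {y} (_ , Sxy)
      with t , bt , xy⊆t ← proj₁ S≐ Sxy
      with _ , u , (Fu , t⊆u) , _ ← boundaryTriangle⁻ (pure st) bt =
      u , Fu , t⊆u (xy⊆t (p⊆p∪q ⁅ y ⁆ (x∈⁅x⁆ x))) , t⊆u (xy⊆t (q⊆p∪q ⁅ x ⁆ ⁅ y ⁆ (x∈⁅x⁆ y)))

  -- With `clique⁺`, this recovers the ball from its boundary, so that degrees in `Λ (Clique S)` can
  -- be computed from `F`. A clique says nothing about a vertex paired with itself; `cover` fills
  -- that gap.
  clique⁻ : ∀ {s} → Clique S s → ⟨ F ⟩ s
  clique⁻ {s} cl = clique-face st adj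
    where
    adj : ∀ {x y} → x ∈ s → y ∈ s → ∃[ u ] F u × x ∈ u × y ∈ u
    adj {x} {y} x∈ y∈ with x ≟ y
    ... | yes refl = let u , Fu , x∈u = cover x in u , Fu , x∈u , x∈u
    ... | no  x≢y  = edge⇒tet (cl x∈ y∈ x≢y)

  clique⁺ : ∀ {s} → ⟨ F ⟩ s → Clique S s
  clique⁺ (u , Fu , s⊆u) x∈ y∈ x≢y
    with t , bt , x∈t , y∈t ← edge-on-boundary st Fu (s⊆u x∈) (s⊆u y∈) =
    x≢y , proj₂ S≐ (t , boundaryTriangle⁺ (pure st) bt ,
      insert-⊆ x∈t (λ z∈ → subst (_∈ t) (sym (x∈⁅y⁆⇒x≡y _ z∈)) y∈t))

  clique-tetrahedron⁺ : ∀ {u} → F u → Tetrahedron (Clique S) u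
  clique-tetrahedron⁺ Fu = clique⁺ (_ , Fu , id) , pure st Fu

  clique-tetrahedron⁻ : ∀ {u} → Tetrahedron (Clique S) u → F u
  clique-tetrahedron⁻ (cl , ∣u∣) = tetrahedron⁻ (pure st) (clique⁻ cl , ∣u∣)

  ∂-isComplex : IsComplex S
  ∂-isComplex = record
    { down-closed = λ s⊆t St → let w , bw , t⊆w = proj₁ S≐ St in proj₂ S≐ (w , bw , t⊆w ∘ s⊆t)
    ; vertex      = λ x → let u , Fu , x∈u = cover x
                              t , bt , x∈t , _ = edge-on-boundary st Fu x∈u x∈u in
                    proj₂ S≐ (t , boundaryTriangle⁺ (pure st) bt ,
                              λ z∈ → subst (_∈ t) (sym (x∈⁅y⁆⇒x≡y _ z∈)) x∈t) }

-- Relabelling vertices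

lookup-injective : ∀ {A B : Set} (f : A → B) {l} → AllPairs (λ x y → f x ≢ f y) l →
                   ∀ {i j} → f (lookup l i) ≡ f (lookup l j) → i ≡ j
lookup-injective f (_ ∷ _)  {zero}  {zero}  _  = refl
lookup-injective f {_ ∷ l} (x≢ ∷ _) {zero}  {suc j} eq = contradiction eq (All.lookup x≢ (LP.∈-lookup {xs = l} j))
lookup-injective f {_ ∷ l} (x≢ ∷ _) {suc i} {zero}  eq = contradiction (sym eq) (All.lookup x≢ (LP.∈-lookup {xs = l} i))
lookup-injective f (_ ∷ u)  {suc i} {suc j} eq = cong suc (lookup-injective f u eq)

injective⇒surjective : ∀ {f : Fin n → Fin n} → Inj f → ∀ y → ∃[ x ] f x ≡ y
injective⇒surjective {suc n} {f} inj y with any? (λ x → f x ≟ y)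
... | yes e = e
... | no ¬e = contradiction
  (injective⇒≤ {f = λ x → punchOut (y≢f x)}
    (λ {i} {j} eq → inj (punchOut-injective (y≢f i) (y≢f j) eq))) 1+n≰n
  where
  y≢f : ∀ x → y ≢ f x
  y≢f x eq = ¬e (x , sym eq)

DownClosed : Faces n → Set
DownClosed K = ∀ {s t} → s ⊆ t → K t → K s

Image : (Fin m → Fin n) → Faces m → Faces n → Set
Image f G F = F ≐ (λ u → ∃[ w ] G w × u ≡ push f w)

module _ {f : Fin m → Fin n} (inj : Inj f) {G : Faces m} {F : Faces n} (im : Image f G F) where

  bd-push⁺ : ∀ {t} → Bd G t → Bd F (push f t)
  bd-push⁺ {t} (∣t∣ , w , (Gw , t⊆w) , only) =
    trans (∣push∣ inj t) ∣t∣ , push f w , (proj₂ im (w , Gw , refl) , push-mono f t⊆w) , only′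
    where
    only′ : ∀ {u} → F u × push f t ⊆ u → push f w ≡ u
    only′ (Fu , t⊆u) with w′ , Gw′ , refl ← proj₁ im Fu =
      cong (push f) (only (Gw′ , push-mono⁻ inj t⊆u))

  bd-push⁻ : ∀ {t} → Bd F (push f t) → Bd G t
  bd-push⁻ {t} (∣t∣ , u , (Fu , t⊆u) , only) with w , Gw , refl ← proj₁ im Fu =
    trans (sym (∣push∣ inj t)) ∣t∣ , w , (Gw , push-mono⁻ inj t⊆u) ,
    λ (Gw′ , t⊆w′) → push-injective inj (only (proj₂ im (_ , Gw′ , refl) , push-mono f t⊆w′))

  bd⇒push : ∀ {t} → Bd F t → push f (pull f t) ≡ t
  bd⇒push (_ , u , (Fu , t⊆u) , _) with w , _ , refl ← proj₁ im Fu = push-pull f {w = w} t⊆u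

  bd-pull : ∀ {t} → Bd F t → Bd G (pull f t)
  bd-pull bt = bd-push⁻ (subst (Bd F) (sym (bd⇒push bt)) bt)

module _ {K : Faces n} (closed : DownClosed K) where

  bd⇒boundaryTriangle : ∀ {t} → Bd (Tetrahedron K) t → BoundaryTriangle K t
  bd⇒boundaryTriangle (∣t∣ , o@(_ , ((Ku , _) , t⊆u) , _)) = (closed t⊆u Ku , ∣t∣) , o

boundaryTriangle⇒bd : ∀ {K : Faces n} {t} → BoundaryTriangle K t → Bd (Tetrahedron K) t
boundaryTriangle⇒bd ((_ , ∣t∣) , o) = ∣t∣ , o

module _ {f : Fin m → Fin n} (inj : Inj f) {K : Faces m} {F : Faces n} (closed : DownClosed K)
         (4F : ∀ {u} → F u → ∣ u ∣ ≡ 4) (im : Image f (Tetrahedron K) F) where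

  ∂-push⁺ : ∀ {s} → ∂ K s → ∂ ⟨ F ⟩ (push f s)
  ∂-push⁺ (t , bt , s⊆t) =
    push f t , boundaryTriangle⁺ 4F (bd-push⁺ inj im (boundaryTriangle⇒bd {K = K} bt)) , push-mono f s⊆t

  ∂-push⁻ : ∀ {s} → ∂ ⟨ F ⟩ (push f s) → ∂ K s
  ∂-push⁻ (t , bt , s⊆t) =
    let bt′ = boundaryTriangle⁻ 4F bt in
    pull f t , bd⇒boundaryTriangle closed (bd-pull inj im bt′) ,
    push-mono⁻ inj (subst (_ ⊆_) (sym (bd⇒push inj im bt′)) s⊆t)

module _ {K : Faces n} {F : Faces n} (closed : DownClosed K) (4F : ∀ {u} → F u → ∣ u ∣ ≡ 4) where

  push-image : (π : Permutation′ n) → ∀ s → push (π ⟨$⟩ˡ_) (image π s) ≡ s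
  push-image π s = push-pull (π ⟨$⟩ˡ_) {w = ⊤} λ {x} _ →
    subst (_∈ push (π ⟨$⟩ˡ_) ⊤) (inverseˡ π) (∈-push⁺ (π ⟨$⟩ˡ_) {i = π ⟨$⟩ʳ x} ∈⊤)

  ∂-permute : (π : Permutation′ n) → Image (π ⟨$⟩ˡ_) (Tetrahedron K) F → ∂ ⟨ F ⟩ ≐ (∂ K ∘ image π)
  ∂-permute π im =
    (λ {s} ∂s → ∂-push⁻ ˡ-inj closed 4F im (subst (∂ ⟨ F ⟩) (sym (push-image π s)) ∂s)) ,
    (λ {s} ∂s → subst (∂ ⟨ F ⟩) (push-image π s) (∂-push⁺ ˡ-inj closed 4F im ∂s))
    where
    ˡ-inj : Inj (π ⟨$⟩ˡ_)
    ˡ-inj eq = trans (sym (inverseʳ π)) (trans (cong (π ⟨$⟩ʳ_) eq) (inverseʳ π))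

  Image⇒≅ : ∀ {f : Fin n → Fin n} → Inj f → Image f (Tetrahedron K) F → ∂ ⟨ F ⟩ ≅ ∂ K
  Image⇒≅ {f} inj im = π , ∂-permute π im
    where
    f⁻¹ : Fin n → Fin n
    f⁻¹ = proj₁ ∘ injective⇒surjective inj
    ff⁻¹ : ∀ y → f (f⁻¹ y) ≡ y
    ff⁻¹ = proj₂ ∘ injective⇒surjective inj
    π : Permutation′ n
    -- `f` is put in the inverse direction, because `image π` looks up positions through `π ⟨$⟩ˡ_`.
    π = permutation f⁻¹ f (λ x → inj (ff⁻¹ (f x))) ff⁻¹

ball-closed : ∀ {B : Faces n} → StackedBall n B → DownClosed B
ball-closed tetrahedron _ _ = tt
ball-closed (stack sb _) {outside ∷ s} {outside ∷ u} s⊆u Bu  = ball-closed sb (drop-∷-⊆ s⊆u) Bu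
ball-closed (stack sb ((Bt , _) , _)) {outside ∷ s} {inside ∷ u} s⊆u u⊆t = ball-closed sb (⊆-trans (drop-∷-⊆ s⊆u) u⊆t) Bt
ball-closed (stack sb _) {inside ∷ s}  {outside ∷ u} s⊆u _   with () ← s⊆u here
ball-closed (stack sb _) {inside ∷ s}  {inside ∷ u} s⊆u u⊆t  = ⊆-trans (drop-∷-⊆ s⊆u) u⊆t

module _ {B : Faces n} {t : Subset n} (∣t∣ : ∣ t ∣ ≡ 3) where

  glue-tetrahedron⁻ : ∀ {w} → Tetrahedron (glue B t) (inside ∷ w) → w ≡ t
  glue-tetrahedron⁻ (w⊆t , ∣w∣) = ⊆∧∣≡∣⇒≡ w⊆t (ℕ-suc-injective ∣w∣) ∣t∣

  glue-tetrahedron⁺ : Tetrahedron (glue B t) (inside ∷ t)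
  glue-tetrahedron⁺ = id , cong suc ∣t∣

-- The gluings are replayed in the numbering of `glue`, where the newest vertex is zero. The last
-- component says that every value of `f` is a used vertex; it turns the freshness of `v` into `v`
-- being outside the range of `f`, which keeps `f′` injective.
Stacked⇒ball : ∀ {F : Faces n} → Stacked m F →
  ∃[ B ] StackedBall m B × Σ[ f ∈ (Fin m → Fin n) ]
    Inj f × Image f (Tetrahedron B) F × (∀ i → ∃[ u ] F u × f i ∈ u)
Stacked⇒ball {F = F} (base {a = a} {b} {c} {d} uniq eq) =
  _ , tetrahedron , lookup l , lookup-injective id uniq , (to , from) ,
  λ i → ⟦ l ⟧ , proj₂ eq refl , ∈⟦⟧⁺ (LP.∈-lookup {xs = l} i)
  where
  l : List _
  l = a ∷ b ∷ c ∷ d ∷ []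
  to : ∀ {u} → F u → ∃[ w ] Tetrahedron _ w × u ≡ push (lookup l) w
  to Fu = ⊤ , (tt , refl) , proj₁ eq Fu
  from : ∀ {u} → (∃[ w ] Tetrahedron _ w × u ≡ push (lookup l) w) → F u
  from (w , (_ , ∣w∣) , refl) with refl ← ∣p∣≡n⇒p≡⊤ {p = w} ∣w∣ = proj₂ eq refl
Stacked⇒ball {n = n} {F = F′} (step {m = m} {F = F} {t = t} {v} st bd fr eq)
  with B , sb , f , inj , im , cov ← Stacked⇒ball st =
  glue B (pull f t) , stack sb bt , f′ , inj′ , (to , from) , cov′
  where
  t≡ : push f (pull f t) ≡ t
  t≡ = bd⇒push inj im bd
  bt : BoundaryTriangle B (pull f t)
  bt = bd⇒boundaryTriangle (ball-closed sb) (bd-pull inj im bd)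
  f′ : Fin (suc m) → Fin n
  f′ zero    = v
  f′ (suc i) = f i
  v∉f : ∀ i → v ≢ f i
  v∉f i refl = let u , Fu , fi∈u = cov i in fr Fu fi∈u
  inj′ : Inj f′
  inj′ {zero}  {zero}  _  = refl
  inj′ {zero}  {suc j} eq = contradiction eq (v∉f j)
  inj′ {suc i} {zero}  eq = contradiction (sym eq) (v∉f i)
  inj′ {suc i} {suc j} eq = cong suc (inj eq)
  to : ∀ {u} → F′ u → ∃[ w ] Tetrahedron (glue B (pull f t)) w × u ≡ push f′ w
  to F′u with proj₁ eq F′u
  ... | inj₁ Fu   = let w , Bw , u≡ = proj₁ im Fu in outside ∷ w , Bw , u≡
  ... | inj₂ refl = inside ∷ pull f t , glue-tetrahedron⁺ {B = B} (proj₂ (proj₁ bt)) , cong (⁅ v ⁆ ∪_) (sym t≡)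
  from : ∀ {u} → (∃[ w ] Tetrahedron (glue B (pull f t)) w × u ≡ push f′ w) → F′ u
  from (outside ∷ w , Bw , u≡) = proj₂ eq (inj₁ (proj₂ im (w , Bw , u≡)))
  from (inside  ∷ w , gw , u≡) with refl ← glue-tetrahedron⁻ {B = B} (proj₂ (proj₁ bt)) gw =
    proj₂ eq (inj₂ (trans u≡ (cong (⁅ v ⁆ ∪_) t≡)))
  cov′ : ∀ i → ∃[ u ] F′ u × f′ i ∈ u
  cov′ zero    = ⁅ v ⁆ ∪ t , proj₂ eq (inj₂ refl) , ∈-insert v
  cov′ (suc i) = let u , Fu , fi∈u = cov i in u , proj₂ eq (inj₁ Fu) , fi∈u

-- Here the number of vertices of the ball equals that of the ambient set, so the injective
-- numbering is onto.
Stacked⇒cover : ∀ {F : Faces n} → Stacked n F → ∀ x → ∃[ u ] F u × x ∈ u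
Stacked⇒cover st x with B , sb , f , inj , im , cov ← Stacked⇒ball st
  with i , refl ← injective⇒surjective inj x = cov i

Stacked⇒sphere : ∀ {F : Faces n} → Stacked n F → StackedSphere n (∂ ⟨ F ⟩)
Stacked⇒sphere st with B , sb , f , inj , im , cov ← Stacked⇒ball st = record
  { isComplex  = ∂-isComplex st (Stacked⇒cover st) (id , id)
  ; isBall     = sb
  ; ≅-boundary = Image⇒≅ (ball-closed sb) (pure st) inj im
  }

-- Trees of tetrahedra

-- A tree over the ordered triangle (a , b , c) describes the tetrahedra on one
-- side of it: the first has apex v, and the three subtrees continue beyond
-- the triangles (v , b , c), (a , v , c) and (a , b , v).
data Tree (n : ℕ) : Set where
  ∅    : Tree n
  node : (v : Fin n) (X Y Z : Tree n) → Tree n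

labels : Tree n → List (Fin n)
labels ∅              = []
labels (node v X Y Z) = v ∷ labels X ++ labels Y ++ labels Z

-- The apex enters at the position of the corner it replaces. A corner thus keeps its position for
-- as long as it survives, which gives the phrase "the same child" a geometric meaning at different
-- nodes.
data Tet {n : ℕ} : (a b c : Fin n) → Tree n → Faces n where
  root : ∀ {a b c v X Y Z} → Tet a b c (node v X Y Z) ⟦ v ∷ a ∷ b ∷ c ∷ [] ⟧
  in₁  : ∀ {a b c v X Y Z u} → Tet v b c X u → Tet a b c (node v X Y Z) u
  in₂  : ∀ {a b c v X Y Z u} → Tet a v c Y u → Tet a b c (node v X Y Z) u
  in₃  : ∀ {a b c v X Y Z u} → Tet a b v Z u → Tet a b c (node v X Y Z) u

Good : (a b c : Fin n) → Tree n → Set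
Good a b c T = Unique (a ∷ b ∷ c ∷ labels T)

++⁻-unique : ∀ {A : Set} (xs : List A) {ys} → Unique (xs ++ ys) →
             Unique xs × Unique ys × (∀ {x} → x L.∈ xs → All (x ≢_) ys)
++⁻-unique []       u        = [] , u , λ ()
++⁻-unique (x ∷ xs) (x≢ ∷ u) with uxs , uys , disj ← ++⁻-unique xs u
  with x≢xs , x≢ys ← AllP.++⁻ xs x≢ =
  x≢xs ∷ uxs , uys , λ { (here refl) → x≢ys ; (there x∈) → disj x∈ }

record NodeGood {n : ℕ} (a b c v : Fin n) (X Y Z : Tree n) : Set where
  field
    a≢b : a ≢ b
    a≢c : a ≢ c
    b≢c : b ≢ c
    a≢v : a ≢ v
    b≢v : b ≢ v
    c≢v : c ≢ v
    aX : All (a ≢_) (labels X)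
    bX : All (b ≢_) (labels X)
    cX : All (c ≢_) (labels X)
    vX : All (v ≢_) (labels X)
    aY : All (a ≢_) (labels Y)
    bY : All (b ≢_) (labels Y)
    cY : All (c ≢_) (labels Y)
    vY : All (v ≢_) (labels Y)
    aZ : All (a ≢_) (labels Z)
    bZ : All (b ≢_) (labels Z)
    cZ : All (c ≢_) (labels Z)
    vZ : All (v ≢_) (labels Z)
    uX : Unique (labels X)
    uY : Unique (labels Y)
    uZ : Unique (labels Z)
    XY : ∀ {x} → x L.∈ labels X → All (x ≢_) (labels Y)
    XZ : ∀ {x} → x L.∈ labels X → All (x ≢_) (labels Z)
    YZ : ∀ {x} → x L.∈ labels Y → All (x ≢_) (labels Z)

  corners : Unique (v ∷ a ∷ b ∷ c ∷ [])
  corners = (≢-sym a≢v ∷ ≢-sym b≢v ∷ ≢-sym c≢v ∷ []) ∷ (a≢b ∷ a≢c ∷ []) ∷ (b≢c ∷ []) ∷ [] ∷ []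
  good₁ : Good v b c X
  good₁ = (≢-sym b≢v ∷ ≢-sym c≢v ∷ vX) ∷ (b≢c ∷ bX) ∷ cX ∷ uX
  good₂ : Good a v c Y
  good₂ = (a≢v ∷ a≢c ∷ aY) ∷ (≢-sym c≢v ∷ vY) ∷ cY ∷ uY
  good₃ : Good a b v Z
  good₃ = (a≢b ∷ a≢v ∷ aZ) ∷ (b≢v ∷ bZ) ∷ vZ ∷ uZ

nodeGood : ∀ {a b c v : Fin n} {X Y Z} → Good a b c (node v X Y Z) → NodeGood a b c v X Y Z
nodeGood {X = X} {Y} {Z} ((ab ∷ ac ∷ av ∷ aL) ∷ (bc ∷ bv ∷ bL) ∷ (cv ∷ cL) ∷ vL ∷ uL)
  with aX , aYZ ← AllP.++⁻ (labels X) aL | bX , bYZ ← AllP.++⁻ (labels X) bL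
     | cX , cYZ ← AllP.++⁻ (labels X) cL | vX , vYZ ← AllP.++⁻ (labels X) vL
     | uX , uYZ , X-YZ ← ++⁻-unique (labels X) uL
  with aY , aZ ← AllP.++⁻ (labels Y) aYZ | bY , bZ ← AllP.++⁻ (labels Y) bYZ
     | cY , cZ ← AllP.++⁻ (labels Y) cYZ | vY , vZ ← AllP.++⁻ (labels Y) vYZ
     | uY , uZ , Y-Z ← ++⁻-unique (labels Y) uYZ = record
  { a≢b = ab ; a≢c = ac ; b≢c = bc ; a≢v = av ; b≢v = bv ; c≢v = cv
  ; aX = aX ; bX = bX ; cX = cX ; vX = vX
  ; aY = aY ; bY = bY ; cY = cY ; vY = vY
  ; aZ = aZ ; bZ = bZ ; cZ = cZ ; vZ = vZ
  ; uX = uX ; uY = uY ; uZ = uZ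
  ; XY = λ x∈ → proj₁ (AllP.++⁻ (labels Y) (X-YZ x∈))
  ; XZ = λ x∈ → proj₂ (AllP.++⁻ (labels Y) (X-YZ x∈))
  ; YZ = Y-Z }

tet-vertex : ∀ {a b c : Fin n} {T u x} → Tet a b c T u → x ∈ u → x L.∈ a ∷ b ∷ c ∷ labels T
tet-vertex {a = a} {b} {c} (root {v = v}) x∈ with ∈⟦⟧⁻ (v ∷ a ∷ b ∷ c ∷ []) x∈
... | here refl                         = there (there (there (here refl)))
... | there (here refl)                 = here refl
... | there (there (here refl))         = there (here refl)
... | there (there (there (here refl))) = there (there (here refl))
tet-vertex (in₁ p) x∈ with tet-vertex p x∈
... | here refl                 = there (there (there (here refl)))
... | there (here refl)         = there (here refl)
... | there (there (here refl)) = there (there (here refl))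
... | there (there (there x∈X)) = there (there (there (there (LP.∈-++⁺ˡ x∈X))))
tet-vertex (in₂ {X = X} p) x∈ with tet-vertex p x∈
... | here refl                 = here refl
... | there (here refl)         = there (there (there (here refl)))
... | there (there (here refl)) = there (there (here refl))
... | there (there (there x∈Y)) = there (there (there (there (LP.∈-++⁺ʳ (labels X) (LP.∈-++⁺ˡ x∈Y)))))
tet-vertex (in₃ {X = X} {Y} p) x∈ with tet-vertex p x∈
... | here refl                 = here refl
... | there (here refl)         = there (here refl)
... | there (there (here refl)) = there (there (there (here refl)))
... | there (there (there x∈Z)) = there (there (there (there (LP.∈-++⁺ʳ (labels X) (LP.∈-++⁺ʳ (labels Y) x∈Z)))))

-- Mostly used for a replaced corner: `a` is neither a corner nor a label of the first subtree, so
-- no tetrahedron there contains it.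
tet-avoids : ∀ {a b c : Fin n} {T u z} → Tet a b c T u → All (z ≢_) (a ∷ b ∷ c ∷ labels T) → z ∉ u
tet-avoids p z≢ z∈ = All.lookup z≢ (tet-vertex p z∈) refl

Stacked-resp : ∀ {F F′ : Faces n} → F ≐ F′ → Stacked m F → Stacked m F′
Stacked-resp (to , from) (base u (p , q))       = base u (p ∘ from , to ∘ q)
Stacked-resp (to , from) (step st bd fr (p , q)) = step st bd fr (p ∘ from , to ∘ q)

-- The number of vertices after gluing the tetrahedra of T to a ball with m vertices.
_+ᵗ_ : Tree n → ℕ → ℕ
∅            +ᵗ m = m
node _ X Y Z +ᵗ m = Z +ᵗ (Y +ᵗ (X +ᵗ suc m))

+ᵗ≡ : ∀ (T : Tree n) m → T +ᵗ m ≡ length (labels T) + m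
+ᵗ≡ ∅              m = refl
+ᵗ≡ (node v X Y Z) m
  rewrite +ᵗ≡ Z (Y +ᵗ (X +ᵗ suc m)) | +ᵗ≡ Y (X +ᵗ suc m) | +ᵗ≡ X (suc m)
        | ListP.length-++ (labels X) {labels Y ++ labels Z} | ListP.length-++ (labels Y) {labels Z} =
  lemma (length (labels X)) (length (labels Y)) (length (labels Z)) m
  where
  open +-*-Solver
  lemma : ∀ x y z m → z + (y + (x + suc m)) ≡ suc (x + (y + z) + m)
  lemma = solve 4 (λ x y z m → z :+ (y :+ (x :+ (con 1 :+ m))) := con 1 :+ (x :+ (y :+ z) :+ m)) refl

_∪ᵗ_ : Faces n → Faces n → Faces n
(F ∪ᵗ G) u = F u ⊎ G u

owned : ∀ {F : Faces n} {t q} → ∣ t ∣ ≡ 3 → F q → t ⊆ q → (∀ {u} → F u → t ⊆ u → u ≡ q) → Bd F t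
owned ∣t∣ Fq t⊆q only = ∣t∣ , _ , (Fq , t⊆q) , λ (Fu , t⊆u) → sym (only Fu t⊆u)

module _ {a b c v : Fin n} {X Y Z : Tree n} (ng : NodeGood a b c v X Y Z) where
  open NodeGood ng

  ∣face₁∣ : ∣ ⟦ v ∷ b ∷ c ∷ [] ⟧ ∣ ≡ 3
  ∣face₁∣ = ∣⟦⟧∣ ((≢-sym b≢v ∷ ≢-sym c≢v ∷ []) ∷ (b≢c ∷ []) ∷ [] ∷ [])
  ∣face₂∣ : ∣ ⟦ a ∷ v ∷ c ∷ [] ⟧ ∣ ≡ 3
  ∣face₂∣ = ∣⟦⟧∣ ((a≢v ∷ a≢c ∷ []) ∷ (≢-sym c≢v ∷ []) ∷ [] ∷ [])
  ∣face₃∣ : ∣ ⟦ a ∷ b ∷ v ∷ [] ⟧ ∣ ≡ 3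
  ∣face₃∣ = ∣⟦⟧∣ ((a≢b ∷ a≢v ∷ []) ∷ (b≢v ∷ []) ∷ [] ∷ [])

face₁⊆ : ∀ (a b c v : Fin n) → ⟦ v ∷ b ∷ c ∷ [] ⟧ ⊆ ⟦ v ∷ a ∷ b ∷ c ∷ [] ⟧
face₁⊆ a b c v = ⟦⟧-mono {l = v ∷ b ∷ c ∷ []} {v ∷ a ∷ b ∷ c ∷ []}
  (here refl ∷ there (there (here refl)) ∷ there (there (there (here refl))) ∷ [])
face₂⊆ : ∀ (a b c v : Fin n) → ⟦ a ∷ v ∷ c ∷ [] ⟧ ⊆ ⟦ v ∷ a ∷ b ∷ c ∷ [] ⟧
face₂⊆ a b c v = ⟦⟧-mono {l = a ∷ v ∷ c ∷ []} {v ∷ a ∷ b ∷ c ∷ []}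
  (there (here refl) ∷ here refl ∷ there (there (there (here refl))) ∷ [])
face₃⊆ : ∀ (a b c v : Fin n) → ⟦ a ∷ b ∷ v ∷ [] ⟧ ⊆ ⟦ v ∷ a ∷ b ∷ c ∷ [] ⟧
face₃⊆ a b c v = ⟦⟧-mono {l = a ∷ b ∷ v ∷ []} {v ∷ a ∷ b ∷ c ∷ []}
  (there (here refl) ∷ there (there (here refl)) ∷ here refl ∷ [])

1st : ∀ {a : Fin n} {l} → a ∈ ⟦ a ∷ l ⟧
1st {a = a} {l} = ∈-insert a {⟦ l ⟧}
2nd : ∀ {a b : Fin n} {l} → b ∈ ⟦ a ∷ b ∷ l ⟧
2nd {a = a} {b} {l} = ⊆-insert a ⟦ b ∷ l ⟧ (1st {a = b} {l})
3rd : ∀ {a b c : Fin n} {l} → c ∈ ⟦ a ∷ b ∷ c ∷ l ⟧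
3rd {a = a} {b} {c} {l} = ⊆-insert a ⟦ b ∷ c ∷ l ⟧ (2nd {a = b} {c} {l})
4th : ∀ {a b c d : Fin n} {l} → d ∈ ⟦ a ∷ b ∷ c ∷ d ∷ l ⟧
4th {a = a} {b} {c} {d} {l} = ⊆-insert a ⟦ b ∷ c ∷ d ∷ l ⟧ (3rd {a = b} {c} {d} {l})

Fresh : List (Fin n) → Faces n → Set
Fresh l F = ∀ {z u} → z L.∈ l → F u → z ∉ u

root-avoids : ∀ {a b c v : Fin n} {l z} → Unique (a ∷ b ∷ c ∷ v ∷ l) → z L.∈ l → z ∉ ⟦ v ∷ a ∷ b ∷ c ∷ [] ⟧
root-avoids ((_ ∷ _ ∷ _ ∷ a≢) ∷ (_ ∷ _ ∷ b≢) ∷ (_ ∷ c≢) ∷ v≢ ∷ _) z∈ =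
  ∉⟦⟧ (≢-sym (All.lookup v≢ z∈) ∷ ≢-sym (All.lookup a≢ z∈) ∷ ≢-sym (All.lookup b≢ z∈) ∷ ≢-sym (All.lookup c≢ z∈) ∷ [])

mutual
  -- The face of each child is still on the boundary when its turn comes: the first subtree misses
  -- `a`, and the second misses `b`. This is separate from `grow` because the root tetrahedron of a
  -- whole tree comes from `base` and is not glued to anything.
  grow-children : ∀ {F : Faces n} {a b c v X Y Z} → Stacked m F → NodeGood a b c v X Y Z →
    F ⟦ v ∷ a ∷ b ∷ c ∷ [] ⟧ → (∀ {u} → F u → v ∈ u → u ≡ ⟦ v ∷ a ∷ b ∷ c ∷ [] ⟧) →
    Fresh (labels X ++ labels Y ++ labels Z) F →
    Stacked (Z +ᵗ (Y +ᵗ (X +ᵗ m))) (((F ∪ᵗ Tet v b c X) ∪ᵗ Tet a v c Y) ∪ᵗ Tet a b v Z)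
  grow-children {F = F} {a} {b} {c} {v} {X} {Y} {Z} st ng Fq only fr =
    grow {T = Z} (grow {T = Y} (grow {T = X} st bd₁ good₁ fr₁) bd₂ good₂ fr₂) bd₃ good₃ fr₃
    where
    open NodeGood ng
    q : Subset _
    q = ⟦ v ∷ a ∷ b ∷ c ∷ [] ⟧
    bd₁ : Bd F ⟦ v ∷ b ∷ c ∷ [] ⟧
    bd₁ = owned (∣face₁∣ ng) Fq (face₁⊆ a b c v) λ Fu t⊆u → only Fu (t⊆u (1st {l = b ∷ c ∷ []}))
    fr₁ : Fresh (labels X) F
    fr₁ z∈ = fr (LP.∈-++⁺ˡ z∈)
    bd₂ : Bd (F ∪ᵗ Tet v b c X) ⟦ a ∷ v ∷ c ∷ [] ⟧
    bd₂ = owned (∣face₂∣ ng) (inj₁ Fq) (face₂⊆ a b c v) λ where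
      (inj₁ Fu) t⊆u → only Fu (t⊆u (2nd {l = c ∷ []}))
      (inj₂ p)  t⊆u → contradiction (t⊆u (1st {l = v ∷ c ∷ []})) (tet-avoids p (a≢v ∷ a≢b ∷ a≢c ∷ aX))
    fr₂ : Fresh (labels Y) (F ∪ᵗ Tet v b c X)
    fr₂ z∈ (inj₁ Fu) = fr (LP.∈-++⁺ʳ (labels X) (LP.∈-++⁺ˡ z∈)) Fu
    fr₂ z∈ (inj₂ p)  = tet-avoids p
      (≢-sym (All.lookup vY z∈) ∷ ≢-sym (All.lookup bY z∈) ∷ ≢-sym (All.lookup cY z∈) ∷
       All.tabulate (λ x∈ → ≢-sym (All.lookup (XY x∈) z∈)))
    bd₃ : Bd ((F ∪ᵗ Tet v b c X) ∪ᵗ Tet a v c Y) ⟦ a ∷ b ∷ v ∷ [] ⟧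
    bd₃ = owned (∣face₃∣ ng) (inj₁ (inj₁ Fq)) (face₃⊆ a b c v) λ where
      (inj₁ (inj₁ Fu)) t⊆u → only Fu (t⊆u (3rd {l = []}))
      (inj₁ (inj₂ p))  t⊆u → contradiction (t⊆u (1st {l = b ∷ v ∷ []})) (tet-avoids p (a≢v ∷ a≢b ∷ a≢c ∷ aX))
      (inj₂ p)         t⊆u → contradiction (t⊆u (2nd {l = v ∷ []})) (tet-avoids p (≢-sym a≢b ∷ b≢v ∷ b≢c ∷ bY))
    fr₃ : Fresh (labels Z) ((F ∪ᵗ Tet v b c X) ∪ᵗ Tet a v c Y)
    fr₃ z∈ (inj₁ (inj₁ Fu)) = fr (LP.∈-++⁺ʳ (labels X) (LP.∈-++⁺ʳ (labels Y) z∈)) Fu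
    fr₃ z∈ (inj₁ (inj₂ p))  = tet-avoids p
      (≢-sym (All.lookup vZ z∈) ∷ ≢-sym (All.lookup bZ z∈) ∷ ≢-sym (All.lookup cZ z∈) ∷
       All.tabulate (λ x∈ → ≢-sym (All.lookup (XZ x∈) z∈)))
    fr₃ z∈ (inj₂ p)         = tet-avoids p
      (≢-sym (All.lookup aZ z∈) ∷ ≢-sym (All.lookup vZ z∈) ∷ ≢-sym (All.lookup cZ z∈) ∷
       All.tabulate (λ x∈ → ≢-sym (All.lookup (YZ x∈) z∈)))

  grow : ∀ {F : Faces n} {a b c T} → Stacked m F → Bd F ⟦ a ∷ b ∷ c ∷ [] ⟧ → Good a b c T →
         Fresh (labels T) F → Stacked (T +ᵗ m) (F ∪ᵗ Tet a b c T)
  grow {T = ∅} st _ _ _ = Stacked-resp (inj₁ , λ { (inj₁ Fu) → Fu }) st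
  grow {F = F} {a} {b} {c} {T = node v X Y Z} st bd good fr =
    Stacked-resp (to , from)
      (grow-children {X = X} {Y} {Z} (step st bd (fr (here refl)) (id , id)) ng (inj₂ refl) only fr′)
    where
    ng : NodeGood a b c v X Y Z
    ng = nodeGood good
    open NodeGood ng
    F₁ : Faces _
    F₁ u = F u ⊎ u ≡ ⟦ v ∷ a ∷ b ∷ c ∷ [] ⟧
    only : ∀ {u} → F₁ u → v ∈ u → u ≡ ⟦ v ∷ a ∷ b ∷ c ∷ [] ⟧
    only (inj₁ Fu) v∈u = contradiction v∈u (fr (here refl) Fu)
    only (inj₂ eq) _   = eq
    fr′ : Fresh (labels X ++ labels Y ++ labels Z) F₁
    fr′ z∈ (inj₁ Fu)   = fr (there z∈) Fu
    fr′ z∈ (inj₂ refl) = root-avoids good z∈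
    to : ∀ {u} → (((F₁ ∪ᵗ Tet v b c X) ∪ᵗ Tet a v c Y) ∪ᵗ Tet a b v Z) u → (F ∪ᵗ Tet a b c (node v X Y Z)) u
    to (inj₁ (inj₁ (inj₁ (inj₁ Fu))))   = inj₁ Fu
    to (inj₁ (inj₁ (inj₁ (inj₂ refl)))) = inj₂ root
    to (inj₁ (inj₁ (inj₂ p)))           = inj₂ (in₁ p)
    to (inj₁ (inj₂ p))                  = inj₂ (in₂ p)
    to (inj₂ p)                         = inj₂ (in₃ p)
    from : ∀ {u} → (F ∪ᵗ Tet a b c (node v X Y Z)) u → (((F₁ ∪ᵗ Tet v b c X) ∪ᵗ Tet a v c Y) ∪ᵗ Tet a b v Z) u
    from (inj₁ Fu)      = inj₁ (inj₁ (inj₁ (inj₁ Fu)))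
    from (inj₂ root)    = inj₁ (inj₁ (inj₁ (inj₂ refl)))
    from (inj₂ (in₁ p)) = inj₁ (inj₁ (inj₂ p))
    from (inj₂ (in₂ p)) = inj₁ (inj₂ p)
    from (inj₂ (in₃ p)) = inj₂ p

Tet-stacked : ∀ {a b c v : Fin n} {X Y Z} → Good a b c (node v X Y Z) →
              Stacked (3 + length (labels (node v X Y Z))) (Tet a b c (node v X Y Z))
Tet-stacked {n} {a} {b} {c} {v} {X} {Y} {Z} good = subst (λ k → Stacked k (Tet a b c (node v X Y Z))) count
  (Stacked-resp (to , from) (grow-children {X = X} {Y} {Z} (base (NodeGood.corners ng) (id , id)) ng refl (λ eq _ → eq) fr))
  where
  ng : NodeGood a b c v X Y Z
  ng = nodeGood good
  q : Subset n
  q = ⟦ v ∷ a ∷ b ∷ c ∷ [] ⟧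
  fr : Fresh (labels X ++ labels Y ++ labels Z) (_≡ q)
  fr z∈ refl = root-avoids good z∈
  count : node v X Y Z +ᵗ 3 ≡ 3 + length (labels (node v X Y Z))
  count = trans (+ᵗ≡ (node v X Y Z) 3) (+-comm _ 3)
  to : ∀ {u} → ((((_≡ q) ∪ᵗ Tet v b c X) ∪ᵗ Tet a v c Y) ∪ᵗ Tet a b v Z) u → Tet a b c (node v X Y Z) u
  to (inj₁ (inj₁ (inj₁ refl))) = root
  to (inj₁ (inj₁ (inj₂ p)))    = in₁ p
  to (inj₁ (inj₂ p))           = in₂ p
  to (inj₂ p)                  = in₃ p
  from : ∀ {u} → Tet a b c (node v X Y Z) u → ((((_≡ q) ∪ᵗ Tet v b c X) ∪ᵗ Tet a v c Y) ∪ᵗ Tet a b v Z) u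
  from root    = inj₁ (inj₁ (inj₁ refl))
  from (in₁ p) = inj₁ (inj₁ (inj₂ p))
  from (in₂ p) = inj₁ (inj₂ p)
  from (in₃ p) = inj₂ p

-- Unfolding a stacked ball into a tree

Unique-↭ : ∀ {A : Set} {l l′ : List A} → l ↭ l′ → Unique l → Unique l′
Unique-↭ p = SetoidPerm.Unique-resp-↭ (setoid _) (↭⇒↭ₛ p)

⟦⟧-↭ : ∀ {l l′ : List (Fin n)} → l ↭ l′ → ⟦ l ⟧ ≡ ⟦ l′ ⟧
⟦⟧-↭ {l = l} {l′} p = ⊆-antisym
  (λ x∈ → ∈⟦⟧⁺ (∈-resp-↭ p (∈⟦⟧⁻ l x∈)))
  (λ x∈ → ∈⟦⟧⁺ (∈-resp-↭ (↭-sym p) (∈⟦⟧⁻ l′ x∈)))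

missing-vertex : ∀ {l l′ : List (Fin n)} {x t} → Unique l → x ∉ t → t ⊆ ⟦ l ⟧ → suc ∣ t ∣ ≡ length l →
                 l ↭ x ∷ l′ → t ≡ ⟦ l′ ⟧
missing-vertex {t = t} u x∉t t⊆ ∣t∣ p with _ ∷ u′ ← Unique-↭ p u =
  ⊆∧∣≡∣⇒≡ (insert-drop x∉t (subst (t ⊆_) (⟦⟧-↭ p) t⊆)) refl
          (trans (∣⟦⟧∣ u′) (ℕ-suc-injective (sym (trans ∣t∣ (↭-length p)))))

-- Exactly one of the four vertices is missing. The order of the cases is that of the three children
-- of a node, with the root face last.
facets : ∀ {v a b c : Fin n} {t} → Unique (v ∷ a ∷ b ∷ c ∷ []) → ∣ t ∣ ≡ 3 → t ⊆ ⟦ v ∷ a ∷ b ∷ c ∷ [] ⟧ →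
         t ≡ ⟦ v ∷ b ∷ c ∷ [] ⟧ ⊎ t ≡ ⟦ a ∷ v ∷ c ∷ [] ⟧ ⊎ t ≡ ⟦ a ∷ b ∷ v ∷ [] ⟧ ⊎ t ≡ ⟦ a ∷ b ∷ c ∷ [] ⟧
facets {v = v} {a} {b} {c} {t} u ∣t∣ t⊆
  with x , x∈ , x∉t ← ∣∣<⇒∃∉ {p = ⟦ v ∷ a ∷ b ∷ c ∷ [] ⟧} {t} (≤-reflexive (trans (cong suc ∣t∣) (sym (∣⟦⟧∣ u))))
  with ∈⟦⟧⁻ (v ∷ a ∷ b ∷ c ∷ []) x∈
... | here refl                         = inj₂ (inj₂ (inj₂ (missing-vertex u x∉t t⊆ (cong suc ∣t∣) ↭-refl)))
... | there (here refl)                 = inj₁ (missing-vertex u x∉t t⊆ (cong suc ∣t∣) (swap _ _ ↭-refl))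
... | there (there (here refl))         = inj₂ (inj₁ (missing-vertex u x∉t t⊆ (cong suc ∣t∣)
  (↭-trans (swap v a ↭-refl) (shift b (a ∷ v ∷ []) (c ∷ [])))))
... | there (there (there (here refl))) = inj₂ (inj₂ (inj₁ (missing-vertex u x∉t t⊆ (cong suc ∣t∣)
  (↭-trans (shift c (v ∷ a ∷ b ∷ []) []) (prep c (↭-sym (shift v (a ∷ b ∷ []) [])))))))

-- The labels are compared only up to permutation, since the new apex can land anywhere in the
-- preorder listing.
record Extends {n : ℕ} (a b c : Fin n) (T T′ : Tree n) (q : Subset n) (z : Fin n) : Set where
  field
    tets⁺  : ∀ {u} → Tet a b c T u ⊎ u ≡ q → Tet a b c T′ u
    tets⁻  : ∀ {u} → Tet a b c T′ u → Tet a b c T u ⊎ u ≡ q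
    labels↭ : labels T′ ↭ z ∷ labels T

module _ {a b c : Fin n} {q : Subset n} {z : Fin n} where
  open Extends

  extends-∅ : q ≡ ⟦ z ∷ a ∷ b ∷ c ∷ [] ⟧ → Extends a b c ∅ (node z ∅ ∅ ∅) q z
  extends-∅ refl = record
    { tets⁺ = λ { (inj₂ refl) → root } ; tets⁻ = λ { root → inj₂ refl } ; labels↭ = ↭-refl }

  module _ {v : Fin n} {X Y Z : Tree n} where

    extends₁ : ∀ {X′} → Extends v b c X X′ q z → Extends a b c (node v X Y Z) (node v X′ Y Z) q z
    extends₁ {X′} e = record { tets⁺ = to ; tets⁻ = from
      ; labels↭ = ↭-trans (prep v (++⁺ʳ (labels Y ++ labels Z) (labels↭ e))) (swap v z ↭-refl) }
      where
      to : ∀ {u} → Tet a b c (node v X Y Z) u ⊎ u ≡ q → Tet a b c (node v X′ Y Z) u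
      to (inj₁ root)    = root
      to (inj₁ (in₁ p)) = in₁ (tets⁺ e (inj₁ p))
      to (inj₁ (in₂ p)) = in₂ p
      to (inj₁ (in₃ p)) = in₃ p
      to (inj₂ eq)      = in₁ (tets⁺ e (inj₂ eq))
      from : ∀ {u} → Tet a b c (node v X′ Y Z) u → Tet a b c (node v X Y Z) u ⊎ u ≡ q
      from root    = inj₁ root
      from (in₁ p) = [ inj₁ ∘ in₁ , inj₂ ]′ (tets⁻ e p)
      from (in₂ p) = inj₁ (in₂ p)
      from (in₃ p) = inj₁ (in₃ p)

    extends₂ : ∀ {Y′} → Extends a v c Y Y′ q z → Extends a b c (node v X Y Z) (node v X Y′ Z) q z
    extends₂ {Y′} e = record { tets⁺ = to ; tets⁻ = from
      ; labels↭ = ↭-trans (prep v (++⁺ˡ (labels X) (++⁺ʳ (labels Z) (labels↭ e))))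
                          (shift z (v ∷ labels X) (labels Y ++ labels Z)) }
      where
      to : ∀ {u} → Tet a b c (node v X Y Z) u ⊎ u ≡ q → Tet a b c (node v X Y′ Z) u
      to (inj₁ root)    = root
      to (inj₁ (in₁ p)) = in₁ p
      to (inj₁ (in₂ p)) = in₂ (tets⁺ e (inj₁ p))
      to (inj₁ (in₃ p)) = in₃ p
      to (inj₂ eq)      = in₂ (tets⁺ e (inj₂ eq))
      from : ∀ {u} → Tet a b c (node v X Y′ Z) u → Tet a b c (node v X Y Z) u ⊎ u ≡ q
      from root    = inj₁ root
      from (in₁ p) = inj₁ (in₁ p)
      from (in₂ p) = [ inj₁ ∘ in₂ , inj₂ ]′ (tets⁻ e p)
      from (in₃ p) = inj₁ (in₃ p)

    extends₃ : ∀ {Z′} → Extends a b v Z Z′ q z → Extends a b c (node v X Y Z) (node v X Y Z′) q z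
    extends₃ {Z′} e = record { tets⁺ = to ; tets⁻ = from
      ; labels↭ = ↭-trans (prep v (++⁺ˡ (labels X) (++⁺ˡ (labels Y) (labels↭ e)))) shuffled }
      where
      shuffled : v ∷ labels X ++ labels Y ++ z ∷ labels Z ↭ z ∷ v ∷ labels X ++ labels Y ++ labels Z
      shuffled rewrite sym (ListP.++-assoc (labels X) (labels Y) (z ∷ labels Z))
                     | sym (ListP.++-assoc (labels X) (labels Y) (labels Z)) =
        shift z (v ∷ labels X ++ labels Y) (labels Z)
      to : ∀ {u} → Tet a b c (node v X Y Z) u ⊎ u ≡ q → Tet a b c (node v X Y Z′) u
      to (inj₁ root)    = root
      to (inj₁ (in₁ p)) = in₁ p
      to (inj₁ (in₂ p)) = in₂ p
      to (inj₁ (in₃ p)) = in₃ (tets⁺ e (inj₁ p))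
      to (inj₂ eq)      = in₃ (tets⁺ e (inj₂ eq))
      from : ∀ {u} → Tet a b c (node v X Y Z′) u → Tet a b c (node v X Y Z) u ⊎ u ≡ q
      from root    = inj₁ root
      from (in₁ p) = inj₁ (in₁ p)
      from (in₂ p) = inj₁ (in₂ p)
      from (in₃ p) = [ inj₁ ∘ in₃ , inj₂ ]′ (tets⁻ e p)

-- The new tetrahedron hangs below the owner `u` of `t`. At `u` the matching child must be empty, as
-- its root would otherwise be a second owner of `t`. On the way down `t` is never the root face of
-- the subtree, because that face is also owned by the parent.
insert : ∀ {a b c : Fin n} {T u t} (z : Fin n) → Good a b c T → Tet a b c T u → t ⊆ u →
         (∀ {w} → Tet a b c T w → t ⊆ w → w ≡ u) → ∣ t ∣ ≡ 3 → t ≢ ⟦ a ∷ b ∷ c ∷ [] ⟧ →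
         ∃[ T′ ] Extends a b c T T′ (⁅ z ⁆ ∪ t) z
insert {a = a} {b} {c} {T = node v X Y Z} {t = t} z good root t⊆ only ∣t∣ t≢ = cases (facets corners ∣t∣ t⊆)
  where
  open NodeGood (nodeGood {X = X} {Y} {Z} good)
  at₁ : ∀ X → All (a ≢_) (labels X) → (∀ {w} → Tet v b c X w → t ⊆ w → w ≡ ⟦ v ∷ a ∷ b ∷ c ∷ [] ⟧) →
        t ≡ ⟦ v ∷ b ∷ c ∷ [] ⟧ → ∃[ X′ ] Extends v b c X X′ (⁅ z ⁆ ∪ t) z
  at₁ ∅ _ _ refl = _ , extends-∅ refl
  at₁ (node x P Q R) aX only refl = contradiction
    (subst (a ∈_) (sym (only root (⊆-insert x _))) (2nd {l = b ∷ c ∷ []}))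
    (tet-avoids {T = node x P Q R} root (a≢v ∷ a≢b ∷ a≢c ∷ aX))
  at₂ : ∀ Y → All (b ≢_) (labels Y) → (∀ {w} → Tet a v c Y w → t ⊆ w → w ≡ ⟦ v ∷ a ∷ b ∷ c ∷ [] ⟧) →
        t ≡ ⟦ a ∷ v ∷ c ∷ [] ⟧ → ∃[ Y′ ] Extends a v c Y Y′ (⁅ z ⁆ ∪ t) z
  at₂ ∅ _ _ refl = _ , extends-∅ refl
  at₂ (node x P Q R) bY only refl = contradiction
    (subst (b ∈_) (sym (only root (⊆-insert x _))) (3rd {l = c ∷ []}))
    (tet-avoids {T = node x P Q R} root (≢-sym a≢b ∷ b≢v ∷ b≢c ∷ bY))
  at₃ : ∀ Z → All (c ≢_) (labels Z) → (∀ {w} → Tet a b v Z w → t ⊆ w → w ≡ ⟦ v ∷ a ∷ b ∷ c ∷ [] ⟧) →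
        t ≡ ⟦ a ∷ b ∷ v ∷ [] ⟧ → ∃[ Z′ ] Extends a b v Z Z′ (⁅ z ⁆ ∪ t) z
  at₃ ∅ _ _ refl = _ , extends-∅ refl
  at₃ (node x P Q R) cZ only refl = contradiction
    (subst (c ∈_) (sym (only root (⊆-insert x _))) (4th {l = []}))
    (tet-avoids {T = node x P Q R} root (≢-sym a≢c ∷ ≢-sym b≢c ∷ c≢v ∷ cZ))
  cases : _ → _
  cases (inj₁ eq)                = let _ , e = at₁ X aX (only ∘ in₁) eq in _ , extends₁ e
  cases (inj₂ (inj₁ eq))         = let _ , e = at₂ Y bY (only ∘ in₂) eq in _ , extends₂ e
  cases (inj₂ (inj₂ (inj₁ eq)))  = let _ , e = at₃ Z cZ (only ∘ in₃) eq in _ , extends₃ e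
  cases (inj₂ (inj₂ (inj₂ eq)))  = contradiction eq t≢
insert {a = a} {b} {c} {T = node v X Y Z} z good (in₁ p) t⊆ only ∣t∣ t≢ =
  let _ , e = insert {T = X} z good₁ p t⊆ (only ∘ in₁) ∣t∣ t≢₁ in _ , extends₁ e
  where
  open NodeGood (nodeGood {X = X} {Y} {Z} good)
  t≢₁ : _ ≢ ⟦ v ∷ b ∷ c ∷ [] ⟧
  t≢₁ refl = tet-avoids p (a≢v ∷ a≢b ∷ a≢c ∷ aX) (subst (a ∈_) (only root (face₁⊆ a b c v)) (2nd {l = b ∷ c ∷ []}))
insert {a = a} {b} {c} {T = node v X Y Z} z good (in₂ p) t⊆ only ∣t∣ t≢ =
  let _ , e = insert {T = Y} z good₂ p t⊆ (only ∘ in₂) ∣t∣ t≢₂ in _ , extends₂ e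
  where
  open NodeGood (nodeGood {X = X} {Y} {Z} good)
  t≢₂ : _ ≢ ⟦ a ∷ v ∷ c ∷ [] ⟧
  t≢₂ refl = tet-avoids p (≢-sym a≢b ∷ b≢v ∷ b≢c ∷ bY) (subst (b ∈_) (only root (face₂⊆ a b c v)) (3rd {l = c ∷ []}))
insert {a = a} {b} {c} {T = node v X Y Z} z good (in₃ p) t⊆ only ∣t∣ t≢ =
  let _ , e = insert {T = Z} z good₃ p t⊆ (only ∘ in₃) ∣t∣ t≢₃ in _ , extends₃ e
  where
  open NodeGood (nodeGood {X = X} {Y} {Z} good)
  t≢₃ : _ ≢ ⟦ a ∷ b ∷ v ∷ [] ⟧
  t≢₃ refl = tet-avoids p (≢-sym a≢c ∷ ≢-sym b≢c ∷ c≢v ∷ cZ) (subst (c ∈_) (only root (face₃⊆ a b c v)) (4th {l = []}))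

label-in-tet : ∀ {a b c : Fin n} T {x} → x L.∈ labels T → ∃[ u ] Tet a b c T u × x ∈ u
label-in-tet (node v X Y Z) (here refl) = _ , root , ∈-insert v
label-in-tet (node v X Y Z) (there x∈) with LP.∈-++⁻ (labels X) x∈
... | inj₁ x∈X = let u , p , x∈u = label-in-tet X x∈X in u , in₁ p , x∈u
... | inj₂ x∈YZ with LP.∈-++⁻ (labels Y) x∈YZ
... | inj₁ x∈Y = let u , p , x∈u = label-in-tet Y x∈Y in u , in₂ p , x∈u
... | inj₂ x∈Z = let u , p , x∈u = label-in-tet Z x∈Z in u , in₃ p , x∈u

BallTets : (Fin m → Fin n) → Faces m → Faces n
BallTets f B u = ∃[ w ] Tetrahedron B w × u ≡ push f w

module _ {B : Faces m} {t : Subset m} (bt : BoundaryTriangle B t) (f : Fin (suc m) → Fin n) where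

  glue-tets⁺ : ∀ {u} → BallTets (f ∘ suc) B u ⊎ u ≡ ⁅ f zero ⁆ ∪ push (f ∘ suc) t → BallTets f (glue B t) u
  glue-tets⁺ (inj₁ (w , Bw , eq)) = outside ∷ w , Bw , eq
  glue-tets⁺ (inj₂ eq)            = inside ∷ t , glue-tetrahedron⁺ {B = B} (proj₂ (proj₁ bt)) , eq

  glue-tets⁻ : ∀ {u} → BallTets f (glue B t) u → BallTets (f ∘ suc) B u ⊎ u ≡ ⁅ f zero ⁆ ∪ push (f ∘ suc) t
  glue-tets⁻ (outside ∷ w , Bw , eq) = inj₁ (w , Bw , eq)
  glue-tets⁻ (inside  ∷ w , gw , eq) with refl ← glue-tetrahedron⁻ {B = B} (proj₂ (proj₁ bt)) gw = inj₂ eq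

-- T describes the ball B, with its vertices renamed by f, as seen from the triangle t.
record Unfolding {m n : ℕ} (f : Fin m → Fin n) (B : Faces m) (t : Subset m) : Set where
  field
    {a b c} : Fin n
    T       : Tree n
    face    : push f t ≡ ⟦ a ∷ b ∷ c ∷ [] ⟧
    tets    : Tet a b c T ≐ BallTets f B
    good    : Good a b c T
    size    : 3 + length (labels T) ≡ m

zero-fresh : ∀ {f : Fin (suc m) → Fin n} → Inj f → ∀ {B : Faces m} {t} (U : Unfolding (f ∘ suc) B t) →
             let open Unfolding U in All (f zero ≢_) (a ∷ b ∷ c ∷ labels T)
zero-fresh {f = f} inj {t = t} U = corner (1st {l = b ∷ c ∷ []}) ∷ corner (2nd {l = c ∷ []}) ∷ corner (3rd {l = []}) ∷ All.tabulate label
  where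
  open Unfolding U
  corner : ∀ {x} → x ∈ ⟦ a ∷ b ∷ c ∷ [] ⟧ → f zero ≢ x
  corner x∈ refl = zero∉push-suc inj t (subst (f zero ∈_) (sym face) x∈)
  label : ∀ {x} → x L.∈ labels T → f zero ≢ x
  label x∈ refl with u , p , x∈u ← label-in-tet T x∈ with w , _ , refl ← proj₁ tets p =
    zero∉push-suc inj w x∈u

module _ {f : Fin (suc m) → Fin n} (inj : Inj f) {B : Faces m} {t : Subset m}
         (bt : BoundaryTriangle B t) (U : Unfolding (f ∘ suc) B t) where
  open Unfolding U

  cone : Subset n
  cone = ⁅ f zero ⁆ ∪ push (f ∘ suc) t

  cone≡ : cone ≡ ⟦ f zero ∷ a ∷ b ∷ c ∷ [] ⟧
  cone≡ = cong (⁅ f zero ⁆ ∪_) face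

  good-cone : Unique (f zero ∷ a ∷ b ∷ c ∷ labels T)
  good-cone = zero-fresh inj U ∷ good

  private
    z = f zero

    glued : ∀ {F : Faces n} → (∀ {u} → F u → Tet a b c T u ⊎ u ≡ ⟦ z ∷ a ∷ b ∷ c ∷ [] ⟧) →
            (∀ {u} → Tet a b c T u ⊎ u ≡ ⟦ z ∷ a ∷ b ∷ c ∷ [] ⟧ → F u) → F ≐ BallTets f (glue B t)
    glued to from =
      (λ Fu → [ (λ p → glue-tets⁺ bt f (inj₁ (proj₁ tets p)))
              , (λ eq → glue-tets⁺ bt f (inj₂ (trans eq (sym cone≡)))) ]′ (to Fu)) ,
      (λ gu → [ (λ Bu → from (inj₁ (proj₂ tets Bu))) , (λ eq → from (inj₂ (trans eq cone≡))) ]′ (glue-tets⁻ bt f gu))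

  -- The old tree needs no re-rooting. Seen from a side face of the cone, the new root has as apex
  -- the corner missing from that face, and the entire old ball lies beyond the glued triangle, at
  -- the child where `z` is replaced by that corner. Likewise for `unfold₂` and `unfold₃`.
  unfold₁ : ∀ {s} → push f s ≡ ⟦ z ∷ b ∷ c ∷ [] ⟧ → Unfolding f (glue B t) s
  unfold₁ eq = record { T = node a T ∅ ∅ ; face = eq ; tets = glued to from
    ; good = Unique-↭ (prep z (↭-sym (shift a (b ∷ c ∷ []) _)))
        (subst (λ l → Unique (z ∷ a ∷ b ∷ c ∷ l)) (sym (ListP.++-identityʳ (labels T))) good-cone)
    ; size = trans (cong (4 +_) (cong length (ListP.++-identityʳ (labels T)))) (cong suc size) }
    where
    q≡ : ⟦ z ∷ a ∷ b ∷ c ∷ [] ⟧ ≡ ⟦ a ∷ z ∷ b ∷ c ∷ [] ⟧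
    q≡ = ⟦⟧-↭ {l = z ∷ a ∷ b ∷ c ∷ []} (swap z a ↭-refl)
    to : ∀ {u} → Tet z b c (node a T ∅ ∅) u → Tet a b c T u ⊎ u ≡ ⟦ z ∷ a ∷ b ∷ c ∷ [] ⟧
    to root    = inj₂ (sym q≡)
    to (in₁ p) = inj₁ p
    from : ∀ {u} → Tet a b c T u ⊎ u ≡ ⟦ z ∷ a ∷ b ∷ c ∷ [] ⟧ → Tet z b c (node a T ∅ ∅) u
    from (inj₁ p)    = in₁ p
    from (inj₂ refl) = subst (Tet z b c (node a T ∅ ∅)) (sym q≡) root

  unfold₂ : ∀ {s} → push f s ≡ ⟦ a ∷ z ∷ c ∷ [] ⟧ → Unfolding f (glue B t) s
  unfold₂ eq = record { T = node b ∅ T ∅ ; face = eq ; tets = glued to from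
    ; good = Unique-↭ perm
        (subst (λ l → Unique (z ∷ a ∷ b ∷ c ∷ l)) (sym (ListP.++-identityʳ (labels T))) good-cone)
    ; size = trans (cong (4 +_) (cong length (ListP.++-identityʳ (labels T)))) (cong suc size) }
    where
    perm : ∀ {l} → z ∷ a ∷ b ∷ c ∷ l ↭ a ∷ z ∷ c ∷ b ∷ l
    perm = swap z a (swap b c ↭-refl)
    q≡ : ⟦ z ∷ a ∷ b ∷ c ∷ [] ⟧ ≡ ⟦ b ∷ a ∷ z ∷ c ∷ [] ⟧
    q≡ = ⟦⟧-↭ (↭-trans (swap z a ↭-refl) (shift b (a ∷ z ∷ []) (c ∷ [])))
    to : ∀ {u} → Tet a z c (node b ∅ T ∅) u → Tet a b c T u ⊎ u ≡ ⟦ z ∷ a ∷ b ∷ c ∷ [] ⟧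
    to root    = inj₂ (sym q≡)
    to (in₂ p) = inj₁ p
    from : ∀ {u} → Tet a b c T u ⊎ u ≡ ⟦ z ∷ a ∷ b ∷ c ∷ [] ⟧ → Tet a z c (node b ∅ T ∅) u
    from (inj₁ p)    = in₂ p
    from (inj₂ refl) = subst (Tet a z c (node b ∅ T ∅)) (sym q≡) root

  unfold₃ : ∀ {s} → push f s ≡ ⟦ a ∷ b ∷ z ∷ [] ⟧ → Unfolding f (glue B t) s
  unfold₃ eq = record { T = node c ∅ ∅ T ; face = eq ; tets = glued to from
    ; good = Unique-↭ (↭-sym (shift z (a ∷ b ∷ []) _)) good-cone
    ; size = cong suc size }
    where
    q≡ : ⟦ z ∷ a ∷ b ∷ c ∷ [] ⟧ ≡ ⟦ c ∷ a ∷ b ∷ z ∷ [] ⟧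
    q≡ = ⟦⟧-↭ (↭-trans (shift c (z ∷ a ∷ b ∷ []) []) (prep c (↭-sym (shift z (a ∷ b ∷ []) []))))
    to : ∀ {u} → Tet a b z (node c ∅ ∅ T) u → Tet a b c T u ⊎ u ≡ ⟦ z ∷ a ∷ b ∷ c ∷ [] ⟧
    to root    = inj₂ (sym q≡)
    to (in₃ p) = inj₁ p
    from : ∀ {u} → Tet a b c T u ⊎ u ≡ ⟦ z ∷ a ∷ b ∷ c ∷ [] ⟧ → Tet a b z (node c ∅ ∅ T) u
    from (inj₁ p)    = in₃ p
    from (inj₂ refl) = subst (Tet a b z (node c ∅ ∅ T)) (sym q≡) root

  unfold-cone : ∀ {e} → e ⊆ t → ∣ inside ∷ e ∣ ≡ 3 → Unfolding f (glue B t) (inside ∷ e)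
  unfold-cone {e} e⊆t ∣e∣
    with facets (UniqueP.take⁺ 4 good-cone) (trans (∣push∣ inj (inside ∷ e)) ∣e∣)
           (subst (push f (inside ∷ e) ⊆_) cone≡ (insert-mono (push-mono (f ∘ suc) e⊆t)))
  ... | inj₁ eq               = unfold₁ eq
  ... | inj₂ (inj₁ eq)        = unfold₂ eq
  ... | inj₂ (inj₂ (inj₁ eq)) = unfold₃ eq
  ... | inj₂ (inj₂ (inj₂ eq)) = contradiction (subst (z ∈_) eq (∈-insert z))
                                  (∉⟦⟧ (All.lookup (zero-fresh inj U) (here refl) ∷ All.lookup (zero-fresh inj U) (there (here refl)) ∷
                                        All.lookup (zero-fresh inj U) (there (there (here refl))) ∷ []))

unfold-old : ∀ {f : Fin (suc m) → Fin n} → Inj f → ∀ {B : Faces m} {t s} → BoundaryTriangle B t →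
             Unfolding (f ∘ suc) B s → t ≢ s → Unfolding f (glue B t) (outside ∷ s)
unfold-old {f = f} inj {B} {t} {s} bt@((Bt , ∣t∣) , w , (Bw , t⊆w) , only) U t≢s =
  record { T = T′ ; face = face ; tets = to , from
         ; good = Unique-↭ perm (zero-fresh inj U ∷ good) ; size = trans (cong (3 +_) (↭-length labels↭)) (cong suc size) }
  where
  open Unfolding U
  g = f ∘ suc
  g-inj : Inj g
  g-inj = ∘suc-inj inj
  only-tet : ∀ {u} → Tet a b c T u → push g t ⊆ u → u ≡ push g w
  only-tet p t⊆u with w′ , Bw′ , refl ← proj₁ tets p = cong (push g) (sym (only (Bw′ , push-mono⁻ g-inj t⊆u)))
  inserted : ∃[ T′ ] Extends a b c T T′ (⁅ f zero ⁆ ∪ push g t) (f zero)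
  inserted = insert (f zero) good (proj₂ tets (w , Bw , refl)) (push-mono g t⊆w) only-tet
               (trans (∣push∣ g-inj t) ∣t∣) (λ eq → t≢s (push-injective g-inj (trans eq (sym face))))
  T′ = proj₁ inserted
  open Extends (proj₂ inserted)
  perm : f zero ∷ a ∷ b ∷ c ∷ labels T ↭ a ∷ b ∷ c ∷ labels T′
  perm = ↭-trans (↭-sym (shift (f zero) (a ∷ b ∷ c ∷ []) (labels T))) (++⁺ˡ (a ∷ b ∷ c ∷ []) (↭-sym labels↭))
  to : ∀ {u} → Tet a b c T′ u → BallTets f (glue B t) u
  to p = glue-tets⁺ bt f ([ inj₁ ∘ proj₁ tets , inj₂ ]′ (tets⁻ p))
  from : ∀ {u} → BallTets f (glue B t) u → Tet a b c T′ u
  from p = tets⁺ ([ inj₁ ∘ proj₂ tets , inj₂ ]′ (glue-tets⁻ bt f p))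

unfold-tetrahedron : ∀ {f : Fin 4 → Fin n} → Inj f → ∀ {t} → ∣ t ∣ ≡ 3 → Unfolding f Full t
unfold-tetrahedron {f = f} inj {t} ∣t∣ =
  cases (facets uq (trans (∣push∣ inj t) ∣t∣) (push-mono f {t} {⊤} ⊆⊤))
  where
  p = f zero
  q = f (suc zero)
  r = f (suc (suc zero))
  s = f (suc (suc (suc zero)))
  uq : Unique (p ∷ q ∷ r ∷ s ∷ [])
  uq = UniqueP.map⁺ inj (UniqueP.allFin⁺ 4)
  single : ∀ {v a b c} → p ∷ q ∷ r ∷ s ∷ [] ↭ v ∷ a ∷ b ∷ c ∷ [] → push f t ≡ ⟦ a ∷ b ∷ c ∷ [] ⟧ → Unfolding f Full t
  single {v} {a} {b} {c} perm eq = record { T = node v ∅ ∅ ∅ ; face = eq ; tets = to , from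
    ; good = Unique-↭ (↭-trans perm (↭-sym (shift v (a ∷ b ∷ c ∷ []) []))) uq ; size = refl }
    where
    to : ∀ {u} → Tet a b c (node v ∅ ∅ ∅) u → BallTets f Full u
    to root = ⊤ , (tt , refl) , sym (⟦⟧-↭ perm)
    from : ∀ {u} → BallTets f Full u → Tet a b c (node v ∅ ∅ ∅) u
    from (w , (_ , ∣w∣) , refl) with refl ← ∣p∣≡n⇒p≡⊤ {p = w} ∣w∣ =
      subst (Tet a b c (node v ∅ ∅ ∅)) (sym (⟦⟧-↭ perm)) root
  cases : _ → Unfolding f Full t
  cases (inj₁ eq)               = single (swap p q ↭-refl) eq
  cases (inj₂ (inj₁ eq))        = single (↭-trans (swap p q ↭-refl) (shift r (q ∷ p ∷ []) (s ∷ []))) eq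
  cases (inj₂ (inj₂ (inj₁ eq))) = single (↭-trans (shift s (p ∷ q ∷ r ∷ []) []) (prep s (↭-sym (shift p (q ∷ r ∷ []) [])))) eq
  cases (inj₂ (inj₂ (inj₂ eq))) = single ↭-refl eq

-- The starting triangle is arbitrary, and the induction uses this freedom. From a triangle through
-- the newest vertex, the old ball is unfolded at the glued triangle and put below the cone; from an
-- old triangle, it is unfolded at that triangle and the cone is inserted.
unfold : ∀ {B : Faces m} → StackedBall m B → ∀ {f : Fin m → Fin n} → Inj f →
         ∀ {t} → BoundaryTriangle B t → Unfolding f B t
unfold tetrahedron inj ((_ , ∣t∣) , _) = unfold-tetrahedron inj ∣t∣
unfold (stack sb bt) inj {inside ∷ e} ((e⊆t , ∣e∣) , _) = unfold-cone inj bt (unfold sb (∘suc-inj inj) bt) e⊆t ∣e∣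
unfold (stack {B = B} {t} sb bt@((Bt , ∣t∣) , w , (Bw , t⊆w) , _)) inj {outside ∷ s} ((Bs , ∣s∣) , u , (Gu , s⊆u) , only) =
  unfold-old inj bt (unfold sb (∘suc-inj inj) (owner u Gu s⊆u only)) t≢s
  where
  t≢s : t ≢ s
  -- Otherwise the cone and the old owner `w` would be two owners of a boundary triangle.
  t≢s refl with () ← trans (sym (only {inside ∷ t} (glue-tetrahedron⁺ {B = B} ∣t∣ , out⊆ id)))
                           (only {outside ∷ w} (Bw , s⊆s t⊆w))
  owner : ∀ u → Tetrahedron (glue B t) u → outside ∷ s ⊆ u →
          (∀ {w} → Tetrahedron (glue B t) w × outside ∷ s ⊆ w → u ≡ w) → BoundaryTriangle B s
  owner (outside ∷ u) Bu s⊆u only = (Bs , ∣s∣) , u , (Bu , drop-∷-⊆ s⊆u) ,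
    λ (Bw , s⊆w) → VecP.∷-injectiveʳ (only (Bw , s⊆s s⊆w))
  owner (inside ∷ u) gu s⊆u only with refl ← glue-tetrahedron⁻ {B = B} ∣t∣ gu =
    contradiction (sym (⊆∧∣≡∣⇒≡ (drop-∷-⊆ s⊆u) ∣s∣ ∣t∣)) t≢s

-- Edge flips as bistellar moves

_with-pair_,_ : Faces n → Subset n → Subset n → Faces n
(R with-pair p , q) u = R u ⊎ u ≡ p ⊎ u ≡ q

pair-comm : ∀ {F R : Faces n} {p q} → F ≐ (R with-pair p , q) → F ≐ (R with-pair q , p)
pair-comm (to , from) = map₂ ⊎-swap ∘ to , from ∘ map₂ ⊎-swap

pair-cong : ∀ {F R : Faces n} {p p′ q q′} → p ≡ p′ → q ≡ q′ → F ≐ (R with-pair p , q) → F ≐ (R with-pair p′ , q′)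
pair-cong refl refl e = e

-- Both pairs of tetrahedra fill the cone from `x` over the quadrilateral `a c b d`, one for each
-- diagonal. The last two fields say that neither diagonal is used by any other tetrahedron; this
-- puts the triangles above the quadrilateral on the boundary.
record Bistellar {n : ℕ} (F F′ : Faces n) (a b c d x : Fin n) : Set₁ where
  field
    R        : Faces n
    distinct : Unique (a ∷ b ∷ c ∷ d ∷ x ∷ [])
    before   : F ≐ (R with-pair ⟦ a ∷ b ∷ c ∷ x ∷ [] ⟧ , ⟦ a ∷ b ∷ d ∷ x ∷ [] ⟧)
    after    : F′ ≐ (R with-pair ⟦ a ∷ c ∷ d ∷ x ∷ [] ⟧ , ⟦ b ∷ c ∷ d ∷ x ∷ [] ⟧)
    no-ab    : ∀ {u} → R u → a ∈ u → b ∉ u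
    no-cd    : ∀ {u} → R u → c ∈ u → d ∉ u

module _ {F F′ : Faces n} {a b c d x : Fin n} (B : Bistellar F F′ a b c d x) where
  open Bistellar B

  -- The symmetries `swap-ab`, `swap-cd` and `inverse` reduce what follows to statements about one
  -- tetrahedron of one pair.
  swap-ab : Bistellar F F′ b a c d x
  swap-ab = record { R = R ; distinct = Unique-↭ (swap a b ↭-refl) distinct
    ; before = pair-cong (⟦⟧-↭ {l = a ∷ b ∷ c ∷ x ∷ []} (swap a b ↭-refl)) (⟦⟧-↭ {l = a ∷ b ∷ d ∷ x ∷ []} (swap a b ↭-refl)) before
    ; after = pair-comm after
    ; no-ab = λ Ru b∈ a∈ → no-ab Ru a∈ b∈ ; no-cd = no-cd }

  swap-cd : Bistellar F F′ a b d c x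
  swap-cd = record { R = R ; distinct = Unique-↭ (prep a (prep b (swap c d ↭-refl))) distinct
    ; before = pair-comm before
    ; after = pair-cong (⟦⟧-↭ {l = a ∷ c ∷ d ∷ x ∷ []} (prep a (swap c d ↭-refl))) (⟦⟧-↭ {l = b ∷ c ∷ d ∷ x ∷ []} (prep b (swap c d ↭-refl))) after
    ; no-ab = no-ab ; no-cd = λ Ru d∈ c∈ → no-cd Ru c∈ d∈ }

  inverse : Bistellar F′ F c d a b x
  inverse = record { R = R
    ; distinct = Unique-↭ (↭-trans (shift c (a ∷ b ∷ []) (d ∷ x ∷ [])) (prep c (shift d (a ∷ b ∷ []) (x ∷ [])))) distinct
    ; before = pair-cong (⟦⟧-↭ {l = a ∷ c ∷ d ∷ x ∷ []} (↭-sym (shift a (c ∷ d ∷ []) (x ∷ []))))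
                         (⟦⟧-↭ {l = b ∷ c ∷ d ∷ x ∷ []} (↭-sym (shift b (c ∷ d ∷ []) (x ∷ [])))) after
    ; after = pair-cong (⟦⟧-↭ {l = a ∷ b ∷ c ∷ x ∷ []} (shift c (a ∷ b ∷ []) (x ∷ [])))
                        (⟦⟧-↭ {l = a ∷ b ∷ d ∷ x ∷ []} (shift d (a ∷ b ∷ []) (x ∷ []))) before
    ; no-ab = no-cd ; no-cd = no-ab }

  a∉bcdx : a ∉ ⟦ b ∷ c ∷ d ∷ x ∷ [] ⟧
  a∉bcdx with ≢ ∷ _ ← distinct = ∉⟦⟧ ≢

  c∉abdx : c ∉ ⟦ a ∷ b ∷ d ∷ x ∷ [] ⟧
  c∉abdx with (_ ∷ ac ∷ _) ∷ (bc ∷ _) ∷ c≢ ∷ _ ← distinct = ∉⟦⟧ (≢-sym ac ∷ ≢-sym bc ∷ c≢)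

  unique-abc : Unique (a ∷ b ∷ c ∷ [])
  unique-abc with (ab ∷ ac ∷ _) ∷ (bc ∷ _) ∷ _ ← distinct = (ab ∷ ac ∷ []) ∷ (bc ∷ []) ∷ [] ∷ []

  unique-acx : Unique (a ∷ c ∷ x ∷ [])
  unique-acx with (ab ∷ ac ∷ _ ∷ ax ∷ []) ∷ _ ∷ (_ ∷ cx ∷ []) ∷ _ ← distinct = (ac ∷ ax ∷ []) ∷ (cx ∷ []) ∷ [] ∷ []

  abc-bd : Bd F ⟦ a ∷ b ∷ c ∷ [] ⟧
  abc-bd = owned (∣⟦⟧∣ unique-abc) (proj₂ before (inj₂ (inj₁ refl)))
    (⟦⟧-mono {l = a ∷ b ∷ c ∷ []} {a ∷ b ∷ c ∷ x ∷ []} (here refl ∷ there (here refl) ∷ there (there (here refl)) ∷ [])) only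
    where
    only : ∀ {u} → F u → ⟦ a ∷ b ∷ c ∷ [] ⟧ ⊆ u → u ≡ ⟦ a ∷ b ∷ c ∷ x ∷ [] ⟧
    only Fu t⊆u with proj₁ before Fu
    ... | inj₁ Ru          = contradiction (t⊆u (2nd {l = c ∷ []})) (no-ab Ru (t⊆u (1st {l = b ∷ c ∷ []})))
    ... | inj₂ (inj₁ eq)   = eq
    ... | inj₂ (inj₂ refl) = contradiction (t⊆u (3rd {l = []})) c∉abdx

  ab-vanishes : ∀ {u} → F′ u → a ∈ u → b ∉ u
  ab-vanishes F′u a∈ b∈ with proj₁ after F′u
  ... | inj₁ Ru          = no-ab Ru a∈ b∈
  ... | inj₂ (inj₂ refl) = a∉bcdx a∈
  ab-vanishes F′u a∈ b∈ | inj₂ (inj₁ refl) with (ab ∷ _) ∷ b≢ ∷ _ ← distinct =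
    ∉⟦⟧ (≢-sym ab ∷ b≢) b∈

  -- The facet is `acx`, and `acdx` takes it over. An owner in `R` would have been an owner before
  -- the move, hence equal to `abcx`, which `no-ab` keeps out of `R`.
  facet-without-b : ∀ {t} → ∣ t ∣ ≡ 3 → t ⊆ ⟦ a ∷ b ∷ c ∷ x ∷ [] ⟧ →
    (∀ {w} → F w → t ⊆ w → w ≡ ⟦ a ∷ b ∷ c ∷ x ∷ [] ⟧) → b ∉ t → Bd F′ t
  facet-without-b {t} ∣t∣ t⊆ only b∉t
    with refl ← ⊆∧∣≡∣⇒≡ {q = ⟦ a ∷ c ∷ x ∷ [] ⟧} (insert-drop b∉t (subst (t ⊆_) (⟦⟧-↭ {l = a ∷ b ∷ c ∷ x ∷ []} (swap a b ↭-refl)) t⊆)) ∣t∣ (∣⟦⟧∣ unique-acx) =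
    owned ∣t∣ (proj₂ after (inj₂ (inj₁ refl)))
      (⟦⟧-mono {l = a ∷ c ∷ x ∷ []} {a ∷ c ∷ d ∷ x ∷ []} (here refl ∷ there (here refl) ∷ there (there (there (here refl))) ∷ [])) only′
    where
    only′ : ∀ {w} → F′ w → ⟦ a ∷ c ∷ x ∷ [] ⟧ ⊆ w → w ≡ ⟦ a ∷ c ∷ d ∷ x ∷ [] ⟧
    only′ F′w t⊆w with proj₁ after F′w
    ... | inj₁ Rw          with refl ← only (proj₂ before (inj₁ Rw)) t⊆w =
      contradiction (2nd {l = c ∷ x ∷ []}) (no-ab Rw (1st {l = b ∷ c ∷ x ∷ []}))
    ... | inj₂ (inj₁ eq)   = eq
    ... | inj₂ (inj₂ refl) = contradiction (t⊆w (1st {l = c ∷ x ∷ []})) a∉bcdx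

  -- A triangle of `acdx` without `d` lies in `abcx`, which would then be a second owner. With the
  -- symmetric statement for `c`, a boundary triangle owned by `R` and contained in a new
  -- tetrahedron would contain both `c` and `d`, against `no-cd`.
  unsplit : ∀ {t u} → R u → (∀ {w} → F w → t ⊆ w → w ≡ u) → t ⊆ ⟦ a ∷ c ∷ d ∷ x ∷ [] ⟧ → d ∈ t
  unsplit {t} Ru only t⊆ = decidable-stable (d ∈? t) λ d∉t → avoid (only (proj₂ before (inj₂ (inj₁ refl))) (t⊆abcx d∉t)) Ru
    where
    avoid : ∀ {u} → ⟦ a ∷ b ∷ c ∷ x ∷ [] ⟧ ≡ u → ¬ R u
    avoid refl Ru = no-ab Ru (1st {l = b ∷ c ∷ x ∷ []}) (2nd {l = c ∷ x ∷ []})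
    t⊆abcx : d ∉ t → t ⊆ ⟦ a ∷ b ∷ c ∷ x ∷ [] ⟧
    t⊆abcx d∉t = ⊆-trans (insert-drop d∉t (subst (t ⊆_) (⟦⟧-↭ {l = a ∷ c ∷ d ∷ x ∷ []} (shift d (a ∷ c ∷ []) (x ∷ []))) t⊆))
      (⟦⟧-mono {l = a ∷ c ∷ x ∷ []} {a ∷ b ∷ c ∷ x ∷ []} (here refl ∷ there (there (here refl)) ∷ there (there (there (here refl))) ∷ []))

module _ {F F′ : Faces n} {a b c d x : Fin n} (B : Bistellar F F′ a b c d x) where
  open Bistellar B

  -- Of the four facets, `acx` and `bcx` pass to the new pair, `abc` is excluded, and `abx` is no
  -- boundary triangle because `abdx` contains it too.
  facet-of-abcx : ∀ {t} → ∣ t ∣ ≡ 3 → t ⊆ ⟦ a ∷ b ∷ c ∷ x ∷ [] ⟧ →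
    (∀ {w} → F w → t ⊆ w → w ≡ ⟦ a ∷ b ∷ c ∷ x ∷ [] ⟧) → t ≢ ⟦ a ∷ b ∷ c ∷ [] ⟧ → Bd F′ t
  facet-of-abcx {t} ∣t∣ t⊆ only t≢ with b ∈? t | a ∈? t | c ∈? t
  ... | no b∉t  | _       | _ = facet-without-b B ∣t∣ t⊆ only b∉t
  ... | yes _   | no a∉t  | _ = facet-without-b (swap-ab B) ∣t∣ (subst (t ⊆_) eq t⊆) (λ Fw t⊆w → trans (only Fw t⊆w) eq) a∉t
    where
    eq : ⟦ a ∷ b ∷ c ∷ x ∷ [] ⟧ ≡ ⟦ b ∷ a ∷ c ∷ x ∷ [] ⟧
    eq = ⟦⟧-↭ {l = a ∷ b ∷ c ∷ x ∷ []} (swap a b ↭-refl)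
  ... | yes b∈t | yes a∈t | yes c∈t = contradiction
    (sym (⊆∧∣≡∣⇒≡ (⟦⟧-⊆ {l = a ∷ b ∷ c ∷ []} (a∈t ∷ b∈t ∷ c∈t ∷ [])) (∣⟦⟧∣ (unique-abc B)) ∣t∣)) t≢
  ... | yes b∈t | yes a∈t | no c∉t = contradiction
    (subst (c ∈_) (sym (only (proj₂ before (inj₂ (inj₂ refl))) t⊆abdx)) (3rd {l = x ∷ []})) (c∉abdx B)
    where
    t⊆abdx : t ⊆ ⟦ a ∷ b ∷ d ∷ x ∷ [] ⟧
    t⊆abdx = ⊆-trans (insert-drop c∉t (subst (t ⊆_) (⟦⟧-↭ {l = a ∷ b ∷ c ∷ x ∷ []} (shift c (a ∷ b ∷ []) (x ∷ []))) t⊆))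
      (⟦⟧-mono {l = a ∷ b ∷ x ∷ []} {a ∷ b ∷ d ∷ x ∷ []} (here refl ∷ there (here refl) ∷ there (there (there (here refl))) ∷ []))

module _ {F F′ : Faces n} {a b c d x : Fin n} (B : Bistellar F F′ a b c d x) where
  open Bistellar B

  -- Applied to the inverse move as well, it shows that only `acd` and `bcd` can be new, so it
  -- settles both inclusions of `result` for the triangles away from the quadrilateral.
  bd-survives : ∀ {t} → Bd F t → t ≢ ⟦ a ∷ b ∷ c ∷ [] ⟧ → t ≢ ⟦ a ∷ b ∷ d ∷ [] ⟧ → Bd F′ t
  bd-survives {t} (∣t∣ , u , (Fu , t⊆u) , only) t≢abc t≢abd with proj₁ before Fu
  ... | inj₂ (inj₁ refl) = facet-of-abcx B ∣t∣ t⊆u (λ Fw t⊆w → sym (only (Fw , t⊆w))) t≢abc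
  ... | inj₂ (inj₂ refl) = facet-of-abcx (swap-cd B) ∣t∣ t⊆u (λ Fw t⊆w → sym (only (Fw , t⊆w))) t≢abd
  ... | inj₁ Ru = owned ∣t∣ (proj₂ after (inj₁ Ru)) t⊆u only′
    where
    only″ : ∀ {w} → F w → t ⊆ w → w ≡ u
    only″ Fw t⊆w = sym (only (Fw , t⊆w))
    only′ : ∀ {w} → F′ w → t ⊆ w → w ≡ u
    only′ F′w t⊆w with proj₁ after F′w
    ... | inj₁ Rw          = only″ (proj₂ before (inj₁ Rw)) t⊆w
    ... | inj₂ (inj₁ refl) = contradiction (t⊆u (unsplit B Ru only″ t⊆w))
      (no-cd Ru (t⊆u (unsplit (swap-cd B) Ru only″
        (subst (t ⊆_) (⟦⟧-↭ {l = a ∷ c ∷ d ∷ x ∷ []} (prep a (swap c d ↭-refl))) t⊆w))))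
    ... | inj₂ (inj₂ refl) = contradiction (t⊆u (unsplit (swap-ab B) Ru only″ t⊆w))
      (no-cd Ru (t⊆u (unsplit (swap-ab (swap-cd B)) Ru only″
        (subst (t ⊆_) (⟦⟧-↭ {l = b ∷ c ∷ d ∷ x ∷ []} (prep b (swap c d ↭-refl))) t⊆w))))

tri≡ : (a b c : Fin n) → tri a b c ≡ ⟦ a ∷ b ∷ c ∷ [] ⟧
tri≡ a b c = cong (λ s → ⁅ a ⁆ ∪ ⁅ b ⁆ ∪ s) (sym (∪-identityʳ ⁅ c ⁆))

Bistellar⇒FlipAt : ∀ {F F′ : Faces n} {a b c d x} →
  (∀ {u} → F u → ∣ u ∣ ≡ 4) → (∀ {u} → F′ u → ∣ u ∣ ≡ 4) →
  Bistellar F F′ a b c d x → FlipAt (∂ ⟨ F ⟩) (∂ ⟨ F′ ⟩) a b c d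
Bistellar⇒FlipAt {F = F} {F′} {a} {b} {c} {d} {x} 4F 4F′ B = record
  { abc = triangle⁺ (tri≡ a b c) (abc-bd B)
  ; abd = triangle⁺ (tri≡ a b d) (abc-bd (swap-cd B))
  ; c≢d = λ { refl → c∉abdx B (3rd {l = x ∷ []}) }
  ; no-cd = no-edge-cd
  ; result = to , from
  }
  where
  open Bistellar B
  triangle⁺ : ∀ {s t} → s ≡ t → Bd F t → Triangle (∂ ⟨ F ⟩) s
  triangle⁺ refl bt = (_ , boundaryTriangle⁺ 4F bt , id) , proj₁ bt
  triangle⁻ : ∀ {t} → Triangle (∂ ⟨ F ⟩) t → Bd F t
  triangle⁻ ((t′ , bt , t⊆t′) , ∣t∣) with bt′ ← boundaryTriangle⁻ 4F bt =
    subst (Bd F) (sym (⊆∧∣≡∣⇒≡ t⊆t′ ∣t∣ (proj₁ bt′))) bt′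
  no-edge-cd : ¬ Edge (∂ ⟨ F ⟩) c d
  no-edge-cd (_ , t , bt , cd⊆t) with _ , u , (Fu , t⊆u) , _ ← boundaryTriangle⁻ 4F bt =
    ab-vanishes (inverse B) Fu (t⊆u (cd⊆t (p⊆p∪q ⁅ d ⁆ (x∈⁅x⁆ c)))) (t⊆u (cd⊆t (q⊆p∪q ⁅ c ⁆ ⁅ d ⁆ (x∈⁅x⁆ d))))
  NewTriangle : Faces _
  NewTriangle t = (Triangle (∂ ⟨ F ⟩) t × t ≢ tri a b c × t ≢ tri a b d) ⊎ t ≡ tri a c d ⊎ t ≡ tri b c d
  ≢tri : ∀ {t e} → Bd F′ t → t ≢ tri a b e
  ≢tri {e = e} (_ , u , (F′u , t⊆u) , _) refl =
    ab-vanishes B F′u (t⊆u (∈-insert a {⁅ b ⁆ ∪ ⁅ e ⁆})) (t⊆u (⊆-insert a (⁅ b ⁆ ∪ ⁅ e ⁆) (∈-insert b {⁅ e ⁆})))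
  acd≡ : tri a c d ≡ ⟦ c ∷ d ∷ a ∷ [] ⟧
  acd≡ = trans (tri≡ a c d) (⟦⟧-↭ {l = a ∷ c ∷ d ∷ []} (↭-sym (shift a (c ∷ d ∷ []) [])))
  bcd≡ : tri b c d ≡ ⟦ c ∷ d ∷ b ∷ [] ⟧
  bcd≡ = trans (tri≡ b c d) (⟦⟧-↭ {l = b ∷ c ∷ d ∷ []} (↭-sym (shift b (c ∷ d ∷ []) [])))
  new⁺ : ∀ {t} → Bd F′ t → NewTriangle t
  new⁺ {t} bt with t ≟ₛ tri a c d | t ≟ₛ tri b c d
  ... | yes eq | _      = inj₂ (inj₁ eq)
  ... | no _   | yes eq = inj₂ (inj₂ eq)
  ... | no t≢  | no t≢′ = inj₁
    (triangle⁺ refl (bd-survives (inverse B) bt (t≢ ∘ λ eq → trans eq (sym acd≡)) (t≢′ ∘ λ eq → trans eq (sym bcd≡))) ,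
     ≢tri bt , ≢tri bt)
  new⁻ : ∀ {t} → NewTriangle t → Bd F′ t
  new⁻ (inj₁ (Ft , t≢abc , t≢abd)) = bd-survives B (triangle⁻ Ft)
    (t≢abc ∘ λ eq → trans eq (sym (tri≡ a b c))) (t≢abd ∘ λ eq → trans eq (sym (tri≡ a b d)))
  new⁻ (inj₂ (inj₁ refl)) = subst (Bd F′) (sym acd≡) (abc-bd (inverse B))
  new⁻ (inj₂ (inj₂ refl)) = subst (Bd F′) (sym bcd≡) (abc-bd (swap-cd (inverse B)))
  to : ∀ {s} → ∂ ⟨ F′ ⟩ s → ⟨ NewTriangle ⟩ s
  to (t , bt , s⊆t) = t , new⁺ (boundaryTriangle⁻ 4F′ bt) , s⊆t
  from : ∀ {s} → ⟨ NewTriangle ⟩ s → ∂ ⟨ F′ ⟩ s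
  from (t , nt , s⊆t) = t , boundaryTriangle⁺ 4F′ (new⁻ nt) , s⊆t

-- Tree rotations

infix 4 _⟶_
-- One rotation for each pair of positions that the two nodes may use while the third stays empty.
-- The opposite rotations are the inverses of these, which is why `_~_` is an equivalence closure.
data _⟶_ {n : ℕ} : Tree n → Tree n → Set where
  rotate₁₃ : ∀ {v w X Y Z} → node v X ∅ (node w Y ∅ Z) ⟶ node w (node v X ∅ Y) ∅ Z
  rotate₂₃ : ∀ {v w X Y Z} → node v ∅ X (node w ∅ Y Z) ⟶ node w ∅ (node v ∅ X Y) Z
  rotate₁₂ : ∀ {v w X Y Z} → node v X (node w Y Z ∅) ∅ ⟶ node w (node v X Y ∅) Z ∅
  child₁   : ∀ {v X X′ Y Z} → X ⟶ X′ → node v X Y Z ⟶ node v X′ Y Z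
  child₂   : ∀ {v X Y Y′ Z} → Y ⟶ Y′ → node v X Y Z ⟶ node v X Y′ Z
  child₃   : ∀ {v X Y Z Z′} → Z ⟶ Z′ → node v X Y Z ⟶ node v X Y Z′

rotate-↭ : ∀ {A : Set} (v w : A) xs ys zs → v ∷ xs ++ w ∷ ys ++ zs ↭ w ∷ v ∷ (xs ++ ys) ++ zs
rotate-↭ v w xs ys zs rewrite ListP.++-assoc xs ys zs = shift w (v ∷ xs) (ys ++ zs)

⟶-labels : ∀ {T T′ : Tree n} → T ⟶ T′ → labels T ↭ labels T′
⟶-labels (rotate₁₃ {v} {w} {X} {Y} {Z}) = rotate-↭ v w (labels X) (labels Y) (labels Z)
⟶-labels (rotate₂₃ {v} {w} {X} {Y} {Z}) = rotate-↭ v w (labels X) (labels Y) (labels Z)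
⟶-labels (rotate₁₂ {v} {w} {X} {Y} {Z})
  rewrite ListP.++-identityʳ (labels Z) | ListP.++-identityʳ (labels Y)
        | ListP.++-identityʳ (labels Y ++ labels Z) =
  rotate-↭ v w (labels X) (labels Y) (labels Z)
⟶-labels (child₁ {v} {Y = Y} {Z} s) = prep v (++⁺ʳ (labels Y ++ labels Z) (⟶-labels s))
⟶-labels (child₂ {v} {X} {Z = Z} s) = prep v (++⁺ˡ (labels X) (++⁺ʳ (labels Z) (⟶-labels s)))
⟶-labels (child₃ {v} {X} {Y} s)     = prep v (++⁺ˡ (labels X) (++⁺ˡ (labels Y) (⟶-labels s)))

module _ {a b c v : Fin n} {X Y Z : Tree n} where

  remove₁ : ∀ {u} → Tet a b c (node v X Y Z) u → Tet v b c X u ⊎ Tet a b c (node v ∅ Y Z) u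
  remove₁ root    = inj₂ root
  remove₁ (in₁ p) = inj₁ p
  remove₁ (in₂ p) = inj₂ (in₂ p)
  remove₁ (in₃ p) = inj₂ (in₃ p)

  remove₂ : ∀ {u} → Tet a b c (node v X Y Z) u → Tet a v c Y u ⊎ Tet a b c (node v X ∅ Z) u
  remove₂ root    = inj₂ root
  remove₂ (in₁ p) = inj₂ (in₁ p)
  remove₂ (in₂ p) = inj₁ p
  remove₂ (in₃ p) = inj₂ (in₃ p)

  remove₃ : ∀ {u} → Tet a b c (node v X Y Z) u → Tet a b v Z u ⊎ Tet a b c (node v X Y ∅) u
  remove₃ root    = inj₂ root
  remove₃ (in₁ p) = inj₂ (in₁ p)
  remove₃ (in₂ p) = inj₂ (in₂ p)
  remove₃ (in₃ p) = inj₁ p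

  restore₁ : ∀ {u} → Tet a b c (node v ∅ Y Z) u → Tet a b c (node v X Y Z) u
  restore₁ root    = root
  restore₁ (in₂ p) = in₂ p
  restore₁ (in₃ p) = in₃ p

  restore₂ : ∀ {u} → Tet a b c (node v X ∅ Z) u → Tet a b c (node v X Y Z) u
  restore₂ root    = root
  restore₂ (in₁ p) = in₁ p
  restore₂ (in₃ p) = in₃ p

  restore₃ : ∀ {u} → Tet a b c (node v X Y ∅) u → Tet a b c (node v X Y Z) u
  restore₃ root    = root
  restore₃ (in₁ p) = in₁ p
  restore₃ (in₂ p) = in₂ p

  module _ (ng : NodeGood a b c v X Y Z) where
    open NodeGood ng

    rest-avoids₁ : ∀ {z u} → z L.∈ labels X → Tet a b c (node v ∅ Y Z) u → z ∉ u
    rest-avoids₁ z∈ p = tet-avoids p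
      (≢-sym (All.lookup aX z∈) ∷ ≢-sym (All.lookup bX z∈) ∷ ≢-sym (All.lookup cX z∈) ∷
       ≢-sym (All.lookup vX z∈) ∷ AllP.++⁺ (XY z∈) (XZ z∈))

    rest-avoids₂ : ∀ {z u} → z L.∈ labels Y → Tet a b c (node v X ∅ Z) u → z ∉ u
    rest-avoids₂ z∈ p = tet-avoids p
      (≢-sym (All.lookup aY z∈) ∷ ≢-sym (All.lookup bY z∈) ∷ ≢-sym (All.lookup cY z∈) ∷
       ≢-sym (All.lookup vY z∈) ∷ AllP.++⁺ (All.tabulate λ x∈ → ≢-sym (All.lookup (XY x∈) z∈)) (YZ z∈))

    rest-avoids₃ : ∀ {z u} → z L.∈ labels Z → Tet a b c (node v X Y ∅) u → z ∉ u
    rest-avoids₃ z∈ p = tet-avoids p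
      (≢-sym (All.lookup aZ z∈) ∷ ≢-sym (All.lookup bZ z∈) ∷ ≢-sym (All.lookup cZ z∈) ∷
       ≢-sym (All.lookup vZ z∈) ∷ AllP.++⁺ (All.tabulate λ x∈ → ≢-sym (All.lookup (XZ x∈) z∈))
         (AllP.++⁺ (All.tabulate λ y∈ → ≢-sym (All.lookup (YZ y∈) z∈)) []))

-- To keep both diagonals out of the added tetrahedra it is enough that these avoid one end of each.
extend-bistellar : ∀ {F F′ G G′ E : Faces n} {a b c d x} → Bistellar F F′ a b c d x →
  G ≐ (F ∪ᵗ E) → G′ ≐ (F′ ∪ᵗ E) → (∀ {u} → E u → b ∉ u) → (∀ {u} → E u → d ∉ u) →
  Bistellar G G′ a b c d x
extend-bistellar {E = E} B (G→ , →G) (G′→ , →G′) b∉E d∉E = record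
  { R = R ∪ᵗ E
  ; distinct = distinct
  ; before = (λ Gu → [ (λ Fu → [ inj₁ ∘ inj₁ , inj₂ ]′ (proj₁ before Fu)) , inj₁ ∘ inj₂ ]′ (G→ Gu)) ,
             [ [ →G ∘ inj₁ ∘ proj₂ before ∘ inj₁ , →G ∘ inj₂ ]′ , →G ∘ inj₁ ∘ proj₂ before ∘ inj₂ ]′
  ; after  = (λ Gu → [ (λ Fu → [ inj₁ ∘ inj₁ , inj₂ ]′ (proj₁ after Fu)) , inj₁ ∘ inj₂ ]′ (G′→ Gu)) ,
             [ [ →G′ ∘ inj₁ ∘ proj₂ after ∘ inj₁ , →G′ ∘ inj₂ ]′ , →G′ ∘ inj₁ ∘ proj₂ after ∘ inj₂ ]′
  ; no-ab = λ { (inj₁ Ru) → no-ab Ru ; (inj₂ Eu) _ → b∉E Eu }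
  ; no-cd = λ { (inj₁ Ru) → no-cd Ru ; (inj₂ Eu) _ → d∉E Eu }
  }
  where open Bistellar B

-- The missing second children leave `avc` and `awv` on the boundary. Both lie opposite `b`, the
-- cone point, and they share the edge `av`, which is flipped to `cw`. In `bistellar₂₃` the cone
-- point is `a` and the flip `bv` to `cw`; in `bistellar₁₂` they are `c` and `av` to `bw`.
bistellar₁₃ : ∀ {a b c v w : Fin n} {X Y Z} → Good a b c (node v X ∅ (node w Y ∅ Z)) →
  Bistellar (Tet a b c (node v X ∅ (node w Y ∅ Z))) (Tet a b c (node w (node v X ∅ Y) ∅ Z)) a v c w b
bistellar₁₃ {n} {a} {b} {c} {v} {w} {X} {Y} {Z} good = record
  { R = (Tet v b c X ∪ᵗ Tet w b v Y) ∪ᵗ Tet a b w Z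
  ; distinct = (a≢v ∷ a≢c ∷ I.a≢v ∷ a≢b ∷ []) ∷ (≢-sym c≢v ∷ I.c≢v ∷ ≢-sym b≢v ∷ []) ∷
               (All.head cZ ∷ ≢-sym b≢c ∷ []) ∷ (≢-sym I.b≢v ∷ []) ∷ [] ∷ []
  ; before = to , from ; after = to′ , from′ ; no-ab = no-ab ; no-cd = no-cd }
  where
  open NodeGood (nodeGood {X = X} {∅} {node w Y ∅ Z} good)
  module I = NodeGood (nodeGood {X = Y} {∅} {Z} good₃)
  R : Faces n
  R = (Tet v b c X ∪ᵗ Tet w b v Y) ∪ᵗ Tet a b w Z
  p : ⟦ v ∷ a ∷ b ∷ c ∷ [] ⟧ ≡ ⟦ a ∷ v ∷ c ∷ b ∷ [] ⟧
  p = ⟦⟧-↭ {l = v ∷ a ∷ b ∷ c ∷ []} (swap v a (swap b c ↭-refl))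
  q : ⟦ w ∷ a ∷ b ∷ v ∷ [] ⟧ ≡ ⟦ a ∷ v ∷ w ∷ b ∷ [] ⟧
  q = ⟦⟧-↭ {l = w ∷ a ∷ b ∷ v ∷ []} (↭-trans (shift v (w ∷ a ∷ b ∷ []) []) (↭-trans (prep v (swap w a ↭-refl)) (swap v a ↭-refl)))
  p′ : ⟦ w ∷ a ∷ b ∷ c ∷ [] ⟧ ≡ ⟦ a ∷ c ∷ w ∷ b ∷ [] ⟧
  p′ = ⟦⟧-↭ {l = w ∷ a ∷ b ∷ c ∷ []} (↭-trans (swap w a ↭-refl) (prep a (shift c (w ∷ b ∷ []) [])))
  q′ : ⟦ v ∷ w ∷ b ∷ c ∷ [] ⟧ ≡ ⟦ v ∷ c ∷ w ∷ b ∷ [] ⟧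
  q′ = ⟦⟧-↭ {l = v ∷ w ∷ b ∷ c ∷ []} (prep v (shift c (w ∷ b ∷ []) []))
  T T′ : Tree n
  T = node v X ∅ (node w Y ∅ Z)
  T′ = node w (node v X ∅ Y) ∅ Z
  to : ∀ {u} → Tet a b c T u → (R with-pair ⟦ a ∷ v ∷ c ∷ b ∷ [] ⟧ , ⟦ a ∷ v ∷ w ∷ b ∷ [] ⟧) u
  to root          = inj₂ (inj₁ p)
  to (in₁ t)       = inj₁ (inj₁ (inj₁ t))
  to (in₃ root)    = inj₂ (inj₂ q)
  to (in₃ (in₁ t)) = inj₁ (inj₁ (inj₂ t))
  to (in₃ (in₃ t)) = inj₁ (inj₂ t)
  from : ∀ {u} → (R with-pair ⟦ a ∷ v ∷ c ∷ b ∷ [] ⟧ , ⟦ a ∷ v ∷ w ∷ b ∷ [] ⟧) u → Tet a b c T u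
  from (inj₁ (inj₁ (inj₁ t))) = in₁ t
  from (inj₁ (inj₁ (inj₂ t))) = in₃ (in₁ t)
  from (inj₁ (inj₂ t))        = in₃ (in₃ t)
  from (inj₂ (inj₁ refl))     = subst (Tet a b c T) p root
  from (inj₂ (inj₂ refl))     = subst (Tet a b c T) q (in₃ root)
  to′ : ∀ {u} → Tet a b c T′ u → (R with-pair ⟦ a ∷ c ∷ w ∷ b ∷ [] ⟧ , ⟦ v ∷ c ∷ w ∷ b ∷ [] ⟧) u
  to′ root          = inj₂ (inj₁ p′)
  to′ (in₁ root)    = inj₂ (inj₂ q′)
  to′ (in₁ (in₁ t)) = inj₁ (inj₁ (inj₁ t))
  to′ (in₁ (in₃ t)) = inj₁ (inj₁ (inj₂ t))
  to′ (in₃ t)       = inj₁ (inj₂ t)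
  from′ : ∀ {u} → (R with-pair ⟦ a ∷ c ∷ w ∷ b ∷ [] ⟧ , ⟦ v ∷ c ∷ w ∷ b ∷ [] ⟧) u → Tet a b c T′ u
  from′ (inj₁ (inj₁ (inj₁ t))) = in₁ (in₁ t)
  from′ (inj₁ (inj₁ (inj₂ t))) = in₁ (in₃ t)
  from′ (inj₁ (inj₂ t))        = in₃ t
  from′ (inj₂ (inj₁ refl))     = subst (Tet a b c T′) p′ root
  from′ (inj₂ (inj₂ refl))     = subst (Tet a b c T′) q′ (in₁ root)
  cY′ : All (c ≢_) (labels Y)
  cY′ = AllP.++⁻ˡ (labels Y) (All.tail cZ)
  cZ′ : All (c ≢_) (labels Z)
  cZ′ = AllP.++⁻ʳ (labels Y) (All.tail cZ)
  no-ab : ∀ {u} → R u → a ∈ u → v ∉ u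
  no-ab (inj₁ (inj₁ t)) a∈ _ = tet-avoids t (a≢v ∷ a≢b ∷ a≢c ∷ aX) a∈
  no-ab (inj₁ (inj₂ t)) a∈ _ = tet-avoids t (I.a≢v ∷ a≢b ∷ a≢v ∷ I.aX) a∈
  no-ab (inj₂ t) _           = tet-avoids t (≢-sym a≢v ∷ ≢-sym b≢v ∷ I.c≢v ∷ I.cZ)
  no-cd : ∀ {u} → R u → c ∈ u → w ∉ u
  no-cd (inj₁ (inj₁ t)) _    = tet-avoids t (≢-sym I.c≢v ∷ ≢-sym I.b≢v ∷ ≢-sym (All.head cZ) ∷
                                 All.tabulate (λ x∈ → ≢-sym (All.head (XZ x∈))))
  no-cd (inj₁ (inj₂ t)) c∈ _ = tet-avoids t (All.head cZ ∷ ≢-sym b≢c ∷ c≢v ∷ cY′) c∈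
  no-cd (inj₂ t) c∈ _        = tet-avoids t (≢-sym a≢c ∷ ≢-sym b≢c ∷ All.head cZ ∷ cZ′) c∈

bistellar₂₃ : ∀ {a b c v w : Fin n} {X Y Z} → Good a b c (node v ∅ X (node w ∅ Y Z)) →
  Bistellar (Tet a b c (node v ∅ X (node w ∅ Y Z))) (Tet a b c (node w ∅ (node v ∅ X Y) Z)) b v c w a
bistellar₂₃ {n} {a} {b} {c} {v} {w} {X} {Y} {Z} good = record
  { R = R
  ; distinct = (b≢v ∷ b≢c ∷ I.b≢v ∷ ≢-sym a≢b ∷ []) ∷ (≢-sym c≢v ∷ I.c≢v ∷ ≢-sym a≢v ∷ []) ∷
               (All.head cZ ∷ ≢-sym a≢c ∷ []) ∷ (≢-sym I.a≢v ∷ []) ∷ [] ∷ []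
  ; before = to , from ; after = to′ , from′ ; no-ab = no-bv ; no-cd = no-cw }
  where
  open NodeGood (nodeGood {X = ∅} {X} {node w ∅ Y Z} good)
  module I = NodeGood (nodeGood {X = ∅} {Y} {Z} good₃)
  R : Faces n
  R = (Tet a v c X ∪ᵗ Tet a w v Y) ∪ᵗ Tet a b w Z
  p : ⟦ v ∷ a ∷ b ∷ c ∷ [] ⟧ ≡ ⟦ b ∷ v ∷ c ∷ a ∷ [] ⟧
  p = ⟦⟧-↭ {l = v ∷ a ∷ b ∷ c ∷ []} (↭-trans (shift b (v ∷ a ∷ []) (c ∷ [])) (prep b (prep v (swap a c ↭-refl))))
  q : ⟦ w ∷ a ∷ b ∷ v ∷ [] ⟧ ≡ ⟦ b ∷ v ∷ w ∷ a ∷ [] ⟧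
  q = ⟦⟧-↭ {l = w ∷ a ∷ b ∷ v ∷ []} (↭-trans (shift b (w ∷ a ∷ []) (v ∷ [])) (prep b (shift v (w ∷ a ∷ []) [])))
  p′ : ⟦ w ∷ a ∷ b ∷ c ∷ [] ⟧ ≡ ⟦ b ∷ c ∷ w ∷ a ∷ [] ⟧
  p′ = ⟦⟧-↭ {l = w ∷ a ∷ b ∷ c ∷ []} (↭-trans (shift b (w ∷ a ∷ []) (c ∷ [])) (prep b (shift c (w ∷ a ∷ []) [])))
  q′ : ⟦ v ∷ a ∷ w ∷ c ∷ [] ⟧ ≡ ⟦ v ∷ c ∷ w ∷ a ∷ [] ⟧
  q′ = ⟦⟧-↭ {l = v ∷ a ∷ w ∷ c ∷ []} (prep v (↭-trans (shift c (a ∷ w ∷ []) []) (prep c (swap a w ↭-refl))))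
  T T′ : Tree n
  T = node v ∅ X (node w ∅ Y Z)
  T′ = node w ∅ (node v ∅ X Y) Z
  to : ∀ {u} → Tet a b c T u → (R with-pair ⟦ b ∷ v ∷ c ∷ a ∷ [] ⟧ , ⟦ b ∷ v ∷ w ∷ a ∷ [] ⟧) u
  to root          = inj₂ (inj₁ p)
  to (in₂ t)       = inj₁ (inj₁ (inj₁ t))
  to (in₃ root)    = inj₂ (inj₂ q)
  to (in₃ (in₂ t)) = inj₁ (inj₁ (inj₂ t))
  to (in₃ (in₃ t)) = inj₁ (inj₂ t)
  from : ∀ {u} → (R with-pair ⟦ b ∷ v ∷ c ∷ a ∷ [] ⟧ , ⟦ b ∷ v ∷ w ∷ a ∷ [] ⟧) u → Tet a b c T u
  from (inj₁ (inj₁ (inj₁ t))) = in₂ t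
  from (inj₁ (inj₁ (inj₂ t))) = in₃ (in₂ t)
  from (inj₁ (inj₂ t))        = in₃ (in₃ t)
  from (inj₂ (inj₁ refl))     = subst (Tet a b c T) p root
  from (inj₂ (inj₂ refl))     = subst (Tet a b c T) q (in₃ root)
  to′ : ∀ {u} → Tet a b c T′ u → (R with-pair ⟦ b ∷ c ∷ w ∷ a ∷ [] ⟧ , ⟦ v ∷ c ∷ w ∷ a ∷ [] ⟧) u
  to′ root          = inj₂ (inj₁ p′)
  to′ (in₂ root)    = inj₂ (inj₂ q′)
  to′ (in₂ (in₂ t)) = inj₁ (inj₁ (inj₁ t))
  to′ (in₂ (in₃ t)) = inj₁ (inj₁ (inj₂ t))
  to′ (in₃ t)       = inj₁ (inj₂ t)
  from′ : ∀ {u} → (R with-pair ⟦ b ∷ c ∷ w ∷ a ∷ [] ⟧ , ⟦ v ∷ c ∷ w ∷ a ∷ [] ⟧) u → Tet a b c T′ u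
  from′ (inj₁ (inj₁ (inj₁ t))) = in₂ (in₂ t)
  from′ (inj₁ (inj₁ (inj₂ t))) = in₂ (in₃ t)
  from′ (inj₁ (inj₂ t))        = in₃ t
  from′ (inj₂ (inj₁ refl))     = subst (Tet a b c T′) p′ root
  from′ (inj₂ (inj₂ refl))     = subst (Tet a b c T′) q′ (in₂ root)
  cY′ : All (c ≢_) (labels Y)
  cY′ = AllP.++⁻ˡ (labels Y) (All.tail cZ)
  cZ′ : All (c ≢_) (labels Z)
  cZ′ = AllP.++⁻ʳ (labels Y) (All.tail cZ)
  no-bv : ∀ {u} → R u → b ∈ u → v ∉ u
  no-bv (inj₁ (inj₁ t)) b∈ _ = tet-avoids t (≢-sym a≢b ∷ b≢v ∷ b≢c ∷ bY) b∈
  no-bv (inj₁ (inj₂ t)) b∈ _ = tet-avoids t (≢-sym a≢b ∷ I.b≢v ∷ b≢v ∷ I.bY) b∈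
  no-bv (inj₂ t) _           = tet-avoids t (≢-sym a≢v ∷ ≢-sym b≢v ∷ I.c≢v ∷ I.cZ)
  no-cw : ∀ {u} → R u → c ∈ u → w ∉ u
  no-cw (inj₁ (inj₁ t)) _    = tet-avoids t (≢-sym I.a≢v ∷ ≢-sym I.c≢v ∷ ≢-sym (All.head cZ) ∷
                                 All.tabulate (λ x∈ → ≢-sym (All.head (YZ x∈))))
  no-cw (inj₁ (inj₂ t)) c∈ _ = tet-avoids t (≢-sym a≢c ∷ All.head cZ ∷ c≢v ∷ cY′) c∈
  no-cw (inj₂ t) c∈ _        = tet-avoids t (≢-sym a≢c ∷ ≢-sym b≢c ∷ All.head cZ ∷ cZ′) c∈

bistellar₁₂ : ∀ {a b c v w : Fin n} {X Y Z} → Good a b c (node v X (node w Y Z ∅) ∅) →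
  Bistellar (Tet a b c (node v X (node w Y Z ∅) ∅)) (Tet a b c (node w (node v X Y ∅) Z ∅)) a v b w c
bistellar₁₂ {n} {a} {b} {c} {v} {w} {X} {Y} {Z} good = record
  { R = R
  ; distinct = (a≢v ∷ a≢b ∷ I.a≢v ∷ a≢c ∷ []) ∷ (≢-sym b≢v ∷ I.b≢v ∷ ≢-sym c≢v ∷ []) ∷
               (All.head bY ∷ b≢c ∷ []) ∷ (≢-sym I.c≢v ∷ []) ∷ [] ∷ []
  ; before = to , from ; after = to′ , from′ ; no-ab = no-av ; no-cd = no-bw }
  where
  open NodeGood (nodeGood {X = X} {node w Y Z ∅} {∅} good)
  module I = NodeGood (nodeGood {X = Y} {Z} {∅} good₂)
  R : Faces n
  R = (Tet v b c X ∪ᵗ Tet w v c Y) ∪ᵗ Tet a w c Z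
  p : ⟦ v ∷ a ∷ b ∷ c ∷ [] ⟧ ≡ ⟦ a ∷ v ∷ b ∷ c ∷ [] ⟧
  p = ⟦⟧-↭ {l = v ∷ a ∷ b ∷ c ∷ []} (swap v a ↭-refl)
  q : ⟦ w ∷ a ∷ v ∷ c ∷ [] ⟧ ≡ ⟦ a ∷ v ∷ w ∷ c ∷ [] ⟧
  q = ⟦⟧-↭ {l = w ∷ a ∷ v ∷ c ∷ []} (↭-trans (swap w a ↭-refl) (prep a (swap w v ↭-refl)))
  p′ : ⟦ w ∷ a ∷ b ∷ c ∷ [] ⟧ ≡ ⟦ a ∷ b ∷ w ∷ c ∷ [] ⟧
  p′ = ⟦⟧-↭ {l = w ∷ a ∷ b ∷ c ∷ []} (↭-sym (shift w (a ∷ b ∷ []) (c ∷ [])))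
  q′ : ⟦ v ∷ w ∷ b ∷ c ∷ [] ⟧ ≡ ⟦ v ∷ b ∷ w ∷ c ∷ [] ⟧
  q′ = ⟦⟧-↭ {l = v ∷ w ∷ b ∷ c ∷ []} (prep v (swap w b ↭-refl))
  T T′ : Tree n
  T = node v X (node w Y Z ∅) ∅
  T′ = node w (node v X Y ∅) Z ∅
  to : ∀ {u} → Tet a b c T u → (R with-pair ⟦ a ∷ v ∷ b ∷ c ∷ [] ⟧ , ⟦ a ∷ v ∷ w ∷ c ∷ [] ⟧) u
  to root          = inj₂ (inj₁ p)
  to (in₁ t)       = inj₁ (inj₁ (inj₁ t))
  to (in₂ root)    = inj₂ (inj₂ q)
  to (in₂ (in₁ t)) = inj₁ (inj₁ (inj₂ t))
  to (in₂ (in₂ t)) = inj₁ (inj₂ t)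
  from : ∀ {u} → (R with-pair ⟦ a ∷ v ∷ b ∷ c ∷ [] ⟧ , ⟦ a ∷ v ∷ w ∷ c ∷ [] ⟧) u → Tet a b c T u
  from (inj₁ (inj₁ (inj₁ t))) = in₁ t
  from (inj₁ (inj₁ (inj₂ t))) = in₂ (in₁ t)
  from (inj₁ (inj₂ t))        = in₂ (in₂ t)
  from (inj₂ (inj₁ refl))     = subst (Tet a b c T) p root
  from (inj₂ (inj₂ refl))     = subst (Tet a b c T) q (in₂ root)
  to′ : ∀ {u} → Tet a b c T′ u → (R with-pair ⟦ a ∷ b ∷ w ∷ c ∷ [] ⟧ , ⟦ v ∷ b ∷ w ∷ c ∷ [] ⟧) u
  to′ root          = inj₂ (inj₁ p′)
  to′ (in₁ root)    = inj₂ (inj₂ q′)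
  to′ (in₁ (in₁ t)) = inj₁ (inj₁ (inj₁ t))
  to′ (in₁ (in₂ t)) = inj₁ (inj₁ (inj₂ t))
  to′ (in₂ t)       = inj₁ (inj₂ t)
  from′ : ∀ {u} → (R with-pair ⟦ a ∷ b ∷ w ∷ c ∷ [] ⟧ , ⟦ v ∷ b ∷ w ∷ c ∷ [] ⟧) u → Tet a b c T′ u
  from′ (inj₁ (inj₁ (inj₁ t))) = in₁ (in₁ t)
  from′ (inj₁ (inj₁ (inj₂ t))) = in₁ (in₂ t)
  from′ (inj₁ (inj₂ t))        = in₂ t
  from′ (inj₂ (inj₁ refl))     = subst (Tet a b c T′) p′ root
  from′ (inj₂ (inj₂ refl))     = subst (Tet a b c T′) q′ (in₁ root)
  bY′ : All (b ≢_) (labels Y)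
  bY′ = AllP.++⁻ˡ (labels Y) (All.tail bY)
  bZ′ : All (b ≢_) (labels Z)
  bZ′ = AllP.++⁻ˡ (labels Z) (AllP.++⁻ʳ (labels Y) (All.tail bY))
  no-av : ∀ {u} → R u → a ∈ u → v ∉ u
  no-av (inj₁ (inj₁ t)) a∈ _ = tet-avoids t (a≢v ∷ a≢b ∷ a≢c ∷ aX) a∈
  no-av (inj₁ (inj₂ t)) a∈ _ = tet-avoids t (I.a≢v ∷ a≢v ∷ a≢c ∷ I.aX) a∈
  no-av (inj₂ t) _           = tet-avoids t (≢-sym a≢v ∷ I.b≢v ∷ ≢-sym c≢v ∷ I.bY)
  no-bw : ∀ {u} → R u → b ∈ u → w ∉ u
  no-bw (inj₁ (inj₁ t)) _    = tet-avoids t (≢-sym I.b≢v ∷ ≢-sym (All.head bY) ∷ ≢-sym I.c≢v ∷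
                                 All.tabulate (λ x∈ → ≢-sym (All.head (XY x∈))))
  no-bw (inj₁ (inj₂ t)) b∈ _ = tet-avoids t (All.head bY ∷ b≢v ∷ b≢c ∷ bY′) b∈
  no-bw (inj₂ t) b∈ _        = tet-avoids t (≢-sym a≢b ∷ All.head bY ∷ b≢c ∷ bZ′) b∈

-- One end of each diagonal is reported to be a label. A label of a subtree occurs in no tetrahedron
-- outside it, so the condition of `extend-bistellar` holds at every level above.
⟶-bistellar : ∀ {a b c : Fin n} {T T′} → Good a b c T → T ⟶ T′ →
  ∃[ p ] ∃[ v ] ∃[ q ] ∃[ w ] ∃[ x ] Bistellar (Tet a b c T) (Tet a b c T′) p v q w x ×
    v L.∈ labels T × w L.∈ labels T
⟶-bistellar good (rotate₁₃ {X = X} {Y} {Z}) =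
  _ , _ , _ , _ , _ , bistellar₁₃ {X = X} {Y} {Z} good , here refl , there (LP.∈-++⁺ʳ (labels X) (here refl))
⟶-bistellar good (rotate₂₃ {X = X} {Y} {Z}) =
  _ , _ , _ , _ , _ , bistellar₂₃ {X = X} {Y} {Z} good , here refl , there (LP.∈-++⁺ʳ (labels X) (here refl))
⟶-bistellar good (rotate₁₂ {X = X} {Y} {Z}) =
  _ , _ , _ , _ , _ , bistellar₁₂ {X = X} {Y} {Z} good , here refl , there (LP.∈-++⁺ʳ (labels X) (here refl))
⟶-bistellar {a = a} {b} {c} good (child₁ {v} {X} {X′} {Y} {Z} s)
  with ng ← nodeGood {X = X} {Y} {Z} good
  with _ , _ , _ , _ , _ , B , v∈ , w∈ ← ⟶-bistellar {T = X} (NodeGood.good₁ ng) s =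
  _ , _ , _ , _ , _ ,
  extend-bistellar {E = Tet a b c (node v ∅ Y Z)} B (remove₁ , [ in₁ , restore₁ ]′) (remove₁ , [ in₁ , restore₁ ]′)
    (rest-avoids₁ ng v∈) (rest-avoids₁ ng w∈) ,
  there (LP.∈-++⁺ˡ v∈) , there (LP.∈-++⁺ˡ w∈)
⟶-bistellar {a = a} {b} {c} good (child₂ {v} {X} {Y} {Y′} {Z} s)
  with ng ← nodeGood {X = X} {Y} {Z} good
  with _ , _ , _ , _ , _ , B , v∈ , w∈ ← ⟶-bistellar {T = Y} (NodeGood.good₂ ng) s =
  _ , _ , _ , _ , _ ,
  extend-bistellar {E = Tet a b c (node v X ∅ Z)} B (remove₂ , [ in₂ , restore₂ ]′) (remove₂ , [ in₂ , restore₂ ]′)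
    (rest-avoids₂ ng v∈) (rest-avoids₂ ng w∈) ,
  there (LP.∈-++⁺ʳ (labels X) (LP.∈-++⁺ˡ v∈)) , there (LP.∈-++⁺ʳ (labels X) (LP.∈-++⁺ˡ w∈))
⟶-bistellar {a = a} {b} {c} good (child₃ {v} {X} {Y} {Z} {Z′} s)
  with ng ← nodeGood {X = X} {Y} {Z} good
  with _ , _ , _ , _ , _ , B , v∈ , w∈ ← ⟶-bistellar {T = Z} (NodeGood.good₃ ng) s =
  _ , _ , _ , _ , _ ,
  extend-bistellar {E = Tet a b c (node v X Y ∅)} B (remove₃ , [ in₃ , restore₃ ]′) (remove₃ , [ in₃ , restore₃ ]′)
    (rest-avoids₃ ng v∈) (rest-avoids₃ ng w∈) ,
  there (LP.∈-++⁺ʳ (labels X) (LP.∈-++⁺ʳ (labels Y) v∈)) , there (LP.∈-++⁺ʳ (labels X) (LP.∈-++⁺ʳ (labels Y) w∈))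

-- Degrees in the dual graph

Binary : Tree n → Set
Binary ∅              = Unit
Binary (node v X Y Z) = (X ≡ ∅ ⊎ Y ≡ ∅ ⊎ Z ≡ ∅) × Binary X × Binary Y × Binary Z

facet : (v a b c : Fin n) → Fin 4 → Subset n
facet v a b c 0F = ⟦ v ∷ b ∷ c ∷ [] ⟧
facet v a b c 1F = ⟦ a ∷ v ∷ c ∷ [] ⟧
facet v a b c 2F = ⟦ a ∷ b ∷ v ∷ [] ⟧
facet v a b c 3F = ⟦ a ∷ b ∷ c ∷ [] ⟧

which-facet : ∀ {v a b c : Fin n} {t} → Unique (v ∷ a ∷ b ∷ c ∷ []) → ∣ t ∣ ≡ 3 → t ⊆ ⟦ v ∷ a ∷ b ∷ c ∷ [] ⟧ →
              ∃[ i ] t ≡ facet v a b c i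
which-facet u ∣t∣ t⊆ with facets u ∣t∣ t⊆
... | inj₁ eq               = 0F , eq
... | inj₂ (inj₁ eq)        = 1F , eq
... | inj₂ (inj₂ (inj₁ eq)) = 2F , eq
... | inj₂ (inj₂ (inj₂ eq)) = 3F , eq

-- If the tetrahedron q has a boundary facet, then at most three of its
-- facets are shared, each of them with only one other tetrahedron.
boundary-facet⇒¬degree-4 : ∀ {F K : Faces n} {v a b c f} → Stacked m F → (∀ {u} → Tetrahedron K u → F u) →
  Unique (v ∷ a ∷ b ∷ c ∷ []) → Bd F f → f ⊆ ⟦ v ∷ a ∷ b ∷ c ∷ [] ⟧ →
  (Kq : Tetrahedron K ⟦ v ∷ a ∷ b ∷ c ∷ [] ⟧) → ¬ Degree (Λ K) (_ , Kq) 4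
boundary-facet⇒¬degree-4 {n = n} {F = F} {K} {v} {a} {b} {c} {f} st K⇒F u bd@(∣f∣ , _ , _ , only) f⊆q Kq
  (ns@(_ ∷ _ ∷ _ ∷ _ ∷ []) , refl , distinct , adj) =
  -- Five triangles, namely `f` and the intersections with four neighbours, fall into four facets.
  let i , j , i<j , eq = pigeonhole (n<1+n 4) (proj₁ ∘ index) in
  clash i j (F<⇒≢ i<j) (trans (proj₂ (index i)) (trans (cong (facet v a b c) eq) (sym (proj₂ (index j)))))
  where
  q : Subset n
  q = ⟦ v ∷ a ∷ b ∷ c ∷ [] ⟧
  w : Fin 4 → Subset n
  w i = proj₁ (lookup ns i)
  Fw : ∀ i → F (w i)
  Fw i = K⇒F (proj₂ (lookup ns i))
  ∣q∩w∣ : ∀ i → ∣ q ∩ w i ∣ ≡ 3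
  ∣q∩w∣ i = Equivalence.from (adj (lookup ns i)) (SetoidMem.∈-lookup (Graph.nodes (Λ K)) ns i)
  q≢w : ∀ i → q ≢ w i
  q≢w i eq with () ← trans (sym (∣q∩w∣ i)) (trans (cong ∣_∣ (trans (cong (q ∩_) (sym eq)) (∩-idem q))) (∣⟦⟧∣ u))
  w-injective : ∀ {i j} → w i ≡ w j → i ≡ j
  w-injective = lookup-injective proj₁ distinct
  g : Fin 5 → Subset n
  g zero    = f
  g (suc i) = q ∩ w i
  index : ∀ i → ∃[ j ] g i ≡ facet v a b c j
  index zero    = which-facet u ∣f∣ f⊆q
  index (suc i) = which-facet u (∣q∩w∣ i) (p∩q⊆p q (w i))
  Fq : F q
  Fq = K⇒F Kq
  f≢ : ∀ i → f ≢ q ∩ w i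
  f≢ i eq = q≢w i (trans (sym (only (Fq , f⊆q))) (only (Fw i , λ x∈ → p∩q⊆q q (w i) (subst (_ ∈_) eq x∈))))
  clash : ∀ i j → i ≢ j → g i ≢ g j
  clash zero    zero    i≢j _  = i≢j refl
  clash zero    (suc j) _   eq = f≢ j eq
  clash (suc i) zero    _   eq = f≢ i (sym eq)
  clash (suc i) (suc j) i≢j eq
    with ≤2-owners st (∣q∩w∣ i) (Fq , p∩q⊆p q (w i)) (Fw i , p∩q⊆q q (w i))
                      (Fw j , λ x∈ → p∩q⊆q q (w j) (subst (_ ∈_) eq x∈))
  ... | inj₁ e        = q≢w i e
  ... | inj₂ (inj₁ e) = q≢w j e
  ... | inj₂ (inj₂ e) = i≢j (cong suc (w-injective e))

-- The invariant for descending into subtrees. That the rest of `F` avoids the labels suffices,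
-- because the faces tested at a node all contain its apex.
Within : (F : Faces n) (a b c : Fin n) (T : Tree n) → Set
Within F a b c T = (∀ {u} → Tet a b c T u → F u) ×
                   (∀ {u} → F u → Tet a b c T u ⊎ All (_∉ u) (labels T))

module _ {F : Faces n} {a b c v : Fin n} {X Y Z : Tree n} (ng : NodeGood a b c v X Y Z)
         (wi : Within F a b c (node v X Y Z)) where

  within₁ : Within F v b c X
  within₁ = proj₁ wi ∘ in₁ , λ Fu →
    [ (λ p → map₂ (λ r → All.tabulate λ z∈ → rest-avoids₁ ng z∈ r) (remove₁ p))
    , (λ avoids → inj₂ (AllP.++⁻ˡ (labels X) (All.tail avoids))) ]′ (proj₂ wi Fu)

  within₂ : Within F a v c Y
  within₂ = proj₁ wi ∘ in₂ , λ Fu →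
    [ (λ p → map₂ (λ r → All.tabulate λ z∈ → rest-avoids₂ ng z∈ r) (remove₂ p))
    , (λ avoids → inj₂ (AllP.++⁻ˡ (labels Y) (AllP.++⁻ʳ (labels X) (All.tail avoids)))) ]′ (proj₂ wi Fu)

  within₃ : Within F a b v Z
  within₃ = proj₁ wi ∘ in₃ , λ Fu →
    [ (λ p → map₂ (λ r → All.tabulate λ z∈ → rest-avoids₃ ng z∈ r) (remove₃ p))
    , (λ avoids → inj₂ (AllP.++⁻ʳ (labels Y) (AllP.++⁻ʳ (labels X) (All.tail avoids)))) ]′ (proj₂ wi Fu)

HasBoundaryFacet : Faces n → Subset n → Set
HasBoundaryFacet F q = ∃[ v ] ∃[ a ] ∃[ b ] ∃[ c ] Unique (v ∷ a ∷ b ∷ c ∷ []) × q ≡ ⟦ v ∷ a ∷ b ∷ c ∷ [] ⟧ ×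
  ∃[ f ] Bd F f × f ⊆ ⟦ v ∷ a ∷ b ∷ c ∷ [] ⟧

-- The witness is the face towards an empty child. It contains the apex, so its owners lie in the
-- tree, and it contains the two corners that the other two subtrees have lost, so the node itself
-- is the only owner.
boundary-facet : ∀ {F : Faces n} {a b c T q} → Good a b c T → Binary T → Within F a b c T →
                 Tet a b c T q → HasBoundaryFacet F q
boundary-facet {F = F} {a} {b} {c} {node v X Y Z} good (empty , _) wi root =
  v , a , b , c , corners , refl , free empty
  where
  ng : NodeGood a b c v X Y Z
  ng = nodeGood good
  open NodeGood ng
  only : ∀ {t} → v ∈ t → (∀ {u} → Tet v b c X u → ¬ t ⊆ u) → (∀ {u} → Tet a v c Y u → ¬ t ⊆ u) →
         (∀ {u} → Tet a b v Z u → ¬ t ⊆ u) → ∀ {u} → F u → t ⊆ u → u ≡ ⟦ v ∷ a ∷ b ∷ c ∷ [] ⟧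
  only v∈t noX noY noZ Fu t⊆u with proj₂ wi Fu
  ... | inj₂ avoids   = contradiction (t⊆u v∈t) (All.head avoids)
  ... | inj₁ root    = refl
  ... | inj₁ (in₁ p) = ⊥-elim (noX p t⊆u)
  ... | inj₁ (in₂ p) = ⊥-elim (noY p t⊆u)
  ... | inj₁ (in₃ p) = ⊥-elim (noZ p t⊆u)
  noX : ∀ {t u} → a ∈ t → Tet v b c X u → ¬ t ⊆ u
  noX a∈t p t⊆u = tet-avoids p (a≢v ∷ a≢b ∷ a≢c ∷ aX) (t⊆u a∈t)
  noY : ∀ {t u} → b ∈ t → Tet a v c Y u → ¬ t ⊆ u
  noY b∈t p t⊆u = tet-avoids p (≢-sym a≢b ∷ b≢v ∷ b≢c ∷ bY) (t⊆u b∈t)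
  noZ : ∀ {t u} → c ∈ t → Tet a b v Z u → ¬ t ⊆ u
  noZ c∈t p t⊆u = tet-avoids p (≢-sym a≢c ∷ ≢-sym b≢c ∷ c≢v ∷ cZ) (t⊆u c∈t)
  free : X ≡ ∅ ⊎ Y ≡ ∅ ⊎ Z ≡ ∅ → ∃[ f ] Bd F f × f ⊆ ⟦ v ∷ a ∷ b ∷ c ∷ [] ⟧
  free (inj₁ refl) = _ , owned (∣face₁∣ ng) (proj₁ wi root) (face₁⊆ a b c v)
    (only {⟦ v ∷ b ∷ c ∷ [] ⟧} (1st {l = b ∷ c ∷ []}) (λ ()) (noY (2nd {l = c ∷ []})) (noZ (3rd {l = []}))) , face₁⊆ a b c v
  free (inj₂ (inj₁ refl)) = _ , owned (∣face₂∣ ng) (proj₁ wi root) (face₂⊆ a b c v)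
    (only {⟦ a ∷ v ∷ c ∷ [] ⟧} (2nd {l = c ∷ []}) (noX (1st {l = v ∷ c ∷ []})) (λ ()) (noZ (3rd {l = []}))) , face₂⊆ a b c v
  free (inj₂ (inj₂ refl)) = _ , owned (∣face₃∣ ng) (proj₁ wi root) (face₃⊆ a b c v)
    (only {⟦ a ∷ b ∷ v ∷ [] ⟧} (3rd {l = []}) (noX (1st {l = b ∷ v ∷ []})) (noY (2nd {l = v ∷ []})) (λ ())) , face₃⊆ a b c v
boundary-facet {T = node v X Y Z} good (_ , bX , _ , _) wi (in₁ p)
  with ng ← nodeGood {X = X} {Y} {Z} good = boundary-facet {T = X} (NodeGood.good₁ ng) bX (within₁ ng wi) p
boundary-facet {T = node v X Y Z} good (_ , _ , bY , _) wi (in₂ p)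
  with ng ← nodeGood {X = X} {Y} {Z} good = boundary-facet {T = Y} (NodeGood.good₂ ng) bY (within₂ ng wi) p
boundary-facet {T = node v X Y Z} good (_ , _ , _ , bZ) wi (in₃ p)
  with ng ← nodeGood {X = X} {Y} {Z} good = boundary-facet {T = Z} (NodeGood.good₃ ng) bZ (within₃ ng wi) p

binary⇒¬degree-4 : ∀ {K : Faces n} {a b c T} → Good a b c T → Binary T → Stacked m (Tet a b c T) →
  (∀ {u} → Tetrahedron K u → Tet a b c T u) → ∀ q → ¬ Degree (Λ K) q 4
binary⇒¬degree-4 {T = T} good bin st K⇒T (q , Kq) deg
  with v , a , b , c , u , refl , f , bd , f⊆q ← boundary-facet {T = T} good bin (id , inj₁) (K⇒T Kq) =
  boundary-facet⇒¬degree-4 st K⇒T u bd f⊆q Kq deg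

∣∩∣≡3 : ∀ {f q u : Subset n} → ∣ f ∣ ≡ 3 → f ⊆ q → f ⊆ u → ∣ q ∣ ≡ 4 → ∣ u ∣ ≡ 4 → q ≢ u → ∣ q ∩ u ∣ ≡ 3
∣∩∣≡3 {q = q} {u} ∣f∣ f⊆q f⊆u ∣q∣ ∣u∣ q≢u
  with x , x∈q , x∉u ← ⊈⇒∃∉ {p = q} {u} (λ q⊆u → q≢u (⊆∧∣≡∣⇒≡ q⊆u ∣q∣ ∣u∣)) =
  ≤-antisym
    (s≤s⁻¹ (≤-trans (p⊂q⇒∣p∣<∣q∣ (p∩q⊆p q u , x , x∈q , x∉u ∘ p∩q⊆q q u)) (≤-reflexive ∣q∣)))
    (≤-trans (≤-reflexive (sym ∣f∣)) (p⊆q⇒∣p∣≤∣q∣ λ x∈ → x∈p∩q⁺ (f⊆q x∈ , f⊆u x∈)))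

module _ {F K : Faces n} (st : Stacked m F) (F⇒K : ∀ {u} → F u → Tetrahedron K u)
         (K⇒F : ∀ {u} → Tetrahedron K u → F u) where

  -- The list of neighbours is complete by `≤2-owners`: a neighbour across a facet coincides with
  -- the given tetrahedron beyond that facet.
  degree-4 : ∀ {v a b c w₀ w₁ w₂ w₃} → Unique (v ∷ a ∷ b ∷ c ∷ []) → F ⟦ v ∷ a ∷ b ∷ c ∷ [] ⟧ →
    Unique (w₀ ∷ w₁ ∷ w₂ ∷ w₃ ∷ []) → All (⟦ v ∷ a ∷ b ∷ c ∷ [] ⟧ ≢_) (w₀ ∷ w₁ ∷ w₂ ∷ w₃ ∷ []) →
    (F₀ : F w₀) (F₁ : F w₁) (F₂ : F w₂) (F₃ : F w₃) →
    facet v a b c 0F ⊆ w₀ → facet v a b c 1F ⊆ w₁ → facet v a b c 2F ⊆ w₂ → facet v a b c 3F ⊆ w₃ →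
    (Kq : Tetrahedron K ⟦ v ∷ a ∷ b ∷ c ∷ [] ⟧) → Degree (Λ K) (_ , Kq) 4
  degree-4 {v} {a} {b} {c} {w₀} {w₁} {w₂} {w₃} uq@((va ∷ vb ∷ vc ∷ []) ∷ (ab ∷ ac ∷ []) ∷ (bc ∷ []) ∷ _) Fq uw
           (q≢₀ ∷ q≢₁ ∷ q≢₂ ∷ q≢₃ ∷ []) F₀ F₁ F₂ F₃ f₀ f₁ f₂ f₃ Kq =
    ns , refl , AllPairsP.map⁻ uw , λ w → mk⇔ (to w) (from w)
    where
    q : Subset n
    q = ⟦ v ∷ a ∷ b ∷ c ∷ [] ⟧
    open Graph (Λ K) using (Node; Adjacent; nodes)
    ns : List Node
    ns = (w₀ , F⇒K F₀) ∷ (w₁ , F⇒K F₁) ∷ (w₂ , F⇒K F₂) ∷ (w₃ , F⇒K F₃) ∷ []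
    g₀ : facet v a b c 0F ⊆ q
    g₀ = face₁⊆ a b c v
    g₁ : facet v a b c 1F ⊆ q
    g₁ = face₂⊆ a b c v
    g₂ : facet v a b c 2F ⊆ q
    g₂ = face₃⊆ a b c v
    g₃ : facet v a b c 3F ⊆ q
    g₃ = ⊆-insert v ⟦ a ∷ b ∷ c ∷ [] ⟧
    same : ∀ {t w w′} → t ⊆ q → t ⊆ w → F w → q ≢ w → F w′ → q ∩ w′ ≡ t → ∣ q ∩ w′ ∣ ≡ 3 → w′ ≡ w
    same {w = w} {w′} t⊆q t⊆w Fw q≢w Fw′ refl ∣t∣ with ≤2-owners st ∣t∣ (Fq , t⊆q) (Fw , t⊆w) (Fw′ , p∩q⊆q q w′)
    ... | inj₁ e        = contradiction e q≢w
    ... | inj₂ (inj₂ e) = sym e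
    ... | inj₂ (inj₁ refl) with () ← trans (sym ∣t∣) (trans (cong ∣_∣ (∩-idem q)) (∣⟦⟧∣ uq))
    to : ∀ w → Adjacent (q , Kq) w → SM._∈_ nodes w ns
    to (w , Kw) ∣∩∣ with facets uq ∣∩∣ (p∩q⊆p q w)
    ... | inj₁ eq               = here (same g₀ f₀ F₀ q≢₀ (K⇒F Kw) eq ∣∩∣)
    ... | inj₂ (inj₁ eq)        = there (here (same g₁ f₁ F₁ q≢₁ (K⇒F Kw) eq ∣∩∣))
    ... | inj₂ (inj₂ (inj₁ eq)) = there (there (here (same g₂ f₂ F₂ q≢₂ (K⇒F Kw) eq ∣∩∣)))
    ... | inj₂ (inj₂ (inj₂ eq)) = there (there (there (here (same g₃ f₃ F₃ q≢₃ (K⇒F Kw) eq ∣∩∣))))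
    shared : ∀ {t w} → ∣ t ∣ ≡ 3 → t ⊆ q → t ⊆ w → F w → q ≢ w → ∣ q ∩ w ∣ ≡ 3
    shared ∣t∣ t⊆q t⊆w Fw q≢w = ∣∩∣≡3 ∣t∣ t⊆q t⊆w (∣⟦⟧∣ uq) (pure st Fw) q≢w
    from : ∀ w → SM._∈_ nodes w ns → Adjacent (q , Kq) w
    from _ (here refl)                         =
      shared (∣⟦⟧∣ ((vb ∷ vc ∷ []) ∷ (bc ∷ []) ∷ [] ∷ [])) g₀ f₀ F₀ q≢₀
    from _ (there (here refl))                 =
      shared (∣⟦⟧∣ ((≢-sym va ∷ ac ∷ []) ∷ (vc ∷ []) ∷ [] ∷ [])) g₁ f₁ F₁ q≢₁
    from _ (there (there (here refl)))         =
      shared (∣⟦⟧∣ ((ab ∷ ≢-sym va ∷ []) ∷ (≢-sym vb ∷ []) ∷ [] ∷ [])) g₂ f₂ F₂ q≢₂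
    from _ (there (there (there (here refl)))) =
      shared (∣⟦⟧∣ ((ab ∷ ac ∷ []) ∷ (bc ∷ []) ∷ [] ∷ [])) g₃ f₃ F₃ q≢₃

  -- Three nonempty children and the tetrahedron `p` behind the root face would be four neighbours.
  -- They are distinct, since each misses a different one of `a`, `b`, `c`, `v` and contains the
  -- other three.
  some-child-empty : (∀ q → ¬ Degree (Λ K) q 4) → ∀ {a b c v} X Y Z {p} → Good a b c (node v X Y Z) →
    (∀ {u} → Tet a b c (node v X Y Z) u → F u) → F p → ⟦ a ∷ b ∷ c ∷ [] ⟧ ⊆ p → v ∉ p → X ≡ ∅ ⊎ Y ≡ ∅ ⊎ Z ≡ ∅
  some-child-empty ¬deg ∅ _ _ _ _ _ _ _ = inj₁ refl
  some-child-empty ¬deg (node _ _ _ _) ∅ _ _ _ _ _ _ = inj₂ (inj₁ refl)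
  some-child-empty ¬deg (node _ _ _ _) (node _ _ _ _) ∅ _ _ _ _ _ = inj₂ (inj₂ refl)
  some-child-empty ¬deg {a} {b} {c} {v} X@(node x X₁ X₂ X₃) Y@(node y Y₁ Y₂ Y₃) Z@(node z Z₁ Z₂ Z₃) {p} good T⇒F Fp abc⊆p v∉p =
    contradiction
      (degree-4 corners (T⇒F root)
        ((≢-by (2nd {l = v ∷ c ∷ []}) a∉X ∘ sym ∷ ≢-by (2nd {l = b ∷ v ∷ []}) a∉X ∘ sym ∷ ≢-by (2nd {l = b ∷ c ∷ []}) v∉p ∷ []) ∷
         (≢-by (3rd {l = v ∷ []}) b∉Y ∘ sym ∷ ≢-by (3rd {l = c ∷ []}) v∉p ∷ []) ∷
         (≢-by (4th {l = []}) v∉p ∷ []) ∷ [] ∷ [])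
        (≢-by (2nd {l = b ∷ c ∷ []}) a∉X ∷ ≢-by (3rd {l = c ∷ []}) b∉Y ∷ ≢-by (4th {l = []}) c∉Z ∷
         ≢-by (1st {l = a ∷ b ∷ c ∷ []}) v∉p ∷ [])
        (T⇒F (in₁ root)) (T⇒F (in₂ root)) (T⇒F (in₃ root)) Fp
        (⊆-insert x _) (⊆-insert y _) (⊆-insert z _) abc⊆p (F⇒K (T⇒F root)))
      (¬deg (⟦ v ∷ a ∷ b ∷ c ∷ [] ⟧ , F⇒K (T⇒F root)))
    where
    open NodeGood (nodeGood {X = X} {Y} {Z} good)
    ≢-by : ∀ {x : Fin n} {s t} → x ∈ s → x ∉ t → s ≢ t
    ≢-by x∈ x∉ refl = x∉ x∈
    a∉X : a ∉ ⟦ x ∷ v ∷ b ∷ c ∷ [] ⟧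
    a∉X = ∉⟦⟧ (All.head aX ∷ a≢v ∷ a≢b ∷ a≢c ∷ [])
    b∉Y : b ∉ ⟦ y ∷ a ∷ v ∷ c ∷ [] ⟧
    b∉Y = ∉⟦⟧ (All.head bY ∷ ≢-sym a≢b ∷ b≢v ∷ b≢c ∷ [])
    c∉Z : c ∉ ⟦ z ∷ a ∷ b ∷ v ∷ [] ⟧
    c∉Z = ∉⟦⟧ (All.head cZ ∷ ≢-sym a≢c ∷ ≢-sym b≢c ∷ c≢v ∷ [])

  ¬degree-4⇒binary : (∀ q → ¬ Degree (Λ K) q 4) → ∀ {a b c T p} → Good a b c T →
    (∀ {u} → Tet a b c T u → F u) → F p → ⟦ a ∷ b ∷ c ∷ [] ⟧ ⊆ p → (∀ {z} → z L.∈ labels T → z ∉ p) → Binary T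
  ¬degree-4⇒binary ¬deg {T = ∅} _ _ _ _ _ = tt
  ¬degree-4⇒binary ¬deg {a} {b} {c} {node v X Y Z} {p} good T⇒F Fp abc⊆p fresh =
    some-child-empty ¬deg X Y Z good T⇒F Fp abc⊆p (fresh (here refl)) ,
    ¬degree-4⇒binary ¬deg {T = X} good₁ (T⇒F ∘ in₁) (T⇒F root) (face₁⊆ a b c v) (root-avoids good ∘ LP.∈-++⁺ˡ) ,
    ¬degree-4⇒binary ¬deg {T = Y} good₂ (T⇒F ∘ in₂) (T⇒F root) (face₂⊆ a b c v)
      (root-avoids good ∘ LP.∈-++⁺ʳ (labels X) ∘ LP.∈-++⁺ˡ) ,
    ¬degree-4⇒binary ¬deg {T = Z} good₃ (T⇒F ∘ in₃) (T⇒F root) (face₃⊆ a b c v)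
      (root-avoids good ∘ LP.∈-++⁺ʳ (labels X) ∘ LP.∈-++⁺ʳ (labels Y))
    where
    open NodeGood (nodeGood {X = X} {Y} {Z} good)

-- Normal form and connectedness

infix 4 _~_
_~_ : Tree n → Tree n → Set
_~_ = EqClosure _⟶_

~-trans : ∀ {T T′ T″ : Tree n} → T ~ T′ → T′ ~ T″ → T ~ T″
~-trans = transitive _⟶_

~-node : ∀ {v} {X X′ Y Y′ Z Z′ : Tree n} → X ~ X′ → Y ~ Y′ → Z ~ Z′ → node v X Y Z ~ node v X′ Y′ Z′
~-node {v = v} {X′ = X′} {Y} {Y′} {Z} x y z =
  ~-trans (gmap (λ X → node v X Y Z) child₁ x)
    (~-trans (gmap (λ Y → node v X′ Y Z) child₂ y) (gmap (node v X′ Y′) child₃ z))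

~-refl : {T : Tree n} → T ~ T
~-refl = ε

comb rcomb : List (Fin n) → Tree n
comb []      = ∅
comb (v ∷ l) = node v (comb l) ∅ ∅
rcomb []      = ∅
rcomb (v ∷ l) = node v ∅ ∅ (rcomb l)

-- A rotation lifts the top `w` of the second comb above `v` and leaves the rest of that comb as the
-- second child of `v`. Both combs have an empty third child throughout.
join₁₂ : ∀ v (k l : List (Fin n)) → ∃[ l′ ] node v (comb k) (comb l) ∅ ~ comb l′
join₁₂ v k []      = v ∷ k , ~-refl
join₁₂ v k (w ∷ l) with l′ , e ← join₁₂ v k l =
  w ∷ l′ , ~-trans (return rotate₁₂) (~-node e ~-refl ~-refl)

join₁₃ : ∀ v (k l : List (Fin n)) → ∃[ l′ ] node v (comb k) ∅ (comb l) ~ comb l′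
join₁₃ v k []      = v ∷ k , ~-refl
join₁₃ v k (w ∷ l) with l′ , e ← join₁₃ v k l =
  w ∷ l′ , ~-trans (return rotate₁₃) (~-node e ~-refl ~-refl)

-- A node with an empty first child is rotated only against a third child whose
-- first child is empty as well, hence the detour through right combs.
join-rcomb : ∀ v (k l : List (Fin n)) → ∃[ l′ ] node v ∅ (comb k) (rcomb l) ~ comb l′
join-rcomb v k []      = join₁₂ v [] k
join-rcomb v k (w ∷ l) with k′ , e ← join₁₂ v [] k with l′ , e′ ← join-rcomb w k′ l =
  l′ , ~-trans (return rotate₂₃) (~-trans (~-node ~-refl e ~-refl) e′)

-- Inverse rotations carry the left spine over to the right one node at a time, with `l` as
-- accumulator. This is list reversal, hence `ʳ++`.
comb~rcomb : ∀ v (k l : List (Fin n)) → node v (comb k) ∅ (rcomb l) ~ rcomb (k ʳ++ v ∷ l)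
comb~rcomb v []      l = ~-refl
comb~rcomb v (w ∷ k) l = ~-trans (symmetric _⟶_ (return rotate₁₃)) (comb~rcomb w k (v ∷ l))

join₂₃ : ∀ v (k l : List (Fin n)) → ∃[ l′ ] node v ∅ (comb k) (comb l) ~ comb l′
join₂₃ v k []      = join₁₂ v [] k
join₂₃ v k (w ∷ l) with l′ , e ← join-rcomb v k (l ʳ++ w ∷ []) =
  -- `comb (w ∷ l)` is `node w (comb l) ∅ (rcomb [])`, so the accumulator starts empty.
  l′ , ~-trans (~-node ~-refl ~-refl (comb~rcomb w l [])) e

normalise : ∀ (T : Tree n) → Binary T → ∃[ l ] T ~ comb l
normalise ∅ _ = [] , ~-refl
normalise (node v ∅ Y Z) (inj₁ refl , _ , bY , bZ)
  with k , y ← normalise Y bY | l , z ← normalise Z bZ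
  with l′ , e ← join₂₃ v k l = l′ , ~-trans (~-node ~-refl y z) e
normalise (node v X ∅ Z) (inj₂ (inj₁ refl) , bX , _ , bZ)
  with k , x ← normalise X bX | l , z ← normalise Z bZ
  with l′ , e ← join₁₃ v k l = l′ , ~-trans (~-node x ~-refl z) e
normalise (node v X Y ∅) (inj₂ (inj₂ refl) , bX , bY , _)
  with k , x ← normalise X bX | l , y ← normalise Y bY
  with l′ , e ← join₁₂ v k l = l′ , ~-trans (~-node x y ~-refl) e

⟶-source-≢∅ : ∀ {T T′ : Tree n} → T ⟶ T′ → T ≢ ∅
⟶-source-≢∅ () refl

⟶-target-≢∅ : ∀ {T T′ : Tree n} → T ⟶ T′ → T′ ≢ ∅
⟶-target-≢∅ () refl

⟶-binary : ∀ {T T′ : Tree n} → T ⟶ T′ → Binary T → Binary T′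
⟶-binary rotate₁₃ (_ , bX , _ , _ , bY , _ , bZ) = inj₂ (inj₁ refl) , (inj₂ (inj₁ refl) , bX , tt , bY) , tt , bZ
⟶-binary rotate₂₃ (_ , _ , bX , _ , _ , bY , bZ) = inj₁ refl , tt , (inj₁ refl , tt , bX , bY) , bZ
⟶-binary rotate₁₂ (_ , bX , (_ , bY , bZ , _) , _) = inj₂ (inj₂ refl) , (inj₂ (inj₂ refl) , bX , bY , tt) , bZ , tt
⟶-binary (child₁ s) (inj₁ eq , _) = contradiction eq (⟶-source-≢∅ s)
⟶-binary (child₁ s) (inj₂ e , bX , bYZ) = inj₂ e , ⟶-binary s bX , bYZ
⟶-binary (child₂ s) (inj₂ (inj₁ eq) , _) = contradiction eq (⟶-source-≢∅ s)
⟶-binary (child₂ s) (inj₁ e , bX , bY , bZ) = inj₁ e , bX , ⟶-binary s bY , bZ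
⟶-binary (child₂ s) (inj₂ (inj₂ e) , bX , bY , bZ) = inj₂ (inj₂ e) , bX , ⟶-binary s bY , bZ
⟶-binary (child₃ s) (inj₂ (inj₂ eq) , _) = contradiction eq (⟶-source-≢∅ s)
⟶-binary (child₃ s) (inj₁ e , bX , bY , bZ) = inj₁ e , bX , bY , ⟶-binary s bZ
⟶-binary (child₃ s) (inj₂ (inj₁ e) , bX , bY , bZ) = inj₂ (inj₁ e) , bX , bY , ⟶-binary s bZ

⟵-binary : ∀ {T T′ : Tree n} → T ⟶ T′ → Binary T′ → Binary T
⟵-binary rotate₁₃ (_ , (_ , bX , _ , bY) , _ , bZ) = inj₂ (inj₁ refl) , bX , tt , inj₂ (inj₁ refl) , bY , tt , bZ
⟵-binary rotate₂₃ (_ , _ , (_ , _ , bX , bY) , bZ) = inj₁ refl , tt , bX , inj₁ refl , tt , bY , bZ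
⟵-binary rotate₁₂ (_ , (_ , bX , bY , _) , bZ , _) = inj₂ (inj₂ refl) , bX , (inj₂ (inj₂ refl) , bY , bZ , tt) , tt
⟵-binary (child₁ s) (inj₁ eq , _) = contradiction eq (⟶-target-≢∅ s)
⟵-binary (child₁ s) (inj₂ e , bX , bYZ) = inj₂ e , ⟵-binary s bX , bYZ
⟵-binary (child₂ s) (inj₂ (inj₁ eq) , _) = contradiction eq (⟶-target-≢∅ s)
⟵-binary (child₂ s) (inj₁ e , bX , bY , bZ) = inj₁ e , bX , ⟵-binary s bY , bZ
⟵-binary (child₂ s) (inj₂ (inj₂ e) , bX , bY , bZ) = inj₂ (inj₂ e) , bX , ⟵-binary s bY , bZ
⟵-binary (child₃ s) (inj₂ (inj₂ eq) , _) = contradiction eq (⟶-target-≢∅ s)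
⟵-binary (child₃ s) (inj₁ e , bX , bY , bZ) = inj₁ e , bX , bY , ⟵-binary s bZ
⟵-binary (child₃ s) (inj₂ (inj₁ e) , bX , bY , bZ) = inj₂ (inj₁ e) , bX , bY , ⟵-binary s bZ

labels-comb : ∀ (l : List (Fin n)) → labels (comb l) ≡ l
labels-comb []      = refl
labels-comb (v ∷ l) = cong (v ∷_) (trans (ListP.++-identityʳ _) (labels-comb l))

comb-binary : ∀ (l : List (Fin n)) → Binary (comb l)
comb-binary []      = tt
comb-binary (v ∷ l) = inj₂ (inj₁ refl) , comb-binary l , tt , tt

module _ (f : Fin m → Fin n) where

  comb-push⁺ : ∀ {a b c} l {w} → Tet a b c (comb l) w → Tet (f a) (f b) (f c) (comb (map f l)) (push f w)
  comb-push⁺ {a} {b} {c} (v ∷ l) root = subst (Tet _ _ _ _) (sym (push-⟦⟧ f (v ∷ a ∷ b ∷ c ∷ []))) root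
  comb-push⁺ (v ∷ l) (in₁ p) = in₁ (comb-push⁺ l p)

  comb-push⁻ : ∀ {a b c} l {u} → Tet (f a) (f b) (f c) (comb (map f l)) u → ∃[ w ] Tet a b c (comb l) w × u ≡ push f w
  comb-push⁻ {a} {b} {c} (v ∷ l) root = _ , root , sym (push-⟦⟧ f (v ∷ a ∷ b ∷ c ∷ []))
  comb-push⁻ (v ∷ l) (in₁ p) = let w , q , eq = comb-push⁻ l p in w , in₁ q , eq

-- Turns the list of corners and apexes of a comb into a relabelling of the vertices `0, 1, 2, …`.
enumerate : ∀ {A : Set} {l : List A} → Unique l → length l ≡ m →
            Σ[ f ∈ (Fin m → A) ] (∀ {i j} → f i ≡ f j → i ≡ j) × map f (allFin m) ≡ l
enumerate {l = l} u refl =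
  lookup l , lookup-injective id u , trans (ListP.map-tabulate id (lookup l)) (ListP.tabulate-lookup l)

-- From trees to nodes of the graph and back

record Model (n : ℕ) : Set where
  field
    {a b c} : Fin n
    tree    : Tree n
    good    : Good a b c tree
    size    : 3 + length (labels tree) ≡ n
    binary  : Binary tree

  tets : Faces n
  tets = Tet a b c tree

≐⇒≅ : ∀ {K L : Faces n} → K ≐ L → K ≅ L
≐⇒≅ {K = K} {L} (to , from) = idₚ , (λ {s} Ks → subst L (sym (image-id s)) (to Ks)) ,
  (λ {s} Ls → from (subst L (image-id s) Ls))

model-stacked : 4 ≤ n → (M : Model n) → Stacked n (Model.tets M)
model-stacked 4≤n record { tree = ∅ ; size = refl } with s≤s (s≤s (s≤s ())) ← 4≤n
model-stacked {n} 4≤n record { a = a ; b = b ; c = c ; tree = T@(node v X Y Z) ; good = good ; size = size } =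
  subst (λ k → Stacked k (Tet a b c T)) size (Tet-stacked {X = X} {Y} {Z} good)

module _ (k : ℕ) where

  private
    N : ℕ
    N = suc (3 + k)
    4≤N : 4 ≤ N
    4≤N = s≤s (s≤s (s≤s (s≤s z≤n)))
    stacked : (M : Model N) → Stacked N (Model.tets M)
    stacked = model-stacked 4≤N

  open Graph (𝒮⁰ N)

  abstract
    sphere-𝒮⁰ : (M : Model N) → Is𝒮⁰ N (∂ ⟨ Model.tets M ⟩)
    sphere-𝒮⁰ M = record
      { stackedSphere = Stacked⇒sphere (stacked M)
      ; noDegreeFour  = binary⇒¬degree-4 {T = tree} good binary (stacked M)
          (clique-tetrahedron⁻ (stacked M) (Stacked⇒cover (stacked M)) (id , id))
      }
      where open Model M

  sphere : Model N → Node
  sphere M = ∂ ⟨ Model.tets M ⟩ , sphere-𝒮⁰ M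

  rotate : (M : Model N) → ∀ {T} → Model.tree M ⟶ T → Model N
  rotate M {T} s = record
    { tree = T ; good = Unique-↭ (++⁺ˡ (a ∷ b ∷ c ∷ []) (⟶-labels s)) good
    ; size = trans (cong (3 +_) (sym (↭-length (⟶-labels s)))) size ; binary = ⟶-binary s binary }
    where open Model M

  unrotate : (M : Model N) → ∀ {T} → T ⟶ Model.tree M → Model N
  unrotate M {T} s = record
    { tree = T ; good = Unique-↭ (++⁺ˡ (a ∷ b ∷ c ∷ []) (↭-sym (⟶-labels s))) good
    ; size = trans (cong (3 +_) (↭-length (⟶-labels s))) size ; binary = ⟵-binary s binary }
    where open Model M

  flip-adjacent : ∀ x y → Flip (proj₁ x) (proj₁ y) → Adjacent x y
  flip-adjacent x y f = x , y , ≅-refl {K = proj₁ x} , ≅-refl {K = proj₁ y} , inj₁ f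

  rotation-flip : ∀ {a b c : Fin N} {T T′} → Good a b c T → T ⟶ T′ → Stacked N (Tet a b c T) → Stacked N (Tet a b c T′) →
                  Flip (∂ ⟨ Tet a b c T ⟩) (∂ ⟨ Tet a b c T′ ⟩)
  rotation-flip {T = T} good s st st′ with p , v , q , w , x , B , _ ← ⟶-bistellar {T = T} good s =
    p , v , q , w , Bistellar⇒FlipAt (pure st) (pure st′) B

  walk : (M : Model N) → ∀ {T} → Model.tree M ~ T →
         ∃[ M′ ] Model.tree M′ ≡ T × Path (𝒮⁰ N) (sphere M) (sphere M′)
  walk M ε = M , refl , ε
  walk M (fwd s ◅ e) with M′ , eq , path ← walk (rotate M s) e =
    M′ , eq , inj₂ (flip-adjacent (sphere M) (sphere (rotate M s))
      (rotation-flip (Model.good M) s (stacked M) (stacked (rotate M s)))) ◅ path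
  walk M (bwd s ◅ e) with M′ , eq , path ← walk (unrotate M s) e =
    M′ , eq , inj₂ (Adjacent-sym {sphere (unrotate M s)} {sphere M} (flip-adjacent (sphere (unrotate M s)) (sphere M)
      (rotation-flip {T = Model.tree (unrotate M s)} (Model.good (unrotate M s)) s (stacked (unrotate M s)) (stacked M)))) ◅ path

  standard : Model N
  standard = record
    { tree   = comb l
    ; good   = subst (λ l → Unique (0F ∷ 1F ∷ 2F ∷ l)) (sym (labels-comb l)) (UniqueP.allFin⁺ N)
    ; size   = trans (cong ((3 +_) ∘ length) (labels-comb l)) (ListP.length-tabulate {n = N} id)
    ; binary = comb-binary l }
    where
    l : List (Fin N)
    -- The apexes continue the corners `0F`, `1F`, `2F`, so that all of them together are `allFin N`
    -- in order.
    l = tabulate (λ i → suc (suc (suc i)))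

  -- The shape of a comb is fixed by its length, so the bijection between the two vertex lists
  -- carries tetrahedra to tetrahedra.
  comb≈standard : (M : Model N) → ∀ {l} → Model.tree M ≡ comb l → sphere M ≈ sphere standard
  comb≈standard M@record { a = a ; b = b ; c = c ; good = good ; size = size } {l} refl
    with f , inj , eq ← enumerate {l = a ∷ b ∷ c ∷ l} (subst (λ l → Unique (a ∷ b ∷ c ∷ l)) (labels-comb l) good)
           (trans (cong ((3 +_) ∘ length) (sym (labels-comb l))) size)
    with refl ← eq =
    Image⇒≅ (λ s⊆t (u , Fu , t⊆u) → u , Fu , t⊆u ∘ s⊆t) (pure (stacked M)) inj
      ( (λ p → let w , q , eq = comb-push⁻ f r p in w , tetrahedron⁺ (pure (stacked standard)) q , eq)
      , (λ { (w , Kw , refl) → comb-push⁺ f r (tetrahedron⁻ (pure (stacked standard)) Kw) }))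
    where
    r : List (Fin N)
    r = tabulate (λ i → suc (suc (suc i)))

  -- The tetrahedron glued last is a leaf of the dual graph. From one of its side faces, the whole
  -- old ball lies beyond the first child. A single tetrahedron is a leaf already, so its starting
  -- facet is chosen arbitrarily.
  unfold-root : ∀ {B : Faces N} → StackedBall N B → ∀ {f : Fin N → Fin N} → Inj f →
                ∃[ s ] Σ[ U ∈ Unfolding f B s ] ∃[ p ] ∃[ T ] Unfolding.T U ≡ node p T ∅ ∅
  unfold-root tetrahedron inj = t , U₀ , leaf (Unfolding.T U₀) (Unfolding.size U₀)
    where
    t : Subset 4
    t = outside ∷ inside ∷ inside ∷ inside ∷ []
    U₀ : Unfolding _ _ t
    U₀ = unfold-tetrahedron inj refl
    leaf : ∀ T → 3 + length (labels T) ≡ 4 → ∃[ p ] ∃[ T′ ] T ≡ node p T′ ∅ ∅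
    leaf (node v ∅ ∅ ∅) refl = v , ∅ , refl
    leaf (node v (node _ _ _ _) _ _) ()
    leaf (node v ∅ (node _ _ _ _) _) ()
    leaf (node v ∅ ∅ (node _ _ _ _)) ()
  unfold-root (stack {t = t} sb bt) {f} inj =
    pull f ⟦ f zero ∷ b ∷ c ∷ [] ⟧ , unfold₁ inj bt U (push-pull f {w = inside ∷ t} ⊆cone) , Unfolding.a U , Unfolding.T U , refl
    where
    U : Unfolding (f ∘ suc) _ t
    U = unfold sb (∘suc-inj inj) bt
    open Unfolding U using (b; c; face)
    ⊆cone : ⟦ f zero ∷ b ∷ c ∷ [] ⟧ ⊆ push f (inside ∷ t)
    ⊆cone = insert-mono (λ x∈ → subst (_ ∈_) (sym face) (⊆-insert _ _ x∈))

  -- The ball is renamed along the given isomorphism during the unfolding. The boundary of the tree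
  -- then equals `S` itself and not only a copy, so the condition on `Clique S` transfers directly.
  model : (x : Node) → ∃[ M ] x ≈ sphere M
  model (S , is) with record { stackedSphere = record { isBall = sb ; ≅-boundary = π , to , from } ; noDegreeFour = ¬deg } ← is
    with s , record { a = a ; b = b ; c = c ; T = T ; tets = tets ; good = good ; size = size } , p , T′ , refl ←
           unfold-root sb {π ⟨$⟩ˡ_} (λ eq → trans (sym (inverseʳ π)) (trans (cong (π ⟨$⟩ʳ_) eq) (inverseʳ π))) =
    record { tree = T ; good = good ; size = size ; binary = inj₂ (inj₁ refl) , binary′ , tt , tt } , ≐⇒≅ S≐
    where
    st : Stacked N (Tet a b c T)
    st = subst (λ k → Stacked k (Tet a b c T)) size (Tet-stacked {X = T′} {∅} {∅} good)
    ∂≐ : ∂ ⟨ Tet a b c T ⟩ ≐ _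
    ∂≐ = ∂-permute (ball-closed sb) (pure st) π tets
    S≐ : S ≐ ∂ ⟨ Tet a b c T ⟩
    S≐ = proj₂ ∂≐ ∘ to , from ∘ proj₁ ∂≐
    binary′ : Binary T′
    -- The root tetrahedron serves as the one behind the root face of `T′`.
    binary′ = ¬degree-4⇒binary st (clique-tetrahedron⁺ st (Stacked⇒cover st) S≐)
      (clique-tetrahedron⁻ st (Stacked⇒cover st) S≐) ¬deg {T = T′} (NodeGood.good₁ (nodeGood {X = T′} {∅} {∅} good))
      in₁ root (face₁⊆ a b c p) (root-avoids good ∘ LP.∈-++⁺ˡ)

  ≈⇒path : ∀ x y → x ≈ y → Path (𝒮⁰ N) x y
  ≈⇒path x y e = inj₁ e ◅ ε

  to-standard : ∀ x → Path (𝒮⁰ N) x (sphere standard)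
  to-standard x with M , x≈M ← model x with l , e ← normalise (Model.tree M) (Model.binary M)
    with M′ , eq , path ← walk M e =
    ≈⇒path x (sphere M) x≈M ◅◅ path ◅◅ ≈⇒path (sphere M′) (sphere standard) (comb≈standard M′ {l} eq)

  path-sym : ∀ x y → Path (𝒮⁰ N) x y → Path (𝒮⁰ N) y x
  path-sym _ _ ε = ε
  path-sym x z (_◅_ {j = y} (inj₁ e) p) = path-sym y z p ◅◅ ≈⇒path y x (≅-sym {K = proj₁ x} {proj₁ y} e)
  path-sym x z (_◅_ {j = y} (inj₂ e) p) = path-sym y z p ◅◅ (inj₂ (Adjacent-sym {x} {y} e) ◅ ε)

  connected : Connected (𝒮⁰ N)
  connected = sphere standard , λ x y → to-standard x ◅◅ path-sym y (sphere standard) (to-standard y)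

theorem4p9 : (n : ℕ) → 4 ≤ n → Connected (𝒮⁰ n)
theorem4p9 _ (s≤s (s≤s (s≤s (s≤s {n = k} z≤n)))) = connected k
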